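{- Let $G$ be a claw-free innocent graph. Then $G$ has a strong stable set.
   Context: All graphs are finite and simple. A graph $G$ contains a graph $H$ if some induced subgraph of $G$ is isomorphic to $H$. A clique is a set of pairwise adjacent vertices, a stable set is a set of pairwise non-adjacent vertices, and a stable set of $G$ is strong if it meets every (inclusion-wise) maximal clique of $G$. A claw is $K_{1,3}$; $G$ is claw-free if it contains no claw. A path is a sequence of distinct vertices $p_0\hbox{ - }p_1\hbox{ - }\dots\hbox{ - }p_k$ such that $p_i$ is adjacent to $p_j$ if and only if $|i-j|=1$; its length is $k$, and it is odd or even according to $k$. For $k\ge 4$, a hole of length $k$ is an induced subgraph isomorphic to the cycle $C_k$, an antihole of length $k$ is an induced subgraph isomorphic to the complement of $C_k$; holes are odd/even according to their length. A prism consists of two vertex-disjoint triangles $\{a_1,a_2,a_3\}$, $\{b_1,b_2,b_3\}$ and three paths $P_1,P_2,P_3$, $P_i$ having ends $a_i,b_i$, such that for $i<j$ the only edges between $V(P_i)$ and $V(P_j)$ are $a_ia_j$ and $b_ib_j$; it is odd if $P_1,P_2,P_3$ all have odd length. A handcuff consists of two vertex-disjoint even holes $C_1,C_2$ and a path $p_1\hbox{ - }\dots\hbox{ - }p_r$ of odd length, disjoint from them, such that $p_1$ has exactly two neighbours in $V(C_1)$ and they are adjacent, $p_r$ has exactly two neighbours in $V(C_2)$ and they are adjacent, and there are no other edges among $V(C_1)$, $V(C_2)$ and the path. An eye mask consists of two vertex-disjoint even holes $C_1,C_2$ and edges $x_1y_1$ of $C_1$, $x_2y_2$ of $C_2$ such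 that $\{x_1,y_1\}$ is complete to $\{x_2,y_2\}$ and there are no other edges between $V(C_1)$ and $V(C_2)$. A graph is innocent if it contains no odd hole, no antihole of length at least six, no odd prism, no handcuff and no eye mask. -}

module Defs where

open import Data.Nat using (ℕ; zero; suc; _+_; _*_; _≤_; _<_; _≡ᵇ_)
open import Data.Bool using (Bool; true; false; _∧_; _∨_; not; if_then_else_)
open import Data.Fin using (Fin; toℕ)
import Data.Fin as F
open import Data.Fin.Subset using (Subset; _∈_; _∉_)
open import Data.Product using (Σ; _×_; _,_; ∃; ∃-syntax)
open import Data.Sum using (_⊎_; inj₁; inj₂)
open import Relation.Binary.PropositionalEquality using (_≡_; _≢_)
open import Relation.Nullary.Decidable using (⌊_⌋)
open import Function.Definitions using (Injective)

record Graph : Set where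
  field
    n     : ℕ
    adj   : Fin n → Fin n → Bool
    sym   : ∀ x y → adj x y ≡ adj y x
    irrefl : ∀ x → adj x x ≡ false

open Graph public

Contains : (G : Graph) {V : Set} → (V → V → Bool) → Set
Contains G {V} E =
  Σ (V → Fin (n G)) λ f →
    Injective _≡_ _≡_ f × (∀ x y → adj G (f x) (f y) ≡ E x y)

Odd : ℕ → Set
Odd k = ∃[ m ] (k ≡ suc (2 * m))

Even : ℕ → Set
Even k = ∃[ m ] (k ≡ 2 * m)

pathAdjℕ : ℕ → ℕ → Bool
pathAdjℕ i j = (suc i ≡ᵇ j) ∨ (suc j ≡ᵇ i)

cycleAdjℕ : ℕ → ℕ → ℕ → Bool
cycleAdjℕ k i j = pathAdjℕ i j ∨ ((i ≡ᵇ 0) ∧ (suc j ≡ᵇ k)) ∨ ((j ≡ᵇ 0) ∧ (suc i ≡ᵇ k))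

cycleAdj : (k : ℕ) → Fin k → Fin k → Bool
cycleAdj k i j = cycleAdjℕ k (toℕ i) (toℕ j)

antiCycleAdj : (k : ℕ) → Fin k → Fin k → Bool
antiCycleAdj k i j = not (cycleAdj k i j) ∧ not (toℕ i ≡ᵇ toℕ j)

clawAdj : Fin 4 → Fin 4 → Bool
clawAdj i j = not (toℕ i ≡ᵇ toℕ j) ∧ ((toℕ i ≡ᵇ 0) ∨ (toℕ j ≡ᵇ 0))

HasHoleOfLength : Graph → ℕ → Set
HasHoleOfLength G k = 4 ≤ k × Contains G (cycleAdj k)

HasOddHole : Graph → Set
HasOddHole G = ∃[ k ] (Odd k × HasHoleOfLength G k)

HasLongAntihole : Graph → Set
HasLongAntihole G = ∃[ k ] (6 ≤ k × Contains G (antiCycleAdj k))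

ClawFree : Graph → Set
ClawFree G = Contains G clawAdj → Data.Empty.⊥
  where import Data.Empty

-- Prism with paths P_i = p_{i,0} - ... - p_{i,k_i}, a_i = p_{i,0},
-- b_i = p_{i,k_i} (k_i ≥ 1 since the triangles are disjoint).
-- Vertices: pairs (i , j) with i : Fin 3, j ≤ k_i.

PrismV : (Fin 3 → ℕ) → Set
PrismV k = Σ (Fin 3) λ i → Fin (suc (k i))

prismAdj : (k : Fin 3 → ℕ) → PrismV k → PrismV k → Bool
prismAdj k (i , j) (i' , j') =
  if ⌊ i F.≟ i' ⌋
  then pathAdjℕ (toℕ j) (toℕ j')
  else (((toℕ j ≡ᵇ 0) ∧ (toℕ j' ≡ᵇ 0))
        ∨ ((toℕ j ≡ᵇ k i) ∧ (toℕ j' ≡ᵇ k i')))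

HasOddPrism : Graph → Set
HasOddPrism G =
  ∃[ k ] ((∀ i → 1 ≤ k i) × (∀ i → Odd (k i)) × Contains G (prismAdj k))

-- Handcuff: even holes C_1 (length a) and C_2 (length b), path
-- p_1 - ... - p_r (r vertices, odd length r - 1).  Labelling the holes
-- so that the two (adjacent) neighbours of p_1 in C_1 are vertices 0,1
-- of C_1 and the neighbours of p_r in C_2 are vertices 0,1 of C_2.
-- Path vertices p_1..p_r are indexed 0..r-1.

HandcuffV : ℕ → ℕ → ℕ → Set
HandcuffV a r b = Fin a ⊎ (Fin r ⊎ Fin b)

isFirstTwo : ℕ → Bool
isFirstTwo c = (c ≡ᵇ 0) ∨ (c ≡ᵇ 1)

handcuffAdj : (a r b : ℕ) → HandcuffV a r b → HandcuffV a r b → Bool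
handcuffAdj a r b (inj₁ x) (inj₁ y) = cycleAdj a x y
handcuffAdj a r b (inj₂ (inj₂ x)) (inj₂ (inj₂ y)) = cycleAdj b x y
handcuffAdj a r b (inj₂ (inj₁ p)) (inj₂ (inj₁ q)) = pathAdjℕ (toℕ p) (toℕ q)
handcuffAdj a r b (inj₁ x) (inj₂ (inj₁ p)) = isFirstTwo (toℕ x) ∧ (toℕ p ≡ᵇ 0)
handcuffAdj a r b (inj₂ (inj₁ p)) (inj₁ x) = isFirstTwo (toℕ x) ∧ (toℕ p ≡ᵇ 0)
handcuffAdj a r b (inj₂ (inj₂ x)) (inj₂ (inj₁ p)) = isFirstTwo (toℕ x) ∧ (suc (toℕ p) ≡ᵇ r)
handcuffAdj a r b (inj₂ (inj₁ p)) (inj₂ (inj₂ x)) = isFirstTwo (toℕ x) ∧ (suc (toℕ p) ≡ᵇ r)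
handcuffAdj a r b (inj₁ x) (inj₂ (inj₂ y)) = false
handcuffAdj a r b (inj₂ (inj₂ y)) (inj₁ x) = false

HasHandcuff : Graph → Set
HasHandcuff G =
  ∃[ a ] ∃[ r ] ∃[ b ]
    (4 ≤ a × Even a × 4 ≤ b × Even b × 1 ≤ r × Odd (r Data.Nat.∸ 1)
     × Contains G (handcuffAdj a r b))
  where import Data.Nat

-- Eye mask: even holes C_1 (length a), C_2 (length b); the edges x_1y_1
-- and x_2y_2 are labelled as vertices 0,1 of C_1 and of C_2.

eyeMaskAdj : (a b : ℕ) → Fin a ⊎ Fin b → Fin a ⊎ Fin b → Bool
eyeMaskAdj a b (inj₁ x) (inj₁ y) = cycleAdj a x y
eyeMaskAdj a b (inj₂ x) (inj₂ y) = cycleAdj b x y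
eyeMaskAdj a b (inj₁ x) (inj₂ y) = isFirstTwo (toℕ x) ∧ isFirstTwo (toℕ y)
eyeMaskAdj a b (inj₂ x) (inj₁ y) = isFirstTwo (toℕ x) ∧ isFirstTwo (toℕ y)

HasEyeMask : Graph → Set
HasEyeMask G =
  ∃[ a ] ∃[ b ] (4 ≤ a × Even a × 4 ≤ b × Even b × Contains G (eyeMaskAdj a b))

Innocent : Graph → Set
Innocent G =
  ¬ HasOddHole G × ¬ HasLongAntihole G × ¬ HasOddPrism G
  × ¬ HasHandcuff G × ¬ HasEyeMask G
  where open import Relation.Nullary using (¬_)

IsClique : (G : Graph) → Subset (n G) → Set
IsClique G K = ∀ x y → x ∈ K → y ∈ K → x ≢ y → adj G x y ≡ true

IsMaximalClique : (G : Graph) → Subset (n G) → Set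
IsMaximalClique G K =
  IsClique G K ×
  (∀ v → v ∉ K → ∃[ u ] (u ∈ K × u ≢ v × adj G u v ≡ false))

IsStable : (G : Graph) → Subset (n G) → Set
IsStable G S = ∀ x y → x ∈ S → y ∈ S → adj G x y ≡ false

IsStrongStable : (G : Graph) → Subset (n G) → Set
IsStrongStable G S =
  IsStable G S × (∀ K → IsMaximalClique G K → ∃[ v ] (v ∈ S × v ∈ K))

module Submission where

-- Induction on the number of vertices: every proper nonempty set of vertices induces a graph with a strong
-- stable set.
--
-- Without a 4-wheel, any stable set S missing a maximal clique K can be exchanged for one that hits K and all
-- maximal cliques hit by S. Among the maximal cliques through s ∈ S that avoid a neighbour l ∉ S, all contain a
-- common vertex r nonadjacent to l; so s can be traded for l and r, then the second S-neighbour of r has to be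
-- traded, and so on along an induced path. If this path never meets itself the exchange succeeds, and
-- otherwise it closes to an even hole with a tail. If some v ∈ K has at most one neighbour in S, a second
-- path starting in K cannot also close up. Otherwise three members of K and their S-neighbours form a
-- 3-sun, and the paths from two of its three tips cannot both close up. Two closed paths would give a handcuff
-- or an eye mask, or an odd hole or an odd prism if they meet.
--
-- With a 4-wheel, take Z maximal, connected in the complement, such that Z and the set A of vertices complete
-- to Z both contain nonadjacent pairs and one of them contains an induced path on three vertices. By
-- induction A has a strong stable pair c , d, and every maximal clique meeting A ∪ Z contains c or d. In each
-- component N of the remaining graph a stable set free of neighbours of c and d and hitting the maximal cliques
-- inside N comes from induction on N ∪ {c , d , u , v} with u , v nonadjacent in Z: the members of N with
-- neighbours in A ∪ Z are all adjacent to the same one of c and d, and otherwise two paths of lengths 2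
-- and 3 between the same ends would close an odd hole or an odd prism.

open import Defs
open import Data.Bool using (Bool; true; false; not; _∧_; _∨_; _xor_; _≟_)
open import Data.Bool.Properties using (∨-identityʳ; ∧-comm; ∧-zeroʳ)
open import Data.Empty using (⊥; ⊥-elim)
open import Data.Fin as F using (Fin; zero; suc; toℕ; fromℕ<; punchIn; punchOut)
open import Data.Fin.Properties using (toℕ-injective; any?; all?; punchIn-injective; punchIn-punchOut)
open import Data.Fin.Subset using () renaming (_∈_ to _∈ˢ_)
open import Data.List using (List; []; _∷_; _++_; length; lookup; reverse; filter; allFin; map)
import Data.List.Membership.DecPropositional as DecMem
open import Data.List.Membership.Propositional using (_∈_; lose; _∉_)
open import Data.List.Membership.Propositional.Properties using (∈-allFin; ∈-filter⁺; ∈-++⁺ˡ; ∈-++⁺ʳ; ∈-++⁻; ∈-map⁺)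
open import Data.List.Properties using (length-++; length-reverse; unfold-reverse; ++-assoc; filter-notAll; reverse-++; ++-identityʳ; ∷-injectiveʳ)
open import Data.List.Relation.Unary.All as All using (All; []; _∷_)
open import Data.List.Relation.Unary.All.Properties using (++⁺; ++⁻ˡ; ++⁻ʳ; ∷ʳ⁺)
open import Data.List.Relation.Unary.Any using (here; there)
import Data.List.Relation.Unary.Any.Properties as AnyP
open import Data.Nat using (ℕ; zero; suc; _+_; _≤_; z≤n; s≤s; _≡ᵇ_; _<_)
open import Data.Nat.Properties using (*-suc; ≤-trans; ≤-pred; ≤-refl)
open import Data.Product using (∃; _×_; _,_; proj₁; proj₂; ∃-syntax)
open import Data.Sum using (_⊎_; inj₁; inj₂; [_,_]′)
open import Data.Unit using (⊤; tt)
open import Data.Vec using (Vec; []; _∷_; tabulate) renaming (lookup to lookupᵛ)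
open import Data.Vec.Properties using (lookup∘tabulate; []=⇒lookup; lookup⇒[]=)
open import Function.Definitions using (Injective)
open import Relation.Binary.PropositionalEquality using (_≡_; _≢_; refl; cong; cong₂; trans; subst) renaming (sym to ≡-sym)
open import Relation.Nullary using (¬_; yes; no; Dec)
open import Relation.Nullary.Decidable using (⌊_⌋; ¬?; _×-dec_; _→-dec_; map′; _⊎-dec_)

-- The case distinction comes from the choice of `r`. It needs the vertices of `N(s)` outside `N[l]`
-- to have comparable neighbourhoods in `N(s) ∩ N(l)`, and two incomparable ones produce a 4-wheel
-- or a five-hole. Parity governs the legs. A leg grows by two vertices at a time, one outside `S`
-- and one in it, so the place where a chord ends decides the parity of the cycle that it closes,
-- and one of the two parities is an odd hole. The induction is stated for vertex sets because the
-- wheel case draws on it for two different proper subsets: the part of `A` in which every vertex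
-- has a non-neighbour, and a component with four vertices added. The induced path on three vertices
-- demanded of `A` or `Z` makes the second set proper; it also refutes the components that are
-- attached to `A` and `Z` in two different ways. Nonemptiness matters: in the empty graph the empty
-- set is a maximal clique that nothing meets.

lookup⁺ : ∀ {A : Set} {P : A → Set} {xs} → All P xs → ∀ i → P (lookup xs i)
lookup⁺ (p ∷ ps) zero    = p
lookup⁺ (p ∷ ps) (suc i) = lookup⁺ ps i

-- Parity as a Boolean

odd? : ℕ → Bool
odd? zero    = false
odd? (suc m) = not (odd? m)

not-true : ∀ {b} → not b ≡ true → b ≡ false
not-true {false} _ = refl

not-false : ∀ {b} → not b ≡ false → b ≡ true
not-false {true} _ = refl

odd?-sound  : ∀ m → odd? m ≡ true → Odd m
even?-sound : ∀ m → odd? m ≡ false → Even m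
odd?-sound (suc m) e with even?-sound m (not-true e)
... | h , refl = h , refl
even?-sound zero _ = 0 , refl
even?-sound (suc m) e with odd?-sound m (not-false e)
... | h , refl = suc h , ≡-sym (*-suc 2 h)

-- Paths, holes and prisms as lists of vertices

module Base (G : Graph) where

  V : Set
  V = Fin (n G)

  infix 4 _~_ _#_

  _~_ : V → V → Set
  x ~ y = adj G x y ≡ true

  -- Distinctness is included, so that an induced path described by `~` and `#` lists its vertices
  -- without repetition.
  _#_ : V → V → Set
  x # y = adj G x y ≡ false × x ≢ y

  Rel : Bool → V → V → Set
  Rel b x y = adj G x y ≡ b × x ≢ y

  t≢f : ∀ {b : Bool} → b ≡ true → b ≡ false → ⊥
  t≢f refl ()

  ~-sym : ∀ {x y} → x ~ y → y ~ x
  ~-sym {x} {y} e = trans (Graph.sym G y x) e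

  #-sym : ∀ {x y} → x # y → y # x
  #-sym {x} {y} (e , d) = trans (Graph.sym G y x) e , λ q → d (≡-sym q)

  ~⇒≢ : ∀ {x y} → x ~ y → x ≢ y
  ~⇒≢ {x} e refl = t≢f e (irrefl G x)

  ~#⊥ : ∀ {x y} → x ~ y → x # y → ⊥
  ~#⊥ a (b , _) = t≢f a b

  ~⇒Rel : ∀ {x y} → x ~ y → Rel true x y
  ~⇒Rel a = a , ~⇒≢ a

  data Tri (x y : V) : Set where
    eq : x ≡ y → Tri x y
    ad : x ~ y → Tri x y
    na : x # y → Tri x y

  tri : ∀ x y → Tri x y
  tri x y with x F.≟ y
  ... | yes e = eq e
  ... | no d with adj G x y in e
  ...   | true  = ad e
  ...   | false = na (e , d)

  data AdN (x y : V) : Set where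
    ad : x ~ y → AdN x y
    na : x # y → AdN x y

  adn : ∀ x y → x ≢ y → AdN x y
  adn x y d with adj G x y in e
  ... | true  = ad e
  ... | false = na (e , d)

  IndPath : List V → Set
  IndPath []           = ⊤
  IndPath (x ∷ [])     = ⊤
  IndPath (x ∷ y ∷ zs) = x ~ y × All (x #_) zs × IndPath (y ∷ zs)

  LastAdj : V → List V → Set
  LastAdj x []            = ⊥
  LastAdj x (z ∷ [])      = x ~ z
  LastAdj x (z ∷ z′ ∷ zs) = x # z × LastAdj x (z′ ∷ zs)

  -- The closing edge joins x to the last vertex of zs.
  Hole : V → V → List V → Set
  Hole x y zs = x ~ y × LastAdj x zs × IndPath (y ∷ zs)

  -- A path whose last vertex is adjacent to exactly h₀ and h₁ in the hole h₀ , h₁ , hs,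
  -- and whose other vertices have no neighbour there.
  Attached : List V → V → V → List V → Set
  Attached []           h₀ h₁ hs = ⊥
  Attached (x ∷ [])     h₀ h₁ hs = x ~ h₀ × x ~ h₁ × All (x #_) hs
  Attached (x ∷ y ∷ zs) h₀ h₁ hs = All (x #_) (h₀ ∷ h₁ ∷ hs) × Attached (y ∷ zs) h₀ h₁ hs

  LastLast : List V → List V → Set
  LastLast []            ys = ⊥
  LastLast (x ∷ [])      ys = LastAdj x ys
  LastLast (x ∷ x′ ∷ xs) ys = All (x #_) ys × LastLast (x′ ∷ xs) ys

  -- The cross edges of a prism: first-first and last-last.
  Rungs : V → List V → V → List V → Set
  Rungs x xs y ys = x ~ y × All (x #_) ys × All (_# y) xs × LastLast xs ys

  -- Since `Rel` includes distinctness, one case analysis over pairs of indices yields injectivity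
  -- and adjacency together. On the diagonal `Rel` fails and `loopless` takes over.
  mkContains : {W : Set} (E : W → W → Bool) (f : W → V) → (∀ i → E i i ≡ false) →
               (∀ i j → i ≡ j ⊎ Rel (E i j) (f i) (f j)) → Contains G E
  mkContains {W} E f loopless h = f , inj , same
    where
    inj : ∀ {i j} → f i ≡ f j → i ≡ j
    inj {i} {j} e with h i j
    ... | inj₁ p       = p
    ... | inj₂ (_ , d) = ⊥-elim (d e)
    same : ∀ i j → adj G (f i) (f j) ≡ E i j
    same i j with h i j
    ... | inj₁ refl    = trans (irrefl G (f i)) (≡-sym (loopless i))
    ... | inj₂ (e , _) = e

  Rel-sym : ∀ {b x y} → Rel b x y → Rel b y x
  Rel-sym {b} {x} {y} (e , d) = trans (Graph.sym G y x) e , λ q → d (≡-sym q)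

  lastAdj-lookup : ∀ x zs → LastAdj x zs → ∀ j → Rel (suc (toℕ j) ≡ᵇ length zs) x (lookup zs j)
  lastAdj-lookup x (z ∷ [])      a       zero    = ~⇒Rel a
  lastAdj-lookup x (z ∷ z′ ∷ zs) (p , _) zero    = p
  lastAdj-lookup x (z ∷ z′ ∷ zs) (_ , a) (suc j) = lastAdj-lookup x (z′ ∷ zs) a j

  path-lookup : ∀ xs → IndPath xs → ∀ i j →
                i ≡ j ⊎ Rel (pathAdjℕ (toℕ i) (toℕ j)) (lookup xs i) (lookup xs j)
  path-lookup (x ∷ xs)     p           zero    zero          = inj₁ refl
  path-lookup (x ∷ y ∷ zs) (a , _)     zero    (suc zero)    = inj₂ (~⇒Rel a)
  path-lookup (x ∷ y ∷ zs) (_ , c , _) zero    (suc (suc j)) = inj₂ (lookup⁺ c j)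
  path-lookup (x ∷ y ∷ zs) (a , _)     (suc zero) zero       = inj₂ (~⇒Rel (~-sym a))
  path-lookup (x ∷ y ∷ zs) (_ , c , _) (suc (suc i)) zero    = inj₂ (#-sym (lookup⁺ c i))
  path-lookup (x ∷ y ∷ zs) (_ , _ , p) (suc i) (suc j) with path-lookup (y ∷ zs) p i j
  ... | inj₁ refl = inj₁ refl
  ... | inj₂ r    = inj₂ r

  pathAdj-loopless : ∀ i → pathAdjℕ i i ≡ false
  pathAdj-loopless zero    = refl
  pathAdj-loopless (suc i) = pathAdj-loopless i

  cycleAdj-loopless : ∀ k → 2 ≤ k → ∀ i → cycleAdjℕ k i i ≡ false
  cycleAdj-loopless (suc (suc k)) _ zero    = refl
  cycleAdj-loopless k _ (suc i) rewrite pathAdj-loopless i = refl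
  cycleAdj-loopless (suc zero) (s≤s ()) zero

  hole-lookup : ∀ x y zs → Hole x y zs → ∀ i j → i ≡ j ⊎
    Rel (cycleAdj (suc (suc (length zs))) i j) (lookup (x ∷ y ∷ zs) i) (lookup (x ∷ y ∷ zs) j)
  hole-lookup x y zs (a , l , p) zero zero          = inj₁ refl
  hole-lookup x y zs (a , l , p) zero (suc zero)    = inj₂ (~⇒Rel a)
  hole-lookup x y zs (a , l , p) zero (suc (suc j)) =
    inj₂ (subst (λ b → Rel b x (lookup zs j)) (≡-sym (∨-identityʳ _)) (lastAdj-lookup x zs l j))
  hole-lookup x y zs (a , l , p) (suc zero) zero    = inj₂ (~⇒Rel (~-sym a))
  hole-lookup x y zs (a , l , p) (suc (suc i)) zero = inj₂ (Rel-sym (lastAdj-lookup x zs l i))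
  hole-lookup x y zs (a , l , p) (suc i) (suc j) with path-lookup (y ∷ zs) p i j
  ... | inj₁ refl = inj₁ refl
  ... | inj₂ r    = inj₂ (subst (λ b → Rel b (lookup (y ∷ zs) i) (lookup (y ∷ zs) j))
                                (≡-sym (∨-identityʳ _)) r)

  hole-contains : ∀ {x y zs} → Hole x y zs → Contains G (cycleAdj (suc (suc (length zs))))
  hole-contains {x} {y} {zs} h =
    mkContains (cycleAdj (suc (suc (length zs)))) (lookup (x ∷ y ∷ zs))
      (λ i → cycleAdj-loopless (suc (suc (length zs))) (s≤s (s≤s z≤n)) (toℕ i)) (hole-lookup x y zs h)

  claw-contains : ∀ {c x y z} → c ~ x → c ~ y → c ~ z → x # y → x # z → y # z → Contains G clawAdj
  claw-contains {c} {x} {y} {z} cx cy cz xy xz yz = mkContains clawAdj f loopless spec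
    where
    f : Fin 4 → V
    f zero                   = c
    f (suc zero)             = x
    f (suc (suc zero))       = y
    f (suc (suc (suc zero))) = z
    loopless : ∀ i → clawAdj i i ≡ false
    loopless zero                   = refl
    loopless (suc zero)             = refl
    loopless (suc (suc zero))       = refl
    loopless (suc (suc (suc zero))) = refl
    spec : ∀ i j → i ≡ j ⊎ Rel (clawAdj i j) (f i) (f j)
    spec zero zero                                     = inj₁ refl
    spec zero (suc zero)                               = inj₂ (~⇒Rel cx)
    spec zero (suc (suc zero))                         = inj₂ (~⇒Rel cy)
    spec zero (suc (suc (suc zero)))                   = inj₂ (~⇒Rel cz)
    spec (suc zero) zero                               = inj₂ (~⇒Rel (~-sym cx))
    spec (suc zero) (suc zero)                         = inj₁ refl
    spec (suc zero) (suc (suc zero))                   = inj₂ xy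
    spec (suc zero) (suc (suc (suc zero)))             = inj₂ xz
    spec (suc (suc zero)) zero                         = inj₂ (~⇒Rel (~-sym cy))
    spec (suc (suc zero)) (suc zero)                   = inj₂ (#-sym xy)
    spec (suc (suc zero)) (suc (suc zero))             = inj₁ refl
    spec (suc (suc zero)) (suc (suc (suc zero)))       = inj₂ yz
    spec (suc (suc (suc zero))) zero                   = inj₂ (~⇒Rel (~-sym cz))
    spec (suc (suc (suc zero))) (suc zero)             = inj₂ (#-sym xz)
    spec (suc (suc (suc zero))) (suc (suc zero))       = inj₂ (#-sym yz)
    spec (suc (suc (suc zero))) (suc (suc (suc zero))) = inj₁ refl

  attached-lookup : ∀ ps h₀ h₁ hs → Attached ps h₀ h₁ hs → ∀ i j →
    Rel (isFirstTwo (toℕ j) ∧ (suc (toℕ i) ≡ᵇ length ps)) (lookup ps i) (lookup (h₀ ∷ h₁ ∷ hs) j)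
  attached-lookup (p ∷ [])     h₀ h₁ hs (a , b , c) zero zero          = ~⇒Rel a
  attached-lookup (p ∷ [])     h₀ h₁ hs (a , b , c) zero (suc zero)    = ~⇒Rel b
  attached-lookup (p ∷ [])     h₀ h₁ hs (a , b , c) zero (suc (suc j)) = lookup⁺ c j
  attached-lookup (p ∷ q ∷ ps) h₀ h₁ hs (a , _) zero j =
    subst (λ b → Rel b p (lookup (h₀ ∷ h₁ ∷ hs) j)) (≡-sym (∧-zeroʳ (isFirstTwo (toℕ j)))) (lookup⁺ a j)
  attached-lookup (p ∷ q ∷ ps) h₀ h₁ hs (_ , a) (suc i) j = attached-lookup (q ∷ ps) h₀ h₁ hs a i j

  first-lookup : ∀ p ps h₀ h₁ hs → p ~ h₀ → p ~ h₁ → All (p #_) hs →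
    All (λ q → All (q #_) (h₀ ∷ h₁ ∷ hs)) ps → ∀ i j →
    Rel (isFirstTwo (toℕ j) ∧ (toℕ i ≡ᵇ 0)) (lookup (p ∷ ps) i) (lookup (h₀ ∷ h₁ ∷ hs) j)
  first-lookup p ps h₀ h₁ hs a b c d zero    zero          = ~⇒Rel a
  first-lookup p ps h₀ h₁ hs a b c d zero    (suc zero)    = ~⇒Rel b
  first-lookup p ps h₀ h₁ hs a b c d zero    (suc (suc j)) = lookup⁺ c j
  first-lookup p ps h₀ h₁ hs a b c d (suc i) j             =
    subst (λ e → Rel e (lookup ps i) (lookup (h₀ ∷ h₁ ∷ hs) j)) (≡-sym (∧-zeroʳ (isFirstTwo (toℕ j))))
      (lookup⁺ (lookup⁺ d i) j)

  handcuff-contains : ∀ {h₀ h₁ hs g₀ g₁ gs p ps} → Hole h₀ h₁ hs → Hole g₀ g₁ gs → IndPath (p ∷ ps) →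
    p ~ h₀ → p ~ h₁ → All (p #_) hs → All (λ q → All (q #_) (h₀ ∷ h₁ ∷ hs)) ps →
    Attached (p ∷ ps) g₀ g₁ gs → All (λ h → All (h #_) (g₀ ∷ g₁ ∷ gs)) (h₀ ∷ h₁ ∷ hs) →
    Contains G (handcuffAdj (suc (suc (length hs))) (suc (length ps)) (suc (suc (length gs))))
  handcuff-contains {h₀} {h₁} {hs} {g₀} {g₁} {gs} {p} {ps} H K P a b c d e x =
    mkContains E f loopless spec
    where
    A B R : ℕ
    A = suc (suc (length hs))
    B = suc (suc (length gs))
    R = suc (length ps)
    E : HandcuffV A R B → HandcuffV A R B → Bool
    E = handcuffAdj A R B
    f : HandcuffV A R B → V
    f (inj₁ i)        = lookup (h₀ ∷ h₁ ∷ hs) i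
    f (inj₂ (inj₁ i)) = lookup (p ∷ ps) i
    f (inj₂ (inj₂ i)) = lookup (g₀ ∷ g₁ ∷ gs) i
    loopless : ∀ i → E i i ≡ false
    loopless (inj₁ i)        = cycleAdj-loopless A (s≤s (s≤s z≤n)) (toℕ i)
    loopless (inj₂ (inj₁ i)) = pathAdj-loopless (toℕ i)
    loopless (inj₂ (inj₂ i)) = cycleAdj-loopless B (s≤s (s≤s z≤n)) (toℕ i)
    lift : ∀ {W W′ : Set} {i j : W} {R : Set} (g : W → W′) → i ≡ j ⊎ R → g i ≡ g j ⊎ R
    lift g (inj₁ refl) = inj₁ refl
    lift g (inj₂ r)    = inj₂ r
    spec : ∀ i j → i ≡ j ⊎ Rel (E i j) (f i) (f j)
    spec (inj₁ i) (inj₁ j)               = lift inj₁ (hole-lookup h₀ h₁ hs H i j)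
    spec (inj₁ i) (inj₂ (inj₁ j))        = inj₂ (Rel-sym (first-lookup p ps h₀ h₁ hs a b c d j i))
    spec (inj₁ i) (inj₂ (inj₂ j))        = inj₂ (lookup⁺ (lookup⁺ x i) j)
    spec (inj₂ (inj₁ i)) (inj₁ j)        = inj₂ (first-lookup p ps h₀ h₁ hs a b c d i j)
    spec (inj₂ (inj₁ i)) (inj₂ (inj₁ j)) = lift (λ k → inj₂ (inj₁ k)) (path-lookup (p ∷ ps) P i j)
    spec (inj₂ (inj₁ i)) (inj₂ (inj₂ j)) = inj₂ (attached-lookup (p ∷ ps) g₀ g₁ gs e i j)
    spec (inj₂ (inj₂ i)) (inj₁ j)        = inj₂ (Rel-sym (lookup⁺ (lookup⁺ x j) i))
    spec (inj₂ (inj₂ i)) (inj₂ (inj₁ j)) = inj₂ (Rel-sym (attached-lookup (p ∷ ps) g₀ g₁ gs e j i))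
    spec (inj₂ (inj₂ i)) (inj₂ (inj₂ j)) = lift (λ k → inj₂ (inj₂ k)) (hole-lookup g₀ g₁ gs K i j)

  eyeMask-contains : ∀ {h₀ h₁ hs g₀ g₁ gs} → Hole h₀ h₁ hs → Hole g₀ g₁ gs →
    h₀ ~ g₀ → h₀ ~ g₁ → h₁ ~ g₀ → h₁ ~ g₁ → All (h₀ #_) gs → All (h₁ #_) gs →
    All (λ h → All (h #_) (g₀ ∷ g₁ ∷ gs)) hs →
    Contains G (eyeMaskAdj (suc (suc (length hs))) (suc (suc (length gs))))
  eyeMask-contains {h₀} {h₁} {hs} {g₀} {g₁} {gs} H K a₀₀ a₀₁ a₁₀ a₁₁ b₀ b₁ c =
    mkContains E f loopless spec
    where
    A B : ℕ
    A = suc (suc (length hs))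
    B = suc (suc (length gs))
    E : Fin A ⊎ Fin B → Fin A ⊎ Fin B → Bool
    E = eyeMaskAdj A B
    f : Fin A ⊎ Fin B → V
    f (inj₁ i) = lookup (h₀ ∷ h₁ ∷ hs) i
    f (inj₂ i) = lookup (g₀ ∷ g₁ ∷ gs) i
    loopless : ∀ i → E i i ≡ false
    loopless (inj₁ i) = cycleAdj-loopless A (s≤s (s≤s z≤n)) (toℕ i)
    loopless (inj₂ i) = cycleAdj-loopless B (s≤s (s≤s z≤n)) (toℕ i)
    cross : ∀ i j → Rel (isFirstTwo (toℕ i) ∧ isFirstTwo (toℕ j)) (f (inj₁ i)) (f (inj₂ j))
    cross zero          zero          = ~⇒Rel a₀₀
    cross zero          (suc zero)    = ~⇒Rel a₀₁
    cross zero          (suc (suc j)) = lookup⁺ b₀ j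
    cross (suc zero)    zero          = ~⇒Rel a₁₀
    cross (suc zero)    (suc zero)    = ~⇒Rel a₁₁
    cross (suc zero)    (suc (suc j)) = lookup⁺ b₁ j
    cross (suc (suc i)) j             = lookup⁺ (lookup⁺ c i) j
    lift : ∀ {W W′ : Set} {i j : W} {R : Set} (g : W → W′) → i ≡ j ⊎ R → g i ≡ g j ⊎ R
    lift g (inj₁ refl) = inj₁ refl
    lift g (inj₂ r)    = inj₂ r
    spec : ∀ i j → i ≡ j ⊎ Rel (E i j) (f i) (f j)
    spec (inj₁ i) (inj₁ j) = lift inj₁ (hole-lookup h₀ h₁ hs H i j)
    spec (inj₁ i) (inj₂ j) = inj₂ (cross i j)
    spec (inj₂ i) (inj₁ j) = inj₂ (subst (λ b → Rel b (f (inj₂ i)) (f (inj₁ j)))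
                                    (∧-comm (isFirstTwo (toℕ j)) (isFirstTwo (toℕ i))) (Rel-sym (cross j i)))
    spec (inj₂ i) (inj₂ j) = lift inj₂ (hole-lookup g₀ g₁ gs K i j)

  lastLast-lookup : ∀ xs ys → LastLast xs ys → ∀ i j →
    Rel ((suc (toℕ i) ≡ᵇ length xs) ∧ (suc (toℕ j) ≡ᵇ length ys)) (lookup xs i) (lookup ys j)
  lastLast-lookup (x ∷ [])      ys a       zero    j = lastAdj-lookup x ys a j
  lastLast-lookup (x ∷ x′ ∷ xs) ys (a , _) zero    j = lookup⁺ a j
  lastLast-lookup (x ∷ x′ ∷ xs) ys (_ , a) (suc i) j = lastLast-lookup (x′ ∷ xs) ys a i j

  lastLast-nonempty : ∀ xs ys → LastLast xs ys → ∃ λ a → ∃ λ as → ∃ λ b → ∃ λ bs → xs ≡ a ∷ as × ys ≡ b ∷ bs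
  lastLast-nonempty (x ∷ [])      (y ∷ ys) a       = x , [] , y , ys , refl , refl
  lastLast-nonempty (x ∷ x′ ∷ xs) ys       (_ , a) with lastLast-nonempty (x′ ∷ xs) ys a
  ... | _ , _ , b , bs , _ , e = x , x′ ∷ xs , b , bs , refl , e

  rungs-lookup : ∀ x xs y ys → Rungs x xs y ys → ∀ (i : Fin (suc (length xs))) (j : Fin (suc (length ys))) →
    Rel (((toℕ i ≡ᵇ 0) ∧ (toℕ j ≡ᵇ 0)) ∨ ((toℕ i ≡ᵇ length xs) ∧ (toℕ j ≡ᵇ length ys)))
        (lookup (x ∷ xs) i) (lookup (y ∷ ys) j)
  -- Once both lists are known to be nonempty, the tests against their lengths compute at index
  -- zero.
  rungs-lookup x xs y ys (a , b , c , d) i j with lastLast-nonempty xs ys d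
  rungs-lookup x xs y ys (a , b , c , d) zero    zero    | _ , _ , _ , _ , refl , refl = ~⇒Rel a
  rungs-lookup x xs y ys (a , b , c , d) zero    (suc j) | _ , _ , _ , _ , refl , refl = lookup⁺ b j
  rungs-lookup x xs y ys (a , b , c , d) (suc i) zero    | x′ , xs′ , y′ , ys′ , refl , refl =
    subst (λ e → Rel e (lookup xs i) y) (≡-sym (∧-zeroʳ (toℕ i ≡ᵇ length xs′))) (lookup⁺ c i)
  rungs-lookup x xs y ys (a , b , c , d) (suc i) (suc j) | _ , _ , _ , _ , refl , refl =
    lastLast-lookup xs ys d i j

  prism-contains : ∀ {x xs y ys z zs} → IndPath (x ∷ xs) → IndPath (y ∷ ys) → IndPath (z ∷ zs) →
    Rungs x xs y ys → Rungs x xs z zs → Rungs y ys z zs →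
    odd? (length xs) ≡ true → odd? (length ys) ≡ true → odd? (length zs) ≡ true → HasOddPrism G
  prism-contains {x} {xs} {y} {ys} {z} {zs} P Q R PQ PR QR op oq or =
    k , (λ i → pos (k i) (odd i)) , (λ i → odd?-sound (k i) (odd i)) ,
    mkContains (prismAdj k) f loopless spec
    where
    k : Fin 3 → ℕ
    k zero             = length xs
    k (suc zero)       = length ys
    k (suc (suc zero)) = length zs
    odd : ∀ i → odd? (k i) ≡ true
    odd zero             = op
    odd (suc zero)       = oq
    odd (suc (suc zero)) = or
    pos : ∀ m → odd? m ≡ true → 1 ≤ m
    pos (suc m) _ = s≤s z≤n
    f : PrismV k → V
    f (zero , j)           = lookup (x ∷ xs) j
    f (suc zero , j)       = lookup (y ∷ ys) j
    f (suc (suc zero) , j) = lookup (z ∷ zs) j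
    loopless : ∀ v → prismAdj k v v ≡ false
    loopless (zero , j)           = pathAdj-loopless (toℕ j)
    loopless (suc zero , j)       = pathAdj-loopless (toℕ j)
    loopless (suc (suc zero) , j) = pathAdj-loopless (toℕ j)
    lift : ∀ {W W′ : Set} {i j : W} {R : Set} (g : W → W′) → i ≡ j ⊎ R → g i ≡ g j ⊎ R
    lift g (inj₁ refl) = inj₁ refl
    lift g (inj₂ r)    = inj₂ r
    flip : ∀ {a b c d u v} → Rel ((a ∧ b) ∨ (c ∧ d)) u v → Rel ((b ∧ a) ∨ (d ∧ c)) v u
    flip {a} {b} {c} {d} {u} {v} r =
      subst (λ e → Rel e v u) (cong₂ _∨_ (∧-comm a b) (∧-comm c d)) (Rel-sym r)
    spec : ∀ v w → v ≡ w ⊎ Rel (prismAdj k v w) (f v) (f w)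
    spec (zero , i) (zero , j)                     = lift (zero ,_) (path-lookup (x ∷ xs) P i j)
    spec (zero , i) (suc zero , j)                 = inj₂ (rungs-lookup x xs y ys PQ i j)
    spec (zero , i) (suc (suc zero) , j)           = inj₂ (rungs-lookup x xs z zs PR i j)
    spec (suc zero , i) (zero , j)                 = inj₂ (flip {a = toℕ j ≡ᵇ 0} {c = toℕ j ≡ᵇ length xs} (rungs-lookup x xs y ys PQ j i))
    spec (suc zero , i) (suc zero , j)             = lift (suc zero ,_) (path-lookup (y ∷ ys) Q i j)
    spec (suc zero , i) (suc (suc zero) , j)       = inj₂ (rungs-lookup y ys z zs QR i j)
    spec (suc (suc zero) , i) (zero , j)           = inj₂ (flip {a = toℕ j ≡ᵇ 0} {c = toℕ j ≡ᵇ length xs} (rungs-lookup x xs z zs PR j i))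
    spec (suc (suc zero) , i) (suc zero , j)       = inj₂ (flip {a = toℕ j ≡ᵇ 0} {c = toℕ j ≡ᵇ length ys} (rungs-lookup y ys z zs QR j i))
    spec (suc (suc zero) , i) (suc (suc zero) , j) = lift (suc (suc zero) ,_) (path-lookup (z ∷ zs) R i j)

-- The complement graph and antiholes

co : Graph → Graph
co G = record
  { n      = n G
  ; adj    = λ x y → not (adj G x y) ∧ not ⌊ x F.≟ y ⌋
  ; sym    = λ x y → cong₂ (λ a b → not a ∧ not b) (Graph.sym G x y) (dec-sym x y)
  ; irrefl = loop }
  where
  dec-sym : ∀ {m} (x y : Fin m) → ⌊ x F.≟ y ⌋ ≡ ⌊ y F.≟ x ⌋
  dec-sym x y with x F.≟ y | y F.≟ x
  ... | yes _ | yes _ = refl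
  ... | no _  | no _  = refl
  ... | yes p | no q  = ⊥-elim (q (≡-sym p))
  ... | no p  | yes q = ⊥-elim (p (≡-sym q))
  loop : ∀ x → not (adj G x x) ∧ not ⌊ x F.≟ x ⌋ ≡ false
  loop x with x F.≟ x
  ... | yes _ = ∧-zeroʳ _
  ... | no d  = ⊥-elim (d refl)

module _ (G : Graph) where
  private
    module B = Base G
    module C = Base (co G)

  co-Rel : ∀ {b x y} → B.Rel b x y → C.Rel (not b) x y
  co-Rel {b} {x} {y} (e , d) with x F.≟ y
  ... | yes p = ⊥-elim (d p)
  ... | no _  = trans (cong (λ a → not a ∧ true) e) (lem b) , d
    where
    lem : ∀ b → not b ∧ true ≡ not b
    lem false = refl
    lem true  = refl

  co-Rel⁻ : ∀ {b x y} → C.Rel b x y → B.Rel (not b) x y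
  co-Rel⁻ {b} {x} {y} (e , d) with x F.≟ y
  ... | yes p = ⊥-elim (d p)
  ... | no _  = lem _ _ e , d
    where
    lem : ∀ a b → not a ∧ true ≡ b → a ≡ not b
    lem false .true refl = refl
    lem true .false refl = refl

  ≡ᵇ-refl : ∀ m → (m ≡ᵇ m) ≡ true
  ≡ᵇ-refl zero    = refl
  ≡ᵇ-refl (suc m) = ≡ᵇ-refl m

  ≡ᵇ-≢ : ∀ a b → a ≢ b → (a ≡ᵇ b) ≡ false
  ≡ᵇ-≢ zero    zero    d = ⊥-elim (d refl)
  ≡ᵇ-≢ zero    (suc b) d = refl
  ≡ᵇ-≢ (suc a) zero    d = refl
  ≡ᵇ-≢ (suc a) (suc b) d = ≡ᵇ-≢ a b (λ e → d (cong suc e))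

  antihole-contains : ∀ {x y zs} → C.Hole x y zs → Contains G (antiCycleAdj (suc (suc (length zs))))
  antihole-contains {x} {y} {zs} h =
    B.mkContains (antiCycleAdj k) (lookup (x ∷ y ∷ zs)) loopless spec
    where
    k : ℕ
    k = suc (suc (length zs))
    loopless : ∀ i → antiCycleAdj k i i ≡ false
    loopless i rewrite ≡ᵇ-refl (toℕ i) = ∧-zeroʳ _
    spec : ∀ i j → i ≡ j ⊎ B.Rel (antiCycleAdj k i j) (lookup (x ∷ y ∷ zs) i) (lookup (x ∷ y ∷ zs) j)
    spec i j with i F.≟ j | C.hole-lookup x y zs h i j
    ... | yes p | _      = inj₁ p
    ... | no _  | inj₁ p = inj₁ p
    ... | no d  | inj₂ r = inj₂ (subst (λ b → B.Rel b (lookup (x ∷ y ∷ zs) i) (lookup (x ∷ y ∷ zs) j)) lem (co-Rel⁻ r))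
      where
      lem : not (cycleAdj k i j) ≡ antiCycleAdj k i j
      lem rewrite ≡ᵇ-≢ (toℕ i) (toℕ j) (λ e → d (toℕ-injective e)) with cycleAdj k i j
      ... | false = refl
      ... | true  = refl

odd?-+ : ∀ a b → odd? (a + b) ≡ (odd? a xor odd? b)
odd?-+ zero    b = refl
odd?-+ (suc a) b rewrite odd?-+ a b with odd? a | odd? b
... | false | _     = refl
... | true  | false = refl
... | true  | true  = refl

odd?-++ : ∀ {A : Set} (xs ys : List A) → odd? (length (xs ++ ys)) ≡ (odd? (length xs) xor odd? (length ys))
odd?-++ xs ys = trans (cong odd? (length-++ xs)) (odd?-+ (length xs) (length ys))

reverse⁺ : ∀ {A : Set} {P : A → Set} {xs} → All P xs → All P (reverse xs)
reverse⁺ []                        = []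
reverse⁺ {xs = x ∷ xs} (p ∷ ps) rewrite unfold-reverse x xs = ∷ʳ⁺ (reverse⁺ ps) p

-- Cutting, reversing and joining induced paths

module Lists (G : Graph) where
  open Base G public

  Far : List V → List V → Set
  Far xs ys = All (λ x → All (x #_) ys) xs

  far-sym : ∀ xs ys → Far xs ys → Far ys xs
  far-sym xs []       f = []
  far-sym xs (y ∷ ys) f = All.map (λ { (p ∷ _) → #-sym p }) f ∷ far-sym xs ys (All.map (λ { (_ ∷ p) → p }) f)

  last⁺ : V → List V → V
  last⁺ x []       = x
  last⁺ x (y ∷ ys) = last⁺ y ys

  last⁺-All : ∀ {P : V → Set} x xs → All P (x ∷ xs) → P (last⁺ x xs)
  last⁺-All x []       (p ∷ [])    = p
  last⁺-All x (y ∷ ys) (p ∷ q ∷ a) = last⁺-All y ys (q ∷ a)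

  indPath-tail : ∀ x xs → IndPath (x ∷ xs) → IndPath xs
  indPath-tail x []       p           = tt
  indPath-tail x (y ∷ ys) (_ , _ , p) = p

  indPath-++ʳ : ∀ xs {ys} → IndPath (xs ++ ys) → IndPath ys
  indPath-++ʳ []       p = p
  indPath-++ʳ (x ∷ xs) p = indPath-++ʳ xs (indPath-tail x _ p)

  indPath-++ˡ : ∀ xs {ys} → IndPath (xs ++ ys) → IndPath xs
  indPath-++ˡ []           p           = tt
  indPath-++ˡ (x ∷ [])     p           = tt
  indPath-++ˡ (x ∷ y ∷ xs) (a , b , p) = a , ++⁻ˡ xs b , indPath-++ˡ (y ∷ xs) p

  indPath-far : ∀ xs {q ys} → IndPath (xs ++ q ∷ ys) → Far xs ys
  indPath-far []           p           = []
  indPath-far (x ∷ [])     (_ , b , _) = b ∷ []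
  indPath-far (x ∷ y ∷ xs) (_ , b , p) = All.tail (++⁻ʳ xs b) ∷ indPath-far (y ∷ xs) p

  indPath-last : ∀ x xs {q ys} → IndPath (x ∷ xs ++ q ∷ ys) → last⁺ x xs ~ q
  indPath-last x []       (a , _)     = a
  indPath-last x (y ∷ xs) (_ , _ , p) = indPath-last y xs p

  indPath-lastAdj : ∀ x xs {q ys} → IndPath (x ∷ xs ++ q ∷ ys) → LastAdj q (x ∷ xs)
  indPath-lastAdj x []       (a , _)     = ~-sym a
  indPath-lastAdj x (y ∷ xs) (_ , b , p) with ++⁻ʳ xs b
  ... | c ∷ _ = #-sym c , indPath-lastAdj y xs p

  lastAdj-last : ∀ {x} z zs → LastAdj x (z ∷ zs) → x ~ last⁺ z zs
  lastAdj-last z []        a       = a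
  lastAdj-last z (z′ ∷ zs) (_ , a) = lastAdj-last z′ zs a

  lastAdj-∷ʳ : ∀ {x q} zs → All (x #_) zs → x ~ q → LastAdj x (zs ++ q ∷ [])
  lastAdj-∷ʳ []            []          a = a
  lastAdj-∷ʳ (z ∷ [])      (b ∷ [])    a = b , a
  lastAdj-∷ʳ (z ∷ z′ ∷ zs) (b ∷ c ∷ d) a = b , lastAdj-∷ʳ (z′ ∷ zs) (c ∷ d) a

  lastAdj-++ : ∀ {x} zs w ws → All (x #_) zs → LastAdj x (w ∷ ws) → LastAdj x (zs ++ w ∷ ws)
  lastAdj-++ []            w ws []          a = a
  lastAdj-++ (z ∷ [])      w ws (b ∷ [])    a = b , a
  lastAdj-++ (z ∷ z′ ∷ zs) w ws (b ∷ c ∷ d) a = b , lastAdj-++ (z′ ∷ zs) w ws (c ∷ d) a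

  lastAdj-++⁻ : ∀ {x} zs w ws → LastAdj x (zs ++ w ∷ ws) → All (x #_) zs × LastAdj x (w ∷ ws)
  lastAdj-++⁻ []            w ws a       = [] , a
  lastAdj-++⁻ (z ∷ [])      w ws (b , a) = b ∷ [] , a
  lastAdj-++⁻ (z ∷ z′ ∷ zs) w ws (b , a) with lastAdj-++⁻ (z′ ∷ zs) w ws a
  ... | c , d = b ∷ c , d

  lastAdj-reverse : ∀ {x} y zs → x ~ y → All (x #_) zs → LastAdj x (reverse (y ∷ zs))
  lastAdj-reverse y zs a b rewrite unfold-reverse y zs = lastAdj-∷ʳ (reverse zs) (reverse⁺ b) a

  indPath-∷ʳ : ∀ xs q → IndPath xs → LastAdj q xs → IndPath (xs ++ q ∷ [])
  indPath-∷ʳ (x ∷ [])     q p           a       = ~-sym a , [] , tt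
  indPath-∷ʳ (x ∷ y ∷ zs) q (b , c , p) (d , a) = b , ∷ʳ⁺ c (#-sym d) , indPath-∷ʳ (y ∷ zs) q p a

  indPath-reverse : ∀ xs → IndPath xs → IndPath (reverse xs)
  indPath-reverse []           p           = tt
  indPath-reverse (x ∷ [])     p           = tt
  indPath-reverse (x ∷ y ∷ zs) (a , b , p) = subst IndPath (≡-sym (unfold-reverse x (y ∷ zs)))
    (indPath-∷ʳ (reverse (y ∷ zs)) x (indPath-reverse (y ∷ zs) p) (lastAdj-reverse y zs a b))

  indPath-join : ∀ xs y ys → IndPath xs → IndPath (y ∷ ys) → LastAdj y xs → Far xs ys →
                 IndPath (xs ++ y ∷ ys)
  indPath-join (x ∷ [])     y ys p           q a       (f ∷ [])    = ~-sym a , f , q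
  indPath-join (x ∷ x′ ∷ xs) y ys (b , c , p) q (d , a) (f ∷ g) =
    b , ++⁺ c (#-sym d ∷ f) , indPath-join (x′ ∷ xs) y ys p q a g

  lastLast-∷ʳ : ∀ xs x ys → Far xs ys → LastAdj x ys → LastLast (xs ++ x ∷ []) ys
  lastLast-∷ʳ []            x ys []      a = a
  lastLast-∷ʳ (w ∷ [])      x ys (f ∷ []) a = f , a
  lastLast-∷ʳ (w ∷ w′ ∷ ws) x ys (f ∷ g) a = f , lastLast-∷ʳ (w′ ∷ ws) x ys g a

  attached-hs : ∀ ps {h₀ h₁ hs} → Attached ps h₀ h₁ hs → All (λ p → All (p #_) hs) ps
  attached-hs (x ∷ [])     (_ , _ , c)       = c ∷ []
  attached-hs (x ∷ y ∷ zs) ((_ ∷ _ ∷ c) , a) = c ∷ attached-hs (y ∷ zs) a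

  attached-++ʳ : ∀ xs y ys {h₀ h₁ hs} → Attached (xs ++ y ∷ ys) h₀ h₁ hs → Attached (y ∷ ys) h₀ h₁ hs
  attached-++ʳ []            y ys a       = a
  attached-++ʳ (x ∷ [])      y ys (_ , a) = a
  attached-++ʳ (x ∷ x′ ∷ xs) y ys (_ , a) = attached-++ʳ (x′ ∷ xs) y ys a

  attached-far : ∀ xs y ys {h₀ h₁ hs} → Attached (xs ++ y ∷ ys) h₀ h₁ hs → Far xs (h₀ ∷ h₁ ∷ hs)
  attached-far []            y ys a       = []
  attached-far (x ∷ [])      y ys (b , a) = b ∷ []
  attached-far (x ∷ x′ ∷ xs) y ys (b , a) = b ∷ attached-far (x′ ∷ xs) y ys a

  attached-++ : ∀ xs y ys {h₀ h₁ hs} → Far xs (h₀ ∷ h₁ ∷ hs) → Attached (y ∷ ys) h₀ h₁ hs →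
                Attached (xs ++ y ∷ ys) h₀ h₁ hs
  attached-++ []            y ys []       a = a
  attached-++ (x ∷ [])      y ys (b ∷ []) a = b , a
  attached-++ (x ∷ x′ ∷ xs) y ys (b ∷ c)  a = b , attached-++ (x′ ∷ xs) y ys c a

  attached-lastAdj₁ : ∀ ps {h₀ h₁ hs} → Attached ps h₀ h₁ hs → LastAdj h₁ ps
  attached-lastAdj₁ (x ∷ [])     (_ , b , _)       = ~-sym b
  attached-lastAdj₁ (x ∷ y ∷ zs) ((_ ∷ b ∷ _) , a) = #-sym b , attached-lastAdj₁ (y ∷ zs) a

  attached-last₀ : ∀ ps {h₀ h₁ hs} zs → Attached ps h₀ h₁ hs → Far ps zs → LastLast ps (zs ++ h₀ ∷ [])
  attached-last₀ (x ∷ [])     zs (a , _)       (f ∷ []) = lastAdj-∷ʳ zs f a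
  attached-last₀ (x ∷ y ∷ ps) zs ((b ∷ _) , a) (f ∷ g)  = ∷ʳ⁺ f b , attached-last₀ (y ∷ ps) zs a g

  attached-last₁ : ∀ ps {h₀ h₁ hs} zs → Attached ps h₀ h₁ hs → Far ps zs → LastLast ps (zs ++ h₁ ∷ [])
  attached-last₁ (x ∷ [])     zs (_ , a , _)       (f ∷ []) = lastAdj-∷ʳ zs f a
  attached-last₁ (x ∷ y ∷ ps) zs ((_ ∷ b ∷ _) , a) (f ∷ g)  = ∷ʳ⁺ f b , attached-last₁ (y ∷ ps) zs a g

  data Search (y : V) (zs : List V) : Set where
    none  : All (y #_) zs → Search y zs
    found : ∀ pre q suf → zs ≡ pre ++ q ∷ suf → All (y #_) pre → y ~ q → Search y zs

  search : ∀ y zs → All (y ≢_) zs → Search y zs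
  search y []       []      = none []
  search y (z ∷ zs) (d ∷ e) with adn y z d
  ... | ad a = found [] z zs refl [] a
  ... | na b with search y zs e
  ...   | none c               = none (b ∷ c)
  ...   | found pre q suf r c a = found (z ∷ pre) q suf (cong (z ∷_) r) (b ∷ c) a

-- The forbidden configurations in list form

record Forbidden (G : Graph) : Set where
  open Lists G
  field
    claw     : ∀ {c x y z} → c ~ x → c ~ y → c ~ z → x # y → x # z → y # z → ⊥
    -- A `Hole x y zs` has `length zs + 2` vertices, so `2 ≤ length zs` excludes triangles and `zs`
    -- has the parity of the hole. The bound 3 for antiholes also admits length five, where an
    -- antihole is a five-hole.
    oddHole  : ∀ {x y zs} → Hole x y zs → 2 ≤ length zs → odd? (length zs) ≡ true → ⊥
    antihole : ∀ {x y zs} → Base.Hole (co G) x y zs → 3 ≤ length zs → ⊥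
    oddPrism : ∀ {x xs y ys z zs} → IndPath (x ∷ xs) → IndPath (y ∷ ys) → IndPath (z ∷ zs) →
      Rungs x xs y ys → Rungs x xs z zs → Rungs y ys z zs →
      odd? (length xs) ≡ true → odd? (length ys) ≡ true → odd? (length zs) ≡ true → ⊥
    handcuff : ∀ {h₀ h₁ hs g₀ g₁ gs p ps} → Hole h₀ h₁ hs → 2 ≤ length hs → odd? (length hs) ≡ false →
      Hole g₀ g₁ gs → 2 ≤ length gs → odd? (length gs) ≡ false →
      IndPath (p ∷ ps) → odd? (length ps) ≡ true →
      p ~ h₀ → p ~ h₁ → All (p #_) hs → All (λ q → All (q #_) (h₀ ∷ h₁ ∷ hs)) ps →
      Attached (p ∷ ps) g₀ g₁ gs → All (λ h → All (h #_) (g₀ ∷ g₁ ∷ gs)) (h₀ ∷ h₁ ∷ hs) → ⊥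
    eyeMask  : ∀ {h₀ h₁ hs g₀ g₁ gs} → Hole h₀ h₁ hs → 2 ≤ length hs → odd? (length hs) ≡ false →
      Hole g₀ g₁ gs → 2 ≤ length gs → odd? (length gs) ≡ false →
      h₀ ~ g₀ → h₀ ~ g₁ → h₁ ~ g₀ → h₁ ~ g₁ → All (h₀ #_) gs → All (h₁ #_) gs →
      All (λ h → All (h #_) (g₀ ∷ g₁ ∷ gs)) hs → ⊥

forbidden : ∀ G → ClawFree G → Innocent G → Forbidden G
forbidden G cf (noOdd , noAnti , noPrism , noCuff , noMask) = record
  { claw     = λ a b c d e f → cf (claw-contains a b c d e f)
  ; oddHole  = oddH
  ; antihole = anti
  ; oddPrism = λ a b c d e f g h i → noPrism (prism-contains a b c d e f g h i)
  ; handcuff = λ {_} {_} {hs} {_} {_} {gs} {_} {ps} H lh eh K lk ek P op a b c d e f →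
      noCuff (suc (suc (length hs)) , suc (length ps) , suc (suc (length gs)) ,
        s≤s (s≤s lh) , ev (length hs) eh , s≤s (s≤s lk) , ev (length gs) ek , s≤s z≤n ,
        odd?-sound (length ps) op , handcuff-contains H K P a b c d e f)
  ; eyeMask  = λ {_} {_} {hs} {_} {_} {gs} H lh eh K lk ek a b c d e f g →
      noMask (suc (suc (length hs)) , suc (suc (length gs)) , s≤s (s≤s lh) , ev (length hs) eh ,
        s≤s (s≤s lk) , ev (length gs) ek , eyeMask-contains H K a b c d e f g) }
  where
  open Lists G
  module C = Base (co G)
  notnot : ∀ {b c} → b ≡ c → not (not b) ≡ c
  notnot {false} e = e
  notnot {true}  e = e
  ev : ∀ m → odd? m ≡ false → Even (suc (suc m))
  ev m e = even?-sound (suc (suc m)) (notnot e)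
  oddH : ∀ {x y zs} → Hole x y zs → 2 ≤ length zs → odd? (length zs) ≡ true → ⊥
  oddH {zs = zs} h l o = noOdd (suc (suc (length zs)) , odd?-sound (suc (suc (length zs))) (notnot o) ,
                                s≤s (s≤s l) , hole-contains h)
  adj⁻ : ∀ {x y} → x C.# y → x ~ y
  adj⁻ r = proj₁ (co-Rel⁻ G r)
  non⁻ : ∀ {x y} → x C.~ y → x # y
  non⁻ a = co-Rel⁻ G (C.~⇒Rel a)
  anti : ∀ {x y zs} → C.Hole x y zs → 3 ≤ length zs → ⊥
  -- The complement of a five-cycle is a five-cycle, visited in the order `x , a , c , y , b`.
  anti {x} {y} {a ∷ b ∷ c ∷ []} (xy , (xa , xb , xc) , ya , (yb ∷ yc ∷ []) , ab , (ac ∷ []) , bc , [] , _) _ =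
    oddH {x} {a} {c ∷ y ∷ b ∷ []}
      (adj⁻ xa , (non⁻ xc , non⁻ xy , adj⁻ xb) ,
       adj⁻ ac , (#-sym (non⁻ ya) ∷ non⁻ ab ∷ []) , ~-sym (adj⁻ yc) , (#-sym (non⁻ bc) ∷ []) , adj⁻ yb , [] , tt)
      (s≤s (s≤s z≤n)) refl
  anti {x} {y} {a ∷ b ∷ c ∷ d ∷ zs} h _ =
    noAnti (suc (suc (suc (suc (suc (suc (length zs)))))) ,
            s≤s (s≤s (s≤s (s≤s (s≤s (s≤s z≤n))))) , antihole-contains G h)
  anti {zs = _ ∷ []}     _ (s≤s ())
  anti {zs = _ ∷ _ ∷ []} _ (s≤s (s≤s ()))

-- Vertices and paths attached to even holes

module Contact (G : Graph) (F : Forbidden G) where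
  open Lists G
  open Forbidden F

  EvenHole : V → V → List V → Set
  EvenHole h₀ h₁ hs = Hole h₀ h₁ hs × 2 ≤ length hs × odd? (length hs) ≡ false

  noFork : ∀ {c x y z} → c ~ x → c ~ y → c ~ z → x # y → x # z → y ≢ z → y ~ z
  noFork {y = y} {z} cx cy cz xy xz d with adn y z d
  ... | ad a = a
  ... | na b = ⊥-elim (claw cx cy cz xy xz b)

  nonadj : ∀ {y p q} → y ~ p → y ~ q → p # q → ∀ {z} → y ≢ z → p # z → q # z → y # z
  nonadj {y} yp yq pq {z} d pz qz with adn y z d
  ... | ad a = ⊥-elim (claw yp yq a pq pz qz)
  ... | na b = b

  nonadjs : ∀ {y p q} → y ~ p → y ~ q → p # q → ∀ {zs} → All (y ≢_) zs → All (p #_) zs → All (q #_) zs → All (y #_) zs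
  nonadjs yp yq pq []       []       []       = []
  nonadjs yp yq pq (d ∷ ds) (e ∷ es) (f ∷ fs) = nonadj yp yq pq d e f ∷ nonadjs yp yq pq ds es fs

  -- `w` is the neighbour of `h₀` on the hole other than `h₁`. Its membership in `hs` is recorded as
  -- inheriting whatever holds on all of `hs`.
  ends-nonadj : ∀ {h₀ h₁ hs} → Hole h₀ h₁ hs → 2 ≤ length hs →
                ∃ λ w → w ~ h₀ × w # h₁ × (∀ {P : V → Set} → All P hs → P w)
  ends-nonadj {hs = g ∷ g′ ∷ gs} (_ , l , (_ , c , _)) _ =
    last⁺ g (g′ ∷ gs) , ~-sym (lastAdj-last g (g′ ∷ gs) l) , #-sym (last⁺-All g′ gs c) , last⁺-All g (g′ ∷ gs)
  ends-nonadj {hs = _ ∷ []} _ (s≤s ())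

  -- Take the first neighbour `q` of `y` on the hole, starting from `h₁`. It closes a cycle through
  -- the path. If this cycle is not an odd hole, then `y` also sees the successor of `q`, and an odd
  -- prism appears. For a path of one vertex, `y` might instead form a triangle with `π₀` and `h₁`;
  -- `base` excludes this.
  holeContact : ∀ {π₀ Π h₀ h₁ hs y} → IndPath (π₀ ∷ Π) → odd? (length Π) ≡ false →
    Attached (π₀ ∷ Π) h₀ h₁ hs → EvenHole h₀ h₁ hs → y ~ π₀ → All (y #_) Π →
    All (y ≢_) (h₀ ∷ h₁ ∷ hs) → 1 ≤ length Π ⊎ (y # h₀ × y # h₁) → All (y #_) (h₀ ∷ h₁ ∷ hs)
  holeContact {π₀} {Π} {h₀} {h₁} {hs} {y} P oP A ((h01 , hl , hp) , hlen , heven) yπ yΠ (d₀ ∷ ds) base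
    with search y (h₁ ∷ hs) ds
  ... | none c with adn y h₀ d₀
  ...   | na b = b ∷ c
  -- A single neighbour `h₀` would give a claw at `h₀`, formed by `y` and the two neighbours of `h₀`
  -- on the hole.
  ...   | ad a with ends-nonadj (h01 , hl , hp) hlen
  ...     | w , wh₀ , wh₁ , pick = ⊥-elim (claw h01 (~-sym wh₀) (~-sym a) (#-sym wh₁) (#-sym (All.head c)) (#-sym (pick (All.tail c))))
  holeContact {π₀} {Π} {h₀} {h₁} {hs} {y} P oP A ((h01 , hl , hp) , hlen , heven) yπ yΠ (d₀ ∷ ds) base
    | found [] .h₁ .hs refl [] a with base
  ... | inj₂ (_ , b) = ⊥-elim (~#⊥ a b)
  ... | inj₁ l = ⊥-elim (oddHole {h₁} {y} {π₀ ∷ Π} (~-sym a , attached-lastAdj₁ (π₀ ∷ Π) A , yπ , yΠ , P) (s≤s l) (cong not oP))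
  holeContact {π₀} {Π} {h₀} {.h₁} {.(pre ++ q ∷ suf)} {y} P oP A ((h01 , hl , hp) , hlen , heven) yπ yΠ (d₀ ∷ ds) base
    | found (h₁ ∷ pre) q suf refl (yh₁ ∷ ypre) a with odd? (length pre) in oe
  ... | true = ⊥-elim (oddHole {q} {y} {π₀ ∷ (Π ++ h₁ ∷ pre)}
        (~-sym a , lastAdj-++ (π₀ ∷ Π) h₁ pre (All.map #-sym qΠ) (indPath-lastAdj h₁ pre hp) ,
         yπ , ++⁺ yΠ (yh₁ ∷ ypre) ,
         indPath-join (π₀ ∷ Π) h₁ pre P (indPath-++ˡ (h₁ ∷ pre) hp) (attached-lastAdj₁ (π₀ ∷ Π) A) farpre)
        (s≤s (len Π)) par)
    where
    far : Far (π₀ ∷ Π) (pre ++ q ∷ suf)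
    far = attached-hs (π₀ ∷ Π) A
    farpre : Far (π₀ ∷ Π) pre
    farpre = All.map (++⁻ˡ pre) far
    qΠ : All (_# q) (π₀ ∷ Π)
    qΠ = All.map (λ c → All.head (++⁻ʳ pre c)) far
    len : ∀ (xs : List V) {y ys} → 1 ≤ length (xs ++ y ∷ ys)
    len []       = s≤s z≤n
    len (x ∷ xs) = s≤s z≤n
    par : not (odd? (length (Π ++ h₁ ∷ pre))) ≡ true
    par rewrite odd?-++ Π (h₁ ∷ pre) | oP | oe = refl
  holeContact {π₀} {Π} {h₀} {.h₁} {.(pre ++ q ∷ [])} {y} P oP A ((h01 , hl , hp) , hlen , heven) yπ yΠ (d₀ ∷ ds) base
    | found (h₁ ∷ pre) q [] refl (yh₁ ∷ ypre) a | false = ⊥-elim (contra heven)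
    where
    contra : odd? (length (pre ++ q ∷ [])) ≡ false → ⊥
    contra e rewrite odd?-++ pre (q ∷ []) | oe = t≢f refl e
  -- The triangles are `y , q , g` and `h₁ , h₀` with the last vertex of the path. They are joined
  -- by the path, by the arc from `q` back to `h₁` and by the arc from `g` on to `h₀`.
  holeContact {π₀} {Π} {h₀} {.h₁} {.(pre ++ q ∷ g ∷ suf)} {y} P oP A ((h01 , hl , hp) , hlen , heven) yπ yΠ (d₀ ∷ ds) base
    | found (h₁ ∷ pre) q (g ∷ suf) refl (yh₁ ∷ ypre) a | false =
    ⊥-elim (oddPrism {y} {π₀ ∷ Π} {q} {reverse (h₁ ∷ pre)} {g} {suf ++ h₀ ∷ []}
      (yπ , yΠ , P)
      (subst IndPath (rev-∷ʳ (h₁ ∷ pre) q) (indPath-reverse ((h₁ ∷ pre) ++ q ∷ [])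
        (indPath-++ˡ ((h₁ ∷ pre) ++ q ∷ []) (subst IndPath (≡-sym (++-assoc (h₁ ∷ pre) (q ∷ []) (g ∷ suf))) hp))))
      (indPath-∷ʳ (g ∷ suf) h₀ (indPath-tail q _ pq) (proj₂ (proj₂ hl′)))
      (a , reverse⁺ (yh₁ ∷ ypre) , All.map (λ c → All.head (++⁻ʳ pre c)) far ,
        subst (LastLast (π₀ ∷ Π)) (≡-sym (unfold-reverse h₁ pre))
          (attached-last₁ (π₀ ∷ Π) (reverse pre) A (All.map (λ c → reverse⁺ (++⁻ˡ pre c)) far)))
      (yg , ∷ʳ⁺ ysuf yh₀ , All.map (λ c → All.head (All.tail (++⁻ʳ pre c))) far ,
        attached-last₀ (π₀ ∷ Π) suf A (All.map (λ c → All.tail (All.tail (++⁻ʳ pre c))) far))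
      (qg , ∷ʳ⁺ qsuf (#-sym qh₀) , reverse⁺ (All.map All.head farh) ,
        subst (λ l → LastLast l (suf ++ h₀ ∷ [])) (≡-sym (unfold-reverse h₁ pre))
          (lastLast-∷ʳ (reverse pre) h₁ (suf ++ h₀ ∷ [])
            (reverse⁺ (All.zipWith (λ { (u , v) → ∷ʳ⁺ (All.tail u) (#-sym v) }) (All.tail farh , preh₀)))
            (lastAdj-∷ʳ suf (All.tail (All.head farh)) (~-sym h01))))
      (cong not oP) opre osuf)
    where
    far : Far (π₀ ∷ Π) (pre ++ q ∷ g ∷ suf)
    far = attached-hs (π₀ ∷ Π) A
    farh : Far (h₁ ∷ pre) (g ∷ suf)
    farh = indPath-far (h₁ ∷ pre) hp
    pq : IndPath (q ∷ g ∷ suf)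
    pq = indPath-++ʳ (h₁ ∷ pre) hp
    qg : q ~ g
    qg = proj₁ pq
    qsuf : All (q #_) suf
    qsuf = proj₁ (proj₂ pq)
    dq : All (y ≢_) (q ∷ g ∷ suf)
    dq = ++⁻ʳ (h₁ ∷ pre) ds
    hl′ : All (h₀ #_) pre × LastAdj h₀ (q ∷ g ∷ suf)
    hl′ = lastAdj-++⁻ pre q (g ∷ suf) hl
    preh₀ : All (h₀ #_) pre
    preh₀ = proj₁ hl′
    qh₀ : h₀ # q
    qh₀ = proj₁ (proj₂ hl′)
    πq : π₀ # q
    πq = All.head (++⁻ʳ pre (All.head far))
    yg : y ~ g
    yg = ~-sym (noFork (~-sym (indPath-last h₁ pre hp)) qg (~-sym a)
           (All.head (last⁺-All h₁ pre farh))
           (#-sym (last⁺-All h₁ pre (yh₁ ∷ ypre))) (λ e → All.head (All.tail dq) (≡-sym e)))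
    ysuf : All (y #_) suf
    ysuf = nonadjs yπ a πq (All.tail (All.tail dq)) (All.tail (All.tail (++⁻ʳ pre (All.head far)))) qsuf
    yh₀ : y # h₀
    yh₀ = by base A
      where
      by : 1 ≤ length Π ⊎ (y # h₀ × y # h₁) → Attached (π₀ ∷ Π) h₀ h₁ (pre ++ q ∷ g ∷ suf) → y # h₀
      by (inj₂ (b , _)) _ = b
      by (inj₁ l) A′ = nonadj yπ a πq d₀ (apart Π l A′) (#-sym qh₀)
        where
        apart : ∀ Π → 1 ≤ length Π → Attached (π₀ ∷ Π) h₀ h₁ (pre ++ q ∷ g ∷ suf) → π₀ # h₀
        apart (_ ∷ _) _ ((b ∷ _) , _) = b
    rev-∷ʳ : ∀ (xs : List V) q → reverse (xs ++ q ∷ []) ≡ q ∷ reverse xs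
    rev-∷ʳ []       q = refl
    rev-∷ʳ (x ∷ xs) q rewrite unfold-reverse x (xs ++ q ∷ []) | rev-∷ʳ xs q | unfold-reverse x xs = refl
    opre : odd? (length (reverse (h₁ ∷ pre))) ≡ true
    opre rewrite length-reverse (h₁ ∷ pre) | oe = refl
    osuf′ : odd? (length suf) ≡ false
    osuf′ = lem (trans (≡-sym (odd?-++ pre (q ∷ g ∷ suf))) heven)
      where
      lem : (odd? (length pre) xor not (not (odd? (length suf)))) ≡ false → odd? (length suf) ≡ false
      lem e rewrite oe with odd? (length suf)
      ... | false = refl
      ... | true  = e
    osuf : odd? (length (suf ++ h₀ ∷ [])) ≡ true
    osuf rewrite odd?-++ suf (h₀ ∷ []) | osuf′ = refl

  -- A first neighbour `q` of `y` beyond `π₁` closes a cycle `q , y , π₀ , π₁ , …`, which has to be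
  -- even. This second even hole is joined to the given one: directly, as an eye mask, if `q` ends
  -- the path, and otherwise through the rest of the path, as a handcuff. Without such a `q`,
  -- `holeContact` applies.
  lollipop-clean : ∀ {π₀ π₁ Π h₀ h₁ hs y} → IndPath (π₀ ∷ π₁ ∷ Π) → odd? (length Π) ≡ true →
    Attached (π₀ ∷ π₁ ∷ Π) h₀ h₁ hs → EvenHole h₀ h₁ hs → y ~ π₀ → y # π₁ → All (y ≢_) Π →
    All (y ≢_) (h₀ ∷ h₁ ∷ hs) → All (y #_) (π₁ ∷ Π) × All (y #_) (h₀ ∷ h₁ ∷ hs)
  lollipop-clean {π₀} {π₁} {Π} {h₀} {h₁} {hs} {y} P oP A E yπ₀ yπ₁ dΠ dC with search y Π dΠ
  ... | none c = yπ₁ ∷ c , holeContact P (cong not oP) A E yπ₀ (yπ₁ ∷ c) dC (inj₁ (s≤s z≤n))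
  ... | found pre q suf refl c a = ⊥-elim (go suf refl)
    where
    second : Hole q y (π₀ ∷ π₁ ∷ pre)
    second = ~-sym a , indPath-lastAdj π₀ (π₁ ∷ pre) P , yπ₀ , (yπ₁ ∷ c) , indPath-++ˡ (π₀ ∷ π₁ ∷ pre) P
    w : V
    w = last⁺ π₁ pre
    yw : y # w
    yw = last⁺-All π₁ pre (yπ₁ ∷ c)
    wq : w ~ q
    wq = indPath-last π₀ (π₁ ∷ pre) P
    π₀q : π₀ # q
    π₀q = All.head (++⁻ʳ pre (proj₁ (proj₂ P)))
    go : ∀ suf′ → suf ≡ suf′ → ⊥
    go suf′ e with odd? (length pre) in oe
    ... | true = oddHole second (s≤s (s≤s z≤n)) (cong (λ b → not (not b)) oe)
    go [] refl | false =
      eyeMask second (s≤s (s≤s z≤n)) (cong (λ b → not (not b)) oe) (proj₁ E) (proj₁ (proj₂ E)) (proj₂ (proj₂ E))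
        qh₀ qh₁ yh₀ yh₁ qhs (nonadjs yπ₀ a π₀q (All.tail (All.tail dC)) (All.tail (All.tail (All.head far))) qhs) far
      where
      far : Far (π₀ ∷ π₁ ∷ pre) (h₀ ∷ h₁ ∷ hs)
      far = attached-far (π₀ ∷ π₁ ∷ pre) q [] A
      end : Attached (q ∷ []) h₀ h₁ hs
      end = attached-++ʳ (π₀ ∷ π₁ ∷ pre) q [] A
      qh₀ : q ~ h₀
      qh₀ = proj₁ end
      qh₁ : q ~ h₁
      qh₁ = proj₁ (proj₂ end)
      qhs : All (q #_) hs
      qhs = proj₂ (proj₂ end)
      wh : All (w #_) (h₀ ∷ h₁ ∷ hs)
      wh = last⁺-All π₁ pre (All.tail far)
      yh₀ : y ~ h₀
      yh₀ = noFork (~-sym wq) (~-sym a) qh₀ (#-sym yw) (All.head wh) (All.head dC)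
      yh₁ : y ~ h₁
      yh₁ = noFork (~-sym wq) (~-sym a) qh₁ (#-sym yw) (All.head (All.tail wh)) (All.head (All.tail dC))
    go (q′ ∷ suf′) refl | false =
      handcuff second (s≤s (s≤s z≤n)) (cong (λ b → not (not b)) oe) (proj₁ E) (proj₁ (proj₂ E)) (proj₂ (proj₂ E))
        (indPath-tail q _ pq) osuf (~-sym qq′) (~-sym yq′) (All.map (λ { (u ∷ _) → #-sym u }) farΠ)
        (far-sym (q ∷ y ∷ π₀ ∷ π₁ ∷ pre) suf′ (qsuf ∷ ysuf ∷ All.map All.tail farΠ))
        (attached-++ʳ (q ∷ []) q′ suf′ (attached-++ʳ (π₀ ∷ π₁ ∷ pre) q (q′ ∷ suf′) A))
        (qC ∷ nonadjs yπ₀ a π₀q dC (All.head farC) qC ∷ farC)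
      where
      pq : IndPath (q ∷ q′ ∷ suf′)
      pq = indPath-++ʳ (π₀ ∷ π₁ ∷ pre) P
      qq′ : q ~ q′
      qq′ = proj₁ pq
      qsuf : All (q #_) suf′
      qsuf = proj₁ (proj₂ pq)
      farΠ : Far (π₀ ∷ π₁ ∷ pre) (q′ ∷ suf′)
      farΠ = indPath-far (π₀ ∷ π₁ ∷ pre) P
      dsuf : All (y ≢_) (q ∷ q′ ∷ suf′)
      dsuf = ++⁻ʳ pre dΠ
      yq′ : y ~ q′
      yq′ = noFork (~-sym wq) (~-sym a) qq′ (#-sym yw) (All.head (last⁺-All π₁ pre (All.tail farΠ))) (All.head (All.tail dsuf))
      ysuf : All (y #_) suf′
      ysuf = nonadjs yπ₀ a π₀q (All.tail (All.tail dsuf)) (All.tail (All.head farΠ)) qsuf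
      farC : Far (π₀ ∷ π₁ ∷ pre) (h₀ ∷ h₁ ∷ hs)
      farC = attached-far (π₀ ∷ π₁ ∷ pre) q (q′ ∷ suf′) A
      qC : All (q #_) (h₀ ∷ h₁ ∷ hs)
      qC = proj₁ (attached-++ʳ (π₀ ∷ π₁ ∷ pre) q (q′ ∷ suf′) A)
      osuf : odd? (length suf′) ≡ true
      osuf = lem (trans (≡-sym (odd?-++ pre (q ∷ q′ ∷ suf′))) oP)
        where
        lem : (odd? (length pre) xor not (not (odd? (length suf′)))) ≡ true → odd? (length suf′) ≡ true
        lem e rewrite oe with odd? (length suf′)
        ... | true  = refl
        ... | false = e

-- Stable sets and maximal cliques

module Cliques (G : Graph) where
  open Lists G

  infix 4 _∋_
  _∋_ : (V → Bool) → V → Set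
  L ∋ v = L v ≡ true

  ∋? : ∀ L v → L ∋ v ⊎ L v ≡ false
  ∋? L v with L v
  ... | true  = inj₁ refl
  ... | false = inj₂ refl

  Stable : (V → Bool) → Set
  Stable S = ∀ {x y} → S ∋ x → S ∋ y → x ~ y → ⊥

  record MaxIn (U L : V → Bool) : Set where
    field
      sub : ∀ {v} → L ∋ v → U ∋ v
      clq : ∀ {x y} → L ∋ x → L ∋ y → x ≢ y → x ~ y
      max : ∀ v → U ∋ v → L v ≡ false → ∃ λ u → L ∋ u × u # v

  Max : (V → Bool) → Set
  Max = MaxIn (λ _ → true)

  outside : ∀ {L} → Max L → ∀ v → L v ≡ false → ∃ λ u → L ∋ u × u # v
  outside M v e = MaxIn.max M v refl e

  ∋-≢ : ∀ {L : V → Bool} {x y} → L ∋ x → L y ≡ false → x ≢ y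
  ∋-≢ a b refl = t≢f a b

  ~? : ∀ x y → Dec (x ~ y)
  ~? x y = adj G x y ≟ true

-- Graphs without a 4-wheel

W4Free : Graph → Set
W4Free G = ∀ {c w x y z} → c ~ w → c ~ x → c ~ y → c ~ z → w ~ x → x ~ y → y ~ z → z ~ w → w # y → x # z → ⊥
  where open Lists G

module Pick (G : Graph) (F : Forbidden G) (w4 : W4Free G) where
  open Lists G
  open Forbidden F
  open Contact G F
  open Cliques G

  module _ {s l : V} (sl : s ~ l) where

    R : V → Set
    R r = r ~ s × r # l

    R? : ∀ r → Dec (R r)
    R? r with ~? r s | tri r l
    ... | no a  | _    = no λ x → a (proj₁ x)
    ... | yes a | na b = yes (a , b)
    ... | yes a | eq e = no λ x → proj₂ (proj₂ x) e
    ... | yes a | ad e = no λ x → ~#⊥ e (proj₂ x)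

    Dom : V → V → Set
    Dom r r′ = ∀ x → x ~ s → x ~ l → x ~ r′ → x ~ r

    R-clique : ∀ {r r′} → R r → R r′ → r ≢ r′ → r ~ r′
    R-clique (a , b) (c , d) e = noFork sl (~-sym a) (~-sym c) (#-sym b) (#-sym d) e

    -- If `x′` were a neighbour of `r` missed by `r′`, then `x , r′ , r , x′` would be the rim of a
    -- 4-wheel with hub `s` when `x` and `x′` are adjacent, and would form a five-hole with `l` when
    -- they are not.
    total : ∀ {r r′ x} → R r → R r′ → x ~ s → x ~ l → x ~ r′ → x # r → Dom r′ r
    total {r} {r′} {x} ρ ρ′ xs xl xr′ xr x′ x′s x′l x′r
      with adn x′ r′ (λ e → ~#⊥ x′l (subst (_# l) (≡-sym e) (proj₂ ρ′)))
    ... | ad a = a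
    ... | na b = ⊥-elim (go (tri x x′))
      where
      rr′ : r ~ r′
      rr′ = R-clique ρ ρ′ λ e → ~#⊥ xr′ (subst (x #_) e xr)
      go : Tri x x′ → ⊥
      go (eq e) = ~#⊥ (subst (_~ r′) e xr′) b
      go (ad e) = w4 (~-sym xs) (~-sym (proj₁ ρ′)) (~-sym (proj₁ ρ)) (~-sym x′s)
                     xr′ (~-sym rr′) (~-sym x′r) (~-sym e) xr (#-sym b)
      go (na e) = oddHole {l} {x} {r′ ∷ r ∷ x′ ∷ []}
        (~-sym xl , (#-sym (proj₂ ρ′) , #-sym (proj₂ ρ) , ~-sym x′l) ,
         xr′ , (xr ∷ e ∷ []) , ~-sym rr′ , (#-sym b ∷ []) , ~-sym x′r , [] , tt) (s≤s (s≤s z≤n)) refl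

    best : ∀ xs → All (λ r → ¬ R r) xs ⊎ ∃ λ r → R r × All (λ r′ → R r′ → Dom r r′) xs
    best [] = inj₁ []
    best (x ∷ xs) with R? x | best xs
    ... | no a  | inj₁ b           = inj₁ (a ∷ b)
    ... | no a  | inj₂ (r , ρ , d) = inj₂ (r , ρ , (λ b → ⊥-elim (a b)) ∷ d)
    ... | yes a | inj₁ b           = inj₂ (x , a , (λ _ _ _ _ c → c) ∷ All.map (λ f g → ⊥-elim (f g)) b)
    ... | yes a | inj₂ (r , ρ , d) with any? (λ w → ~? w s ×-dec ~? w l ×-dec ~? w x ×-dec (adj G w r ≟ false))
    ...   | yes (w , ws , wl , wx , wr) =
      inj₂ (x , a , (λ _ _ _ _ c → c) ∷ All.map (λ f g z zs zl zr′ → xr z zs zl (f g z zs zl zr′)) d)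
      where
      xr : Dom x r
      xr = total ρ a ws wl wx (wr , λ e → ~#⊥ wl (subst (_# l) (≡-sym e) (proj₂ ρ)))
    ...   | no c = inj₂ (r , ρ , (λ _ → dom) ∷ d)
      where
      dom : Dom r x
      dom w ws wl wx with adj G w r in e
      ... | true  = refl
      ... | false = ⊥-elim (c (w , ws , wl , wx , e))

  -- N(s) \ N[l] is a clique, and its members have nested neighbourhoods in N(s) ∩ N(l);
  -- the one with the largest neighbourhood lies in every maximal clique through s avoiding l.
  pick : ∀ {s l} → s ~ l → (∀ L → Max L → L ∋ s → L ∋ l) ⊎
         ∃ λ r → r ~ s × r # l × (∀ L → Max L → L ∋ s → L ∋ l ⊎ L ∋ r)
  pick {s} {l} sl with best sl (allFin (n G))
  ... | inj₁ empty = inj₁ go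
    where
    go : ∀ L → Max L → L ∋ s → L ∋ l
    go L M Ls with ∋? L l
    ... | inj₁ a = a
    ... | inj₂ b with outside M l b
    ...   | u , Lu , ul = ⊥-elim (All.lookup empty (∈-allFin u)
            (MaxIn.clq M Lu Ls (λ e → ~#⊥ sl (subst (_# l) e ul)) , ul))
  ... | inj₂ (r , ρ , d) = inj₂ (r , proj₁ ρ , proj₂ ρ , go)
    where
    go : ∀ L → Max L → L ∋ s → L ∋ l ⊎ L ∋ r
    go L M Ls with ∋? L l | ∋? L r
    ... | inj₁ a | _      = inj₁ a
    ... | inj₂ _ | inj₁ b = inj₂ b
    ... | inj₂ a | inj₂ b with outside M r b | outside M l a
    -- `u` sees `l`, since otherwise `l , u , r` form a claw at `s`. So `u` is a common neighbour of
    -- `s`, `l` and `r′` that `r` misses, against the choice of `r`.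
    ...   | u , Lu , ur | r′ , Lr′ , r′l = ⊥-elim (case (adn u l (∋-≢ Lu a)))
      where
      us : u ~ s
      us = MaxIn.clq M Lu Ls λ e → ~#⊥ (~-sym (proj₁ ρ)) (subst (_# r) e ur)
      r′s : r′ ~ s
      r′s = MaxIn.clq M Lr′ Ls λ e → ~#⊥ sl (subst (_# l) e r′l)
      case : AdN u l → ⊥
      case (na e) = claw sl (~-sym us) (~-sym (proj₁ ρ)) (#-sym e) (#-sym (proj₂ ρ)) ur
      case (ad e) = ~#⊥ (All.lookup d (∈-allFin r′) (r′s , r′l) u us e
        (MaxIn.clq M Lu Lr′ λ q → ~#⊥ e (subst (_# l) (≡-sym q) r′l))) ur

-- Exchanges along a growing path

module Legs (G : Graph) (F : Forbidden G) (w4 : W4Free G) where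
  open Lists G
  open Forbidden F
  open Cliques G
  open Pick G F w4

  module Augment (S : V → Bool) (stable : Stable S) where

    -- Exchanging Rm ⊆ S for Ad keeps stability and loses no maximal clique.
    record Flip (Rm Ad : List V) : Set where
      field
        indep : ∀ {x y} → x ∈ Ad → y ∈ Ad → x ~ y → ⊥
        nbr   : ∀ {x u} → x ∈ Ad → S ∋ u → x ~ u → u ∈ Rm
        cover : ∀ {s} → s ∈ Rm → ∀ L → Max L → L ∋ s → ∃ λ x → x ∈ Ad × L ∋ x

    Saturated : List V → Set
    Saturated X = ∀ {w u} → w ∈ X → S w ≡ false → S ∋ u → u ~ w → u ∈ X

    stable-# : ∀ {x y} → S ∋ x → S ∋ y → x ≢ y → x # y
    stable-# {x} {y} a b d with adn x y d
    ... | ad e = ⊥-elim (stable a b e)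
    ... | na e = e

    two-nbrs : ∀ {y s u u′} → S ∋ s → S ∋ u → u ≢ s → s ~ y → u ~ y → S ∋ u′ → u′ ~ y → u′ ≡ s ⊎ u′ ≡ u
    two-nbrs {y} {s} {u} {u′} Ss Su us sy uy Su′ u′y with u′ F.≟ s | u′ F.≟ u
    ... | yes a | _     = inj₁ a
    ... | no _  | yes b = inj₂ b
    ... | no a  | no b  = ⊥-elim (claw (~-sym sy) (~-sym uy) (~-sym u′y)
          (stable-# Ss Su λ e → us (≡-sym e)) (stable-# Ss Su′ λ e → a (≡-sym e)) (stable-# Su Su′ λ e → b (≡-sym e)))

    -- `u` is not in `X`, because `y` sees nothing there except `s`. Saturation then keeps `u` from
    -- seeing the vertices of `X` outside `S`, and stability from seeing those in `S`.
    far-from : ∀ {X s y u} → Saturated X → (∀ {x} → x ∈ X → x ≡ s ⊎ y # x) → S ∋ u → u ~ y → u ≢ s →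
               ∀ {w} → w ∈ X → u # w
    far-from {X} {s} {y} {u} sat clean Su uy us {w} w∈ = go (∋? S w) (tri u w)
      where
      absent : u ∈ X → ⊥
      absent u∈ with clean u∈
      ... | inj₁ e = us e
      ... | inj₂ e = ~#⊥ (~-sym uy) e
      go : S ∋ w ⊎ S w ≡ false → Tri u w → u # w
      go _        (na e)    = e
      go _        (eq refl) = ⊥-elim (absent w∈)
      go (inj₁ a) (ad e)    = ⊥-elim (stable Su a e)
      go (inj₂ a) (ad e)    = ⊥-elim (absent (sat w∈ a Su e))

    -- A leg s ∷ l ∷ Π alternates between S and its complement, newest vertex first; while the current s lies
    -- in maximal cliques avoiding l, pick supplies the next vertex outside S. Geo is the invariant of the leg,
    -- C a set of vertices it must avoid, and Out the outcome when the leg runs into itself.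
    module Walk (C : List V) (Geo : List V → Set) (Good : V → Set) (Out : Set)
      (extend : ∀ {s l Π y} → Geo (s ∷ l ∷ Π) → Saturated ((s ∷ l ∷ Π) ++ C) → S ∋ s → y ~ s → y # l → S y ≡ false →
        Out ⊎ (All (y #_) (l ∷ Π) × All (y #_) C × Good y ×
               (∀ u → S ∋ u → u ~ y → All (u #_) (s ∷ l ∷ Π) → All (u #_) C →
                Geo (u ∷ y ∷ s ∷ l ∷ Π) × Good u))) where

      -- `nbr` already counts `s` as removed, while `cover` speaks of `Rm` only: the maximal cliques
      -- through `s` are the open obligation, which the next use of `pick` settles.
      record State (s l : V) (Π Rm Ad : List V) : Set where
        field
          geo   : Geo (s ∷ l ∷ Π)
          sat   : Saturated ((s ∷ l ∷ Π) ++ C)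
          Ss    : S ∋ s
          sl    : s ~ l
          indep : ∀ {x y} → x ∈ (l ∷ Ad) → y ∈ (l ∷ Ad) → x ~ y → ⊥
          nbr   : ∀ {x u} → x ∈ (l ∷ Ad) → S ∋ u → x ~ u → u ∈ s ∷ Rm
          cover : ∀ {r} → r ∈ Rm → ∀ L → Max L → L ∋ r → ∃ λ x → x ∈ (l ∷ Ad) × L ∋ x
          rm    : All (_∈ (s ∷ l ∷ Π)) Rm
          inAd  : All (_∈ (l ∷ Π)) (l ∷ Ad)
          good  : All Good (s ∷ Rm) × All Good (l ∷ Ad)

      Done : List V → Set
      Done Ad₀ = ∃ λ Rm → ∃ λ Ad → Flip Rm Ad × All (_∈ Ad) Ad₀ × All Good Rm × All Good Ad

      -- `pool` contains the members of `S` that are not yet removed and loses `u` in each round, so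
      -- its length bounds the recursion.
      run : ∀ k pool → length pool ≤ k → ∀ {s l Π Rm Ad} → State s l Π Rm Ad →
            (∀ {x} → S ∋ x → x ∈ s ∷ Rm ⊎ x ∈ pool) → Out ⊎ Done (l ∷ Ad)
      run k pool le {s} {l} {Π} {Rm} {Ad} st fresh with pick (State.sl st)
      ... | inj₁ all = inj₂ (s ∷ Rm , l ∷ Ad , record { indep = indep ; nbr = nbr ; cover = cov } ,
                             All.tabulate (λ z → z) , good)
        where
        open State st
        cov : ∀ {r} → r ∈ s ∷ Rm → ∀ L → Max L → L ∋ r → ∃ λ x → x ∈ (l ∷ Ad) × L ∋ x
        cov (here refl) L M Lr = l , here refl , all L M Lr
        cov (there m)   L M Lr = cover m L M Lr
      ... | inj₂ (y , ys , yl , hit) with ∋? S y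
      ...   | inj₁ Sy = ⊥-elim (stable Sy (State.Ss st) ys)
      ...   | inj₂ Sy with extend (State.geo st) (State.sat st) (State.Ss st) ys yl Sy
      ...     | inj₁ o = inj₁ o
      ...     | inj₂ (clean , cleanC , gy , next)
              with any? (λ u → (S u ≟ true) ×-dec ~? u y ×-dec ¬? (u F.≟ s))
      -- `y` can be added at no further cost, and `l` and `y` together meet every maximal clique
      -- through `s`.
      ...       | no lone = inj₂ (s ∷ Rm , y ∷ l ∷ Ad , record { indep = ind ; nbr = nb ; cover = cov } ,
                                  All.tabulate there , proj₁ good , gy ∷ proj₂ good)
        where
        open State st
        apart : ∀ {x} → x ∈ l ∷ Ad → y # x
        apart m = All.lookup clean (All.lookup inAd m)
        ind : ∀ {x z} → x ∈ y ∷ l ∷ Ad → z ∈ y ∷ l ∷ Ad → x ~ z → ⊥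
        ind (here refl) (here refl) a = ~⇒≢ a refl
        ind (here refl) (there m)   a = ~#⊥ a (apart m)
        ind (there m)   (here refl) a = ~#⊥ (~-sym a) (apart m)
        ind (there m)   (there m′)  a = indep m m′ a
        nb : ∀ {x u} → x ∈ y ∷ l ∷ Ad → S ∋ u → x ~ u → u ∈ s ∷ Rm
        nb {u = u} (here refl) Su a with u F.≟ s
        ... | yes e = here e
        ... | no d  = ⊥-elim (lone (u , Su , ~-sym a , d))
        nb (there m) Su a = nbr m Su a
        cov : ∀ {r} → r ∈ s ∷ Rm → ∀ L → Max L → L ∋ r → ∃ λ x → x ∈ (y ∷ l ∷ Ad) × L ∋ x
        cov (here refl) L M Lr with hit L M Lr
        ... | inj₁ a = l , there (here refl) , a
        ... | inj₂ a = y , here refl , a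
        cov (there m) L M Lr with cover m L M Lr
        ... | x , x∈ , a = x , there x∈ , a
      -- Adding `y` forces `u` out of `S`, so `u` becomes the next open obligation.
      ...       | yes (u , Su , uy , us) = again k le
        where
        open State st
        clean′ : ∀ {x} → x ∈ (s ∷ l ∷ Π) ++ C → x ≡ s ⊎ y # x
        clean′ (here refl) = inj₁ refl
        clean′ (there m)   = inj₂ (All.lookup (++⁺ clean cleanC) m)
        farX : ∀ {w} → w ∈ (s ∷ l ∷ Π) ++ C → u # w
        farX = far-from sat clean′ Su uy us
        farΠ : All (u #_) (s ∷ l ∷ Π)
        farΠ = ++⁻ˡ (s ∷ l ∷ Π) (All.tabulate farX)
        farC : All (u #_) C
        farC = ++⁻ʳ (s ∷ l ∷ Π) (All.tabulate farX)
        u∉ : ∀ {x} → x ∈ s ∷ Rm → u ≢ x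
        u∉ (here refl) e    = us e
        u∉ (there m)   refl = proj₂ (All.lookup farΠ (All.lookup rm m)) refl
        apart : ∀ {x} → x ∈ l ∷ Ad → y # x
        apart m = All.lookup clean (All.lookup inAd m)
        st′ : State u y (s ∷ l ∷ Π) (s ∷ Rm) (l ∷ Ad)
        st′ = record
          { geo   = proj₁ (next u Su uy farΠ farC)
          ; sat   = sat′
          ; Ss    = Su
          ; sl    = uy
          ; indep = ind
          ; nbr   = nb
          ; cover = cov
          ; rm    = there (there (here refl)) ∷ All.map (λ m → there (there m)) rm
          ; inAd  = here refl ∷ All.map (λ m → there (there m)) inAd
          ; good  = proj₂ (next u Su uy farΠ farC) ∷ proj₁ good , gy ∷ proj₂ good }
          where
          sat′ : Saturated ((u ∷ y ∷ s ∷ l ∷ Π) ++ C)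
          sat′ (here refl) e _ _ = ⊥-elim (t≢f Su e)
          sat′ (there (here refl)) _ Su′ u′y with two-nbrs Ss Su us (~-sym ys) uy Su′ u′y
          ... | inj₁ refl = there (there (here refl))
          ... | inj₂ refl = here refl
          sat′ (there (there m)) e Su′ a = there (there (sat m e Su′ a))
          ind : ∀ {x z} → x ∈ y ∷ l ∷ Ad → z ∈ y ∷ l ∷ Ad → x ~ z → ⊥
          ind (here refl) (here refl) a = ~⇒≢ a refl
          ind (here refl) (there m)   a = ~#⊥ a (apart m)
          ind (there m)   (here refl) a = ~#⊥ (~-sym a) (apart m)
          ind (there m)   (there m′)  a = indep m m′ a
          nb : ∀ {x u′} → x ∈ y ∷ l ∷ Ad → S ∋ u′ → x ~ u′ → u′ ∈ u ∷ s ∷ Rm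
          nb (here refl) Su′ a with two-nbrs Ss Su us (~-sym ys) uy Su′ (~-sym a)
          ... | inj₁ refl = there (here refl)
          ... | inj₂ refl = here refl
          nb (there m) Su′ a = there (nbr m Su′ a)
          cov : ∀ {r} → r ∈ s ∷ Rm → ∀ L → Max L → L ∋ r → ∃ λ x → x ∈ (y ∷ l ∷ Ad) × L ∋ x
          cov (here refl) L M Lr with hit L M Lr
          ... | inj₁ a = l , there (here refl) , a
          ... | inj₂ a = y , here refl , a
          cov (there m) L M Lr with cover m L M Lr
          ... | x , x∈ , a = x , there x∈ , a
        keep? : ∀ x → Dec (x ≢ u)
        keep? x = ¬? (x F.≟ u)
        u∈pool : u ∈ pool
        u∈pool with fresh Su
        ... | inj₁ m = ⊥-elim (u∉ m refl)
        ... | inj₂ m = m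
        shorter : length (filter keep? pool) < length pool
        shorter = filter-notAll keep? pool (lose u∈pool (λ f → f refl))
        fresh′ : ∀ {x} → S ∋ x → x ∈ u ∷ s ∷ Rm ⊎ x ∈ filter keep? pool
        fresh′ {x} Sx with x F.≟ u | fresh Sx
        ... | yes e | _      = inj₁ (here e)
        ... | no d  | inj₁ m = inj₁ (there m)
        ... | no d  | inj₂ m = inj₂ (∈-filter⁺ keep? m d)
        again : ∀ k → length pool ≤ k → Out ⊎ Done (l ∷ Ad)
        again zero le′ with ≤-trans shorter le′
        ... | ()
        again (suc k′) le′ with run k′ (filter keep? pool) (≤-pred (≤-trans shorter le′)) st′ fresh′
        ... | inj₁ o = inj₁ o
        ... | inj₂ (Rm′ , Ad′ , f , sub , g) = inj₂ (Rm′ , Ad′ , f , All.tail sub , g)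

      start : ∀ {s l Π Rm Ad} → State s l Π Rm Ad → Out ⊎ Done (l ∷ Ad)
      start st = run _ (allFin (n G)) ≤-refl st (λ {x} _ → inj₂ (∈-allFin x))
        where open import Data.Nat.Properties using (≤-refl)

-- A lollipop whose tail is a single vertex

module ShortContact (G : Graph) (F : Forbidden G) (w4 : W4Free G) where
  open Lists G
  open Forbidden F
  open Contact G F

  private
    module C = Base (co G)

    co~ : ∀ {x y} → x # y → x C.~ y
    co~ r = proj₁ (co-Rel G r)

    co# : ∀ {x y} → x ~ y → x C.# y
    co# a = co-Rel G (~⇒Rel a)

  -- A claw at `h₁` makes `k` adjacent to `h₂`, which is why the hypothesis on `ρ` can be
  -- conditional. Then `k` sees `h₃` too, as otherwise replacing `h₁` by `v , k` turns the even hole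
  -- into an odd one. Now `ρ` sees `h₂` but not `k`, and every position of it gives a five-hole, a
  -- 4-wheel, an antihole of length seven or a longer odd hole.
  short-contact : ∀ {v k ρ h₀ h₁ h₂ h₃ gs} → EvenHole h₀ h₁ (h₂ ∷ h₃ ∷ gs) →
    v ~ h₀ → v ~ h₁ → All (v #_) (h₂ ∷ h₃ ∷ gs) → k ~ v → k # h₀ → k ~ h₁ →
    (k ~ h₂ → ρ ~ h₂) → ρ # k → ⊥
  short-contact {v} {k} {ρ} {h₀} {h₁} {h₂} {h₃} {gs} ((h01 , hl , hp) , _ , he) vh₀ vh₁ vhs kv kh₀ kh₁ ρh ρk =
    atk (adn k h₃ (k≢ (All.head (All.tail vhs))))
    where
    k≢ : ∀ {z} → v # z → k ≢ z
    k≢ vz e = ~#⊥ (~-sym kv) (subst (v #_) (≡-sym e) vz)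
    k≢s : ∀ {zs} → All (v #_) zs → All (k ≢_) zs
    k≢s = All.map k≢
    h₀h₂ : h₀ # h₂
    h₀h₂ = proj₁ hl
    h₁h₂ : h₁ ~ h₂
    h₁h₂ = proj₁ hp
    kh₂ : k ~ h₂
    kh₂ = ~-sym (noFork (~-sym h01) h₁h₂ (~-sym kh₁) h₀h₂ (#-sym kh₀) (λ e → k≢ (All.head vhs) (≡-sym e)))
    ρh₂ : ρ ~ h₂
    ρh₂ = ρh kh₂
    p₂ : IndPath (h₂ ∷ h₃ ∷ gs)
    p₂ = indPath-tail h₁ _ hp
    h₂gs : All (h₂ #_) gs
    h₂gs = proj₁ (proj₂ p₂)
    vh₂ : v # h₂
    vh₂ = All.head vhs
    kgs : All (k #_) gs
    kgs = nonadjs kv kh₂ vh₂ (k≢s (All.tail (All.tail vhs))) (All.tail (All.tail vhs)) h₂gs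
    around : IndPath ((h₂ ∷ h₃ ∷ gs) ++ h₀ ∷ [])
    around = indPath-∷ʳ (h₂ ∷ h₃ ∷ gs) h₀ p₂ hl
    v-around : LastAdj v ((h₂ ∷ h₃ ∷ gs) ++ h₀ ∷ [])
    v-around = lastAdj-∷ʳ (h₂ ∷ h₃ ∷ gs) vhs vh₀
    odd1 : ∀ xs → odd? (length xs) ≡ false → odd? (length (xs ++ h₀ ∷ [])) ≡ true
    odd1 xs e rewrite odd?-++ xs (h₀ ∷ []) | e = refl
    five : ∀ {ρ} → ρ ~ h₂ → ρ # k → ρ ~ h₀ → v # ρ → ⊥
    five a b c d = oddHole {v} {k} {h₂ ∷ _ ∷ h₀ ∷ []}
      (~-sym kv , (vh₂ , d , vh₀) , kh₂ , (#-sym b ∷ kh₀ ∷ []) , ~-sym a , (#-sym h₀h₂ ∷ []) , c , [] , tt)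
      (s≤s (s≤s z≤n)) refl
    ρ≢v : ρ ≢ v
    ρ≢v e = ~#⊥ kv (subst (k #_) e (#-sym ρk))
    ρ≢h₀ : ρ ≢ h₀
    ρ≢h₀ e = ~#⊥ ρh₂ (subst (_# h₂) (≡-sym e) h₀h₂)
    caseA : ρ ~ h₁ → ⊥
    caseA ρh₁ = go (adn v ρ (λ e → ρ≢v (≡-sym e)))
      where
      ρh₀ : ρ ~ h₀
      ρh₀ = ~-sym (noFork (~-sym kh₁) (~-sym h01) (~-sym ρh₁) kh₀ (#-sym ρk) (λ e → ρ≢h₀ (≡-sym e)))
      go : AdN v ρ → ⊥
      go (na b) = five ρh₂ ρk ρh₀ b
      go (ad b) = w4 (~-sym vh₁) (~-sym kh₁) h₁h₂ (~-sym ρh₁) (~-sym kv) kh₂ (~-sym ρh₂) (~-sym b) vh₂ (#-sym ρk)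
    caseB : ρ # h₁ → k ~ h₃ → ⊥
    caseB ρh₁ kh₃ = rest gs refl
      where
      h₁h₃ : h₁ # h₃
      h₁h₃ = All.head (proj₁ (proj₂ hp))
      h₂h₃ : h₂ ~ h₃
      h₂h₃ = proj₁ p₂
      ρh₃ : ρ ~ h₃
      ρh₃ = ~-sym (noFork (~-sym h₁h₂) h₂h₃ (~-sym ρh₂) h₁h₃ (#-sym ρh₁) (λ e → ~#⊥ kh₃ (subst (k #_) (≡-sym e) (#-sym ρk))))
      rest : ∀ gs′ → gs ≡ gs′ → ⊥
      rest [] refl = go (adn v ρ (λ e → ρ≢v (≡-sym e)))
        where
        h₀h₃ : h₀ ~ h₃
        h₀h₃ = proj₂ hl
        ρh₀ : ρ ~ h₀
        ρh₀ = ~-sym (noFork (~-sym kh₃) (~-sym h₀h₃) (~-sym ρh₃) kh₀ (#-sym ρk) (λ e → ρ≢h₀ (≡-sym e)))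
        go : AdN v ρ → ⊥
        go (na b) = five ρh₂ ρk ρh₀ b
        go (ad b) = antihole {v} {h₃} {h₁ ∷ ρ ∷ k ∷ h₀ ∷ h₂ ∷ []}
          (co~ (All.head (All.tail vhs)) ,
           (co# vh₁ , co# b , co# (~-sym kv) , co# vh₀ , co~ vh₂) ,
           co~ (#-sym h₁h₃) , (co# (~-sym ρh₃) ∷ co# (~-sym kh₃) ∷ co# (~-sym h₀h₃) ∷ co# (~-sym h₂h₃) ∷ []) ,
           co~ (#-sym ρh₁) , (co# (~-sym kh₁) ∷ co# (~-sym h01) ∷ co# h₁h₂ ∷ []) ,
           co~ ρk , (co# ρh₀ ∷ co# ρh₂ ∷ []) ,
           co~ kh₀ , (co# kh₂ ∷ []) ,
           co~ h₀h₂ , [] , tt) (s≤s (s≤s (s≤s z≤n)))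
      rest (h₄ ∷ []) refl = t≢f refl he
      rest (h₄ ∷ h₅ ∷ gs″) refl = go (adn ρ h₅ (λ e → ~#⊥ ρh₂ (subst (_# h₂) (≡-sym e) (#-sym (All.head (All.tail h₂gs))))))
        where
        p₃ : IndPath (h₃ ∷ h₄ ∷ h₅ ∷ gs″)
        p₃ = indPath-tail h₂ _ p₂
        p₄ : IndPath (h₄ ∷ h₅ ∷ gs″)
        p₄ = indPath-tail h₃ _ p₃
        hl₄ : LastAdj h₀ (h₄ ∷ h₅ ∷ gs″)
        hl₄ = proj₂ (proj₂ hl)
        h₂h₄ : h₂ # h₄
        h₂h₄ = All.head h₂gs
        ρh₄ : ρ ~ h₄
        ρh₄ = ~-sym (noFork (~-sym kh₃) (proj₁ p₃) (~-sym ρh₃) (All.head kgs) (#-sym ρk)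
                (λ e → ~#⊥ ρh₂ (subst (_# h₂) e (#-sym h₂h₄))))
        ρv : ρ # v
        ρv = nonadj ρh₂ ρh₄ h₂h₄ ρ≢v (#-sym vh₂) (#-sym (All.head (All.tail (All.tail vhs))))
        ρh₀ : ρ # h₀
        ρh₀ = nonadj ρh₂ ρh₄ h₂h₄ ρ≢h₀ (#-sym h₀h₂) (#-sym (proj₁ hl₄))
        ρgs : All (ρ #_) gs″
        ρgs = nonadjs ρh₂ ρh₄ h₂h₄ (All.map (λ z e → ~#⊥ ρh₂ (subst (_# h₂) (≡-sym e) (#-sym z))) (All.tail (All.tail h₂gs)))
                (All.tail (All.tail h₂gs)) (proj₁ (proj₂ p₄))
        even : odd? (length gs″) ≡ false
        even = lem he
          where
          lem : ∀ {b} → not (not (not (not b))) ≡ false → b ≡ false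
          lem {false} _ = refl
        go : AdN ρ h₅ → ⊥
        -- Here `ρ` replaces `h₃ , h₄`, which shortens the even hole by one. In the next case
        -- `v , k` replace `h₁` and `ρ` replaces `h₃`, which lengthens it by one.
        go (ad b) = oddHole {h₁} {h₂} {ρ ∷ (h₅ ∷ gs″) ++ h₀ ∷ []}
          (h₁h₂ ,
           lastAdj-∷ʳ (ρ ∷ h₅ ∷ gs″) (#-sym ρh₁ ∷ All.tail (All.tail (proj₁ (proj₂ hp)))) (~-sym h01) ,
           ~-sym ρh₂ , ∷ʳ⁺ (All.tail h₂gs) (#-sym h₀h₂) ,
           b , ∷ʳ⁺ ρgs ρh₀ ,
           indPath-∷ʳ (h₅ ∷ gs″) h₀ (indPath-tail h₄ _ p₄) (proj₂ hl₄))
          (s≤s (s≤s z≤n)) (cong (λ c → not (not c)) (odd1 gs″ even))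
        go (na b) = oddHole {v} {k} {h₂ ∷ ρ ∷ (h₄ ∷ h₅ ∷ gs″) ++ h₀ ∷ []}
          (~-sym kv ,
           lastAdj-∷ʳ (h₂ ∷ ρ ∷ h₄ ∷ h₅ ∷ gs″) (vh₂ ∷ #-sym ρv ∷ All.tail (All.tail vhs)) vh₀ ,
           kh₂ , (#-sym ρk ∷ ∷ʳ⁺ kgs kh₀) ,
           ~-sym ρh₂ , ∷ʳ⁺ h₂gs (#-sym h₀h₂) ,
           ρh₄ , ∷ʳ⁺ (b ∷ ρgs) ρh₀ ,
           indPath-∷ʳ (h₄ ∷ h₅ ∷ gs″) h₀ p₄ hl₄)
          (s≤s (s≤s z≤n)) (cong (λ c → not (not (not (not c)))) (odd1 gs″ even))
    atk : AdN k h₃ → ⊥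
    atk (na b) = oddHole {v} {k} {(h₂ ∷ h₃ ∷ gs) ++ h₀ ∷ []}
      (~-sym kv , v-around , kh₂ , ∷ʳ⁺ (b ∷ kgs) kh₀ , around) (s≤s (s≤s z≤n)) (odd1 (h₂ ∷ h₃ ∷ gs) he)
    atk (ad b) with adn ρ h₁ (λ e → ~#⊥ kh₁ (subst (k #_) e (#-sym ρk)))
    ... | ad c = caseA c
    ... | na c = caseB c b

-- The leg from a vertex with one neighbour in the stable set

module RootedLeg (G : Graph) (F : Forbidden G) (w4 : W4Free G)
  (S : F.Fin (n G) → Bool) (stable : Cliques.Stable G S) where
  open Lists G
  open Forbidden F
  open Contact G F
  open Cliques G
  open Legs G F w4
  open Augment S stable

  -- The even hole and its tail that arise when the leg meets itself; a tail consisting of v alone is kept apart.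
  data Lollipop (v t : V) (Good : V → Set) : Set where
    short : ∀ {h₁ h₂ h₃ gs} → EvenHole t h₁ (h₂ ∷ h₃ ∷ gs) → v ~ t → v ~ h₁ → All (v #_) (h₂ ∷ h₃ ∷ gs) →
      S ∋ h₂ → Saturated (v ∷ t ∷ h₁ ∷ h₂ ∷ h₃ ∷ gs) → All Good (t ∷ h₁ ∷ h₂ ∷ h₃ ∷ gs) → Lollipop v t Good
    long  : ∀ {Λ h₀ h₁ hs} → IndPath (v ∷ t ∷ Λ) → odd? (length Λ) ≡ true → Attached (v ∷ t ∷ Λ) h₀ h₁ hs →
      EvenHole h₀ h₁ hs → Saturated ((v ∷ t ∷ Λ) ++ h₀ ∷ h₁ ∷ hs) → All Good (t ∷ Λ) →
      All Good (h₀ ∷ h₁ ∷ hs) → Lollipop v t Good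

  -- Separates the two shapes of a lollipop: the edge `q q′` at which the leg closes is its initial
  -- edge `t v`, or it lies nearer to the growing end.
  tail-end : ∀ {t v : V} xs {q q′ suf} P₀ → xs ++ q ∷ q′ ∷ suf ≡ P₀ ++ t ∷ v ∷ [] →
    (suf ≡ [] × q ≡ t × q′ ≡ v) ⊎ ∃ λ P₁ → q′ ∷ suf ≡ P₁ ++ t ∷ v ∷ []
  tail-end []           []       refl = inj₁ (refl , refl , refl)
  tail-end []           (p ∷ P₁) e    = inj₂ (P₁ , ∷-injectiveʳ e)
  tail-end (x ∷ xs)     (p ∷ P₁) e    = tail-end xs P₁ (∷-injectiveʳ e)
  tail-end (x ∷ [])         [] ()
  tail-end (x ∷ x′ ∷ [])    [] ()
  tail-end (x ∷ x′ ∷ _ ∷ _) [] ()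

  -- `Good` carries information along the leg: `hook` hands it to new vertices outside `S`, `hookS`
  -- to their neighbours in `S`. It is trivial for a leg on its own; in a sun it records the side on
  -- which the leg stays.
  module Rooted {v t : V} (vt : v ~ t) (St : S ∋ t) (Sv : S v ≡ false) (uniq : ∀ {u} → S ∋ u → u ~ v → u ≡ t)
    (Good : V → Set) (good-t : Good t)
    (hook : ∀ {P₀ s l Π y} → s ∷ l ∷ Π ≡ P₀ ++ t ∷ v ∷ [] → IndPath (s ∷ l ∷ Π) → odd? (length Π) ≡ false →
      All Good P₀ → Saturated (s ∷ l ∷ Π) → S ∋ s → y ~ s → y # l → S y ≡ false → Good y)
    (hookS : ∀ {y u} → Good y → S y ≡ false → S ∋ u → u ~ y → Good u) where

    Good′ : V → Set
    Good′ w = w ≡ v ⊎ Good w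

    Geo : List V → Set
    Geo Π = ∃ λ P₀ → Π ≡ P₀ ++ t ∷ v ∷ [] × IndPath Π × odd? (length Π) ≡ false × All Good P₀

    notnot : ∀ {b c} → not (not b) ≡ c → b ≡ c
    notnot {false} e = e
    notnot {true}  e = e

    extend : ∀ {s l Π y} → Geo (s ∷ l ∷ Π) → Saturated ((s ∷ l ∷ Π) ++ []) → S ∋ s → y ~ s → y # l → S y ≡ false →
      Lollipop v t Good ⊎ (All (y #_) (l ∷ Π) × All (y #_) [] × Good′ y ×
        (∀ u → S ∋ u → u ~ y → All (u #_) (s ∷ l ∷ Π) → All (u #_) [] → Geo (u ∷ y ∷ s ∷ l ∷ Π) × Good′ u))
    extend {s} {l} {Π} {y} (P₀ , eΠ , P , oP , gP) sat₀ Ss ys yl Sy with search y Π dΠ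
      where
      dΠ : All (y ≢_) Π
      dΠ = All.map (λ { r refl → ~#⊥ (~-sym ys) r }) (proj₁ (proj₂ P))
    ... | none c = inj₂ (yl ∷ c , [] , inj₂ gy , next)
      where
      gy : Good y
      gy = hook {P₀} eΠ P (notnot oP) gP (subst Saturated (++-identityʳ _) sat₀) Ss ys yl Sy
      next : ∀ u → S ∋ u → u ~ y → All (u #_) (s ∷ l ∷ Π) → All (u #_) [] → Geo (u ∷ y ∷ s ∷ l ∷ Π) × Good′ u
      next u Su uy far _ =
        (u ∷ y ∷ P₀ , cong (λ l → u ∷ y ∷ l) eΠ , (uy , far , ys , (yl ∷ c) , P) ,
          trans (cong (λ b → not (not b)) oP) refl , hookS gy Sy Su uy ∷ gy ∷ gP) ,
        inj₂ (hookS gy Sy Su uy)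
    ... | found pre q suf refl c a = inj₁ (close suf refl)
      where
      sat : Saturated (s ∷ l ∷ pre ++ q ∷ suf)
      sat = subst Saturated (++-identityʳ _) sat₀
      gy : Good y
      gy = hook {P₀} eΠ P (notnot oP) gP sat Ss ys yl Sy
      dΠ : All (y ≢_) (pre ++ q ∷ suf)
      dΠ = All.map (λ { r refl → ~#⊥ (~-sym ys) r }) (proj₁ (proj₂ P))
      H : Hole q y (s ∷ l ∷ pre)
      H = ~-sym a , indPath-lastAdj s (l ∷ pre) P , ys , (yl ∷ c) , indPath-++ˡ (s ∷ l ∷ pre) P
      w : V
      w = last⁺ l pre
      yw : y # w
      yw = last⁺-All l pre (yl ∷ c)
      wq : w ~ q
      wq = indPath-last s (l ∷ pre) P
      sq : s # q
      sq = All.head (++⁻ʳ pre (proj₁ (proj₂ P)))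
      -- A neighbour `u` of `y` in `S` other than `s` is `q` or sees `q`, because otherwise
      -- `s , q , u` form a claw at `y`. If it sees `q`, saturation has listed it already.
      y-sat : ∀ {u} → S ∋ u → u ~ y → u ∈ s ∷ l ∷ pre ++ q ∷ suf
      y-sat {u} Su uy with u F.≟ s
      ... | yes e = here e
      ... | no d with tri u q | ∋? S q
      ...   | eq e | _       = there (there (subst (_∈ pre ++ q ∷ suf) (≡-sym e) (∈-++⁺ʳ pre (here refl))))
      ...   | na e | _       = ⊥-elim (claw ys a (~-sym uy) sq (stable-# Ss Su (λ e → d (≡-sym e))) (#-sym e))
      ...   | ad e | inj₁ Sq = ⊥-elim (stable Su Sq e)
      ...   | ad e | inj₂ Sq = sat (there (there (∈-++⁺ʳ pre (here refl)))) Sq Su e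
      close : ∀ suf′ → suf ≡ suf′ → Lollipop v t Good
      close suf′ e with odd? (length pre) in oe
      ... | true = ⊥-elim (oddHole H (s≤s (s≤s z≤n)) (cong (λ b → not (not b)) oe))
      -- `Π` has even length, so `pre` would be odd if `q` were the root `v`; that is the odd hole
      -- of the previous case.
      close [] refl | false = ⊥-elim (t≢f par oP)
        where
        par : not (not (odd? (length (pre ++ q ∷ [])))) ≡ true
        par rewrite odd?-++ pre (q ∷ []) | oe = refl
      close (q′ ∷ suf′) refl | false = shape (tail-end (s ∷ l ∷ pre) P₀ eΠ)
        where
        pq : IndPath (q ∷ q′ ∷ suf′)
        pq = indPath-++ʳ (s ∷ l ∷ pre) P
        E : EvenHole q y (s ∷ l ∷ pre)
        E = H , s≤s (s≤s z≤n) , cong (λ b → not (not b)) oe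
        farΠ : Far (s ∷ l ∷ pre) (q′ ∷ suf′)
        farΠ = indPath-far (s ∷ l ∷ pre) P
        dsuf : All (y ≢_) (q ∷ q′ ∷ suf′)
        dsuf = ++⁻ʳ pre dΠ
        yq′ : y ~ q′
        yq′ = noFork (~-sym wq) (~-sym a) (proj₁ pq) (#-sym yw) (All.head (last⁺-All l pre (All.tail farΠ))) (All.head (All.tail dsuf))
        ysuf : All (y #_) suf′
        ysuf = nonadjs ys a sq (All.tail (All.tail dsuf)) (All.tail (All.head farΠ)) (proj₁ (proj₂ pq))
        q′hole : All (q′ #_) (s ∷ l ∷ pre)
        q′hole = All.map (λ { (z ∷ _) → #-sym z }) farΠ
        sufhole : Far suf′ (q ∷ y ∷ s ∷ l ∷ pre)
        sufhole = far-sym (q ∷ y ∷ s ∷ l ∷ pre) suf′ (proj₁ (proj₂ pq) ∷ ysuf ∷ All.map All.tail farΠ)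
        goodAll : ∀ {x} → x ∈ s ∷ l ∷ pre ++ q ∷ q′ ∷ suf′ → x ≡ v ⊎ Good x
        goodAll m with ∈-++⁻ P₀ (subst (_ ∈_) eΠ m)
        ... | inj₁ m′                 = inj₂ (All.lookup gP m′)
        ... | inj₂ (here refl)         = inj₂ good-t
        ... | inj₂ (there (here e))    = inj₁ e
        good≢ : ∀ {x} → x ∈ s ∷ l ∷ pre ++ q ∷ q′ ∷ suf′ → x ≢ v → Good x
        good≢ m d with goodAll m
        ... | inj₁ e = ⊥-elim (d e)
        ... | inj₂ g = g
        T : List V
        T = y ∷ s ∷ l ∷ pre ++ q ∷ q′ ∷ suf′
        satT : Saturated T
        satT (here refl) _  Su uy = there (y-sat Su uy)
        satT (there m)   Sw Su uw = there (sat m Sw Su uw)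
        resat : ∀ {X} → (∀ {x} → x ∈ X → x ∈ T) → (∀ {x} → x ∈ T → x ∈ X) → Saturated X
        resat to from m Sw Su uw = from (satT (to m) Sw Su uw)
        fromT : ∀ {x} → x ∈ T → x ∈ (q′ ∷ suf′) ⊎ x ∈ (q ∷ y ∷ s ∷ l ∷ pre)
        fromT (here e)                = inj₂ (there (here e))
        fromT (there (here e))        = inj₂ (there (there (here e)))
        fromT (there (there (here e))) = inj₂ (there (there (there (here e))))
        fromT (there (there (there m))) with ∈-++⁻ pre m
        ... | inj₁ m′           = inj₂ (there (there (there (there m′))))
        ... | inj₂ (here e)     = inj₂ (here e)
        ... | inj₂ (there m′)   = inj₁ m′
        toT : ∀ {x} → x ∈ (q′ ∷ suf′) ⊎ x ∈ (q ∷ y ∷ s ∷ l ∷ pre) → x ∈ T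
        toT (inj₁ m)                           = there (there (there (∈-++⁺ʳ pre (there m))))
        toT (inj₂ (here e))                    = there (there (there (∈-++⁺ʳ pre (here e))))
        toT (inj₂ (there (here e)))            = here e
        toT (inj₂ (there (there (here e))))    = there (here e)
        toT (inj₂ (there (there (there (here e))))) = there (there (here e))
        toT (inj₂ (there (there (there (there m))))) = there (there (there (∈-++⁺ˡ m)))
        Shape : Set
        Shape = (suf′ ≡ [] × q ≡ t × q′ ≡ v) ⊎ ∃ λ P₁ → q′ ∷ suf′ ≡ P₁ ++ t ∷ v ∷ []
        shape : Shape → Lollipop v t Good
        shape (inj₁ (refl , refl , refl)) =
          short E (~-sym (proj₁ pq)) (~-sym yq′) q′hole Ss
            (resat (λ { (here e) → toT (inj₁ (here e)) ; (there m) → toT (inj₂ m) })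
                   (λ m → join (fromT m)))
            (good-t ∷ gy ∷ All.tabulate λ m → good≢ (inΠ m) (λ e → ~⇒≢′ (All.lookup q′hole m) (≡-sym e)))
          where
          ~⇒≢′ : ∀ {x z} → x # z → x ≢ z
          ~⇒≢′ = proj₂
          inΠ : ∀ {x} → x ∈ s ∷ l ∷ pre → x ∈ s ∷ l ∷ pre ++ q ∷ q′ ∷ []
          inΠ m = ∈-++⁺ˡ {xs = s ∷ l ∷ pre} m
          join : ∀ {x} → x ∈ (q′ ∷ []) ⊎ x ∈ (q ∷ y ∷ s ∷ l ∷ pre) → x ∈ q′ ∷ q ∷ y ∷ s ∷ l ∷ pre
          join (inj₁ (here e)) = here e
          join (inj₂ m)        = there m
        shape (inj₂ (P₁ , e)) =
          long (subst IndPath eR (indPath-reverse (q′ ∷ suf′) (indPath-tail q _ pq))) odd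
            (subst (λ l → Attached l q y (s ∷ _ ∷ pre)) eR
              (subst (λ l → Attached l q y (s ∷ _ ∷ pre)) (≡-sym (unfold-reverse q′ suf′))
                (attached-++ (reverse suf′) q′ [] (reverse⁺ sufhole) (~-sym (proj₁ pq) , ~-sym yq′ , q′hole))))
            E (resat to from)
            (good-t ∷ reverse⁺ (All.tabulate λ m → good≢ (toΠ (subst (_ ∈_) (≡-sym e) (∈-++⁺ˡ m))) (vP₁ m)))
            (All.tabulate goodH)
          where
          eR : reverse (q′ ∷ suf′) ≡ v ∷ t ∷ reverse P₁
          eR = trans (cong reverse e) (reverse-++ P₁ (t ∷ v ∷ []))
          par : odd? (length suf′) ≡ false
          par = lem (trans (≡-sym (odd?-++ pre (q ∷ q′ ∷ suf′))) (notnot oP))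
            where
            lem : (odd? (length pre) xor not (not (odd? (length suf′)))) ≡ false → odd? (length suf′) ≡ false
            lem z rewrite oe = notnot z
          odd : odd? (length (reverse P₁)) ≡ true
          odd = notnot (trans (cong (λ xs → odd? (length xs)) (≡-sym eR))
                  (trans (cong odd? (length-reverse (q′ ∷ suf′))) (cong not par)))
          toΠ : ∀ {x} → x ∈ q′ ∷ suf′ → x ∈ s ∷ l ∷ pre ++ q ∷ q′ ∷ suf′
          toΠ m = there (there (∈-++⁺ʳ pre (there m)))
          vind : IndPath (v ∷ t ∷ reverse P₁)
          vind = subst IndPath eR (indPath-reverse (q′ ∷ suf′) (indPath-tail q _ pq))
          vP₁ : ∀ {x} → x ∈ P₁ → x ≢ v
          vP₁ m refl = proj₂ (All.lookup (proj₁ (proj₂ vind)) (AnyP.reverse⁺ m)) refl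
          v∈ : v ∈ q′ ∷ suf′
          v∈ = subst (v ∈_) (≡-sym e) (∈-++⁺ʳ P₁ (there (here refl)))
          goodH : ∀ {x} → x ∈ q ∷ y ∷ s ∷ l ∷ pre → Good x
          goodH (there (here refl)) = gy
          goodH (here refl) = good≢ (there (there (∈-++⁺ʳ pre (here refl)))) qv
            where
            q∉ : ∀ {x} → x ∈ q′ ∷ suf′ → q ≢ x
            q∉ (here refl) = ~⇒≢ (proj₁ pq)
            q∉ (there m)   = proj₂ (All.lookup (proj₁ (proj₂ pq)) m)
            qv : q ≢ v
            qv = q∉ v∈
          goodH (there (there m)) = good≢ (∈-++⁺ˡ {xs = s ∷ l ∷ pre} m) λ z →
            proj₂ (All.lookup (All.lookup farΠ m) v∈) z
          to : ∀ {x} → x ∈ (v ∷ t ∷ reverse P₁) ++ q ∷ y ∷ s ∷ l ∷ pre → x ∈ T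
          to m with ∈-++⁻ (v ∷ t ∷ reverse P₁) m
          ... | inj₁ m′ = toT (inj₁ (AnyP.reverse⁻ (subst (_ ∈_) (≡-sym eR) m′)))
          ... | inj₂ m′ = toT (inj₂ m′)
          from : ∀ {x} → x ∈ T → x ∈ (v ∷ t ∷ reverse P₁) ++ q ∷ y ∷ s ∷ l ∷ pre
          from m with fromT m
          ... | inj₁ m′ = ∈-++⁺ˡ (subst (_ ∈_) eR (AnyP.reverse⁺ m′))
          ... | inj₂ m′ = ∈-++⁺ʳ (v ∷ t ∷ reverse P₁) m′

    open Walk [] Geo Good′ (Lollipop v t Good) extend public

    leg : Lollipop v t Good ⊎ Done (v ∷ [])
    leg = start (record
      { geo = [] , refl , (~-sym vt , [] , tt) , refl , []
      ; sat = λ { (here refl) e _ _ → ⊥-elim (t≢f St e)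
                ; (there (here refl)) _ Su uv → here (uniq Su uv) }
      ; Ss = St
      ; sl = ~-sym vt
      ; indep = λ { (here refl) (here refl) a → ~⇒≢ a refl }
      ; nbr = λ { (here refl) Su a → here (uniq Su (~-sym a)) }
      ; cover = λ ()
      ; rm = []
      ; inAd = here refl ∷ []
      ; good = inj₂ good-t ∷ [] , inj₁ refl ∷ [] })

-- Improving a stable set at a missed clique

module Improve (G : Graph) (F : Forbidden G) (w4 : W4Free G)
  (S : F.Fin (n G) → Bool) (stable : Cliques.Stable G S) where
  open Lists G
  open Forbidden F
  open Contact G F
  open ShortContact G F w4
  open Cliques G
  open Pick G F w4
  open Legs G F w4
  open Augment S stable
  open RootedLeg G F w4 S stable

  Hits : (V → Bool) → (V → Bool) → Set
  Hits T L = ∃ λ x → T ∋ x × L ∋ x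

  Improvement : (V → Bool) → Set
  Improvement K = ∃ λ T → Stable T × Hits T K × (∀ L → Max L → Hits S L → Hits T L)

  flip-improves : ∀ {Rm Ad v K} → Flip Rm Ad → v ∈ Ad → K ∋ v → Improvement K
  flip-improves {Rm} {Ad} {v} {K} f v∈ Kv = T , T-stable , (v , new v∈ , Kv) , keep
    where
    open Flip f
    open DecMem F._≟_ using (_∈?_)
    T : V → Bool
    T x with x ∈? Ad | x ∈? Rm
    ... | yes _ | _     = true
    ... | no _  | yes _ = false
    ... | no _  | no _  = S x
    view : ∀ {x} → T ∋ x → x ∈ Ad ⊎ (S ∋ x × x ∉ Rm)
    view {x} e with x ∈? Ad | x ∈? Rm
    view {x} e  | yes a | _    = inj₁ a
    view {x} () | no _  | yes _
    view {x} e  | no _  | no b = inj₂ (e , b)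
    new : ∀ {x} → x ∈ Ad → T ∋ x
    new {x} m with x ∈? Ad | x ∈? Rm
    ... | yes _ | _ = refl
    ... | no a  | _ = ⊥-elim (a m)
    old : ∀ {x} → S ∋ x → x ∉ Rm → T ∋ x
    old {x} e m with x ∈? Ad | x ∈? Rm
    ... | yes _ | _     = refl
    ... | no _  | yes b = ⊥-elim (m b)
    ... | no _  | no _  = e
    T-stable : Stable T
    T-stable a b xy with view a | view b
    ... | inj₁ x        | inj₁ y        = indep x y xy
    ... | inj₁ x        | inj₂ (y , y∉) = y∉ (nbr x y xy)
    ... | inj₂ (x , x∉) | inj₁ y        = x∉ (nbr y x (~-sym xy))
    ... | inj₂ (x , _)  | inj₂ (y , _)  = stable x y xy
    keep : ∀ L → Max L → Hits S L → Hits T L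
    keep L M (x , Sx , Lx) with x ∈? Rm
    ... | no x∉ = x , old Sx x∉ , Lx
    ... | yes x∈ with cover x∈ L M Lx
    ...   | y , y∈ , Ly = y , new y∈ , Ly

  -- A second lollipop would form a forbidden configuration with the first, so the leg from k ends in a Flip.
  module Blocked {v k s : V} {Λ h₀ h₁ hs} (P : IndPath (v ∷ Λ)) (oP : odd? (length Λ) ≡ false)
    (A : Attached (v ∷ Λ) h₀ h₁ hs) (E : EvenHole h₀ h₁ hs) (sat : Saturated ((v ∷ Λ) ++ h₀ ∷ h₁ ∷ hs))
    (Sv : S v ≡ false) (kv : k ~ v) (kΛ : All (k #_) Λ) (kC : All (k #_) (h₀ ∷ h₁ ∷ hs))
    (Sk : S k ≡ false) (Ss : S ∋ s) (sk : s ~ k) (uniq : ∀ {u} → S ∋ u → u ~ k → u ≡ s) where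

    C : List V
    C = h₀ ∷ h₁ ∷ hs

    Geo : List V → Set
    Geo Π = IndPath Π × odd? (length Π) ≡ true × Attached Π h₀ h₁ hs

    notnot : ∀ {b c} → not (not b) ≡ c → b ≡ c
    notnot {false} e = e
    notnot {true}  e = e

    extend : ∀ {s l Π y} → Geo (s ∷ l ∷ Π) → Saturated ((s ∷ l ∷ Π) ++ C) → S ∋ s → y ~ s → y # l → S y ≡ false →
      ⊥ ⊎ (All (y #_) (l ∷ Π) × All (y #_) C × ⊤ ×
        (∀ u → S ∋ u → u ~ y → All (u #_) (s ∷ l ∷ Π) → All (u #_) C → Geo (u ∷ y ∷ s ∷ l ∷ Π) × ⊤))
    extend {s} {l} {Π} {y} (P , o , A) _ Ss ys yl Sy = inj₂ (proj₁ both , proj₂ both , tt , next)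
      where
      sC : ∀ Π → Attached (s ∷ l ∷ Π) h₀ h₁ hs → All (s #_) C
      sC Π (a , _) = a
      apart : ∀ {xs} → All (s #_) xs → All (y ≢_) xs
      apart = All.map (λ { r refl → ~#⊥ (~-sym ys) r })
      both : All (y #_) (l ∷ Π) × All (y #_) C
      both = lollipop-clean P (notnot o) A E ys yl (apart (proj₁ (proj₂ P))) (apart (sC Π A))
      next : ∀ u → S ∋ u → u ~ y → All (u #_) (s ∷ l ∷ Π) → All (u #_) C → Geo (u ∷ y ∷ s ∷ l ∷ Π) × ⊤
      next u Su uy f g = ((uy , f , ys , proj₁ both , P) , cong (λ b → not (not b)) o , (g , proj₂ both , A)) , tt

    open Walk C Geo (λ _ → ⊤) ⊥ extend public

    clean : ∀ {x} → x ∈ (v ∷ Λ) ++ C → x ≡ v ⊎ k # x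
    clean (here e)  = inj₁ e
    clean (there m) = inj₂ (All.lookup (++⁺ kΛ kC) m)

    far : ∀ {w} → w ∈ (v ∷ Λ) ++ C → s # w
    far = far-from sat clean Ss sk (∋-≢ {S} Ss Sv)

    leg : ⊥ ⊎ Done (k ∷ [])
    leg = start (record
      { geo = (sk , ++⁻ˡ (v ∷ Λ) (All.tabulate far) , kv , kΛ , P) , cong (λ b → not (not (not b))) oP ,
              (++⁻ʳ (v ∷ Λ) (All.tabulate far) , kC , A)
      ; sat = λ { (here refl) e _ _ → ⊥-elim (t≢f Ss e)
                ; (there (here refl)) _ Su uk → here (uniq Su uk)
                ; (there (there m)) e Su uw → there (there (sat m e Su uw)) }
      ; Ss = Ss
      ; sl = sk
      ; indep = λ { (here refl) (here refl) a → ~⇒≢ a refl }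
      ; nbr = λ { (here refl) Su a → here (uniq Su (~-sym a)) }
      ; cover = λ ()
      ; rm = []
      ; inAd = here refl ∷ []
      ; good = tt ∷ [] , tt ∷ [] })

  module _ {K : V → Bool} (M : Max K) (missed : ∀ {x} → K ∋ x → S ∋ x → ⊥) where

    S-false : ∀ {x} → K ∋ x → S x ≡ false
    S-false {x} Kx with ∋? S x
    ... | inj₁ a = ⊥-elim (missed Kx a)
    ... | inj₂ b = b

    K-false : ∀ {x} → S ∋ x → K x ≡ false
    K-false {x} Sx with ∋? K x
    ... | inj₁ a = ⊥-elim (missed a Sx)
    ... | inj₂ b = b

    lone-improves : ∀ {v} → K ∋ v → (∀ {u} → S ∋ u → u ~ v → ⊥) → Improvement K
    lone-improves {v} Kv no-nbr = flip-improves {[]} {v ∷ []} (record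
      { indep = λ { (here refl) (here refl) a → ~⇒≢ a refl }
      ; nbr = λ { (here refl) Su a → ⊥-elim (no-nbr Su (~-sym a)) }
      ; cover = λ () }) (here refl) Kv

    -- Take `k` in `K` nonadjacent to `t`. By a claw at `k`, it too has at most one neighbour `s` in
    -- `S`, so both `v` and `k` can root a leg. If the leg from `v` closes up, then `k` sees nothing
    -- of the lollipop except `v`; the leg from `k` thus prolongs its tail and cannot close up
    -- again.
    unique-improves : ∀ {v t} → K ∋ v → S ∋ t → t ~ v → (∀ {u} → S ∋ u → u ~ v → u ≡ t) → Improvement K
    unique-improves {v} {t} Kv St tv uniq with outside M t (K-false St)
    ... | k , Kk , kt with any? (λ u → (S u ≟ true) ×-dec ~? u k)
    ...   | no no-nbr = lone-improves Kk λ Su uk → no-nbr (_ , Su , uk)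
    ...   | yes (s , Ss , sk) with pick sk
    ...     | inj₁ all = flip-improves {s ∷ []} {k ∷ []} (record
      { indep = λ { (here refl) (here refl) a → ~⇒≢ a refl }
      ; nbr = λ { (here refl) Su a → here (uniqk Su (~-sym a)) }
      ; cover = λ { (here refl) L ML Ls → k , here refl , all L ML Ls } }) (here refl) Kk
      where
      k≢v : k ≢ v
      k≢v e = ~#⊥ tv (subst (t #_) e (#-sym kt))
      off-v : ∀ {u} → S ∋ u → u ~ k → u # v
      off-v {u} Su uk with adn u v (∋-≢ {S} Su (S-false Kv))
      ... | na b = b
      ... | ad a = ⊥-elim (~#⊥ (subst (_~ k) (uniq Su a) uk) (#-sym kt))
      uniqk : ∀ {u} → S ∋ u → u ~ k → u ≡ s
      uniqk {u} Su uk with u F.≟ s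
      ... | yes e = e
      ... | no d = ⊥-elim (claw (~-sym sk) (~-sym uk) (MaxIn.clq M Kk Kv k≢v)
              (stable-# Ss Su (λ e → d (≡-sym e))) (off-v Ss sk) (off-v Su uk))
    ...     | inj₂ (ρ , ρs , ρk , _) = first leg₁
      where
      k≢v : k ≢ v
      k≢v e = ~#⊥ tv (subst (t #_) e (#-sym kt))
      kv : k ~ v
      kv = MaxIn.clq M Kk Kv k≢v
      off-v : ∀ {u} → S ∋ u → u ~ k → u # v
      off-v {u} Su uk with adn u v (∋-≢ {S} Su (S-false Kv))
      ... | na b = b
      ... | ad a = ⊥-elim (~#⊥ (subst (_~ k) (uniq Su a) uk) (#-sym kt))
      uniqk : ∀ {u} → S ∋ u → u ~ k → u ≡ s
      uniqk {u} Su uk with u F.≟ s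
      ... | yes e = e
      ... | no d = ⊥-elim (claw (~-sym sk) (~-sym uk) kv
              (stable-# Ss Su (λ e → d (≡-sym e))) (off-v Ss sk) (off-v Su uk))
      open Rooted (~-sym tv) St (S-false Kv) uniq (λ _ → ⊤) tt (λ _ _ _ _ _ _ _ _ _ → tt) (λ _ _ _ _ → tt)
        using () renaming (leg to leg₁; Done to Done₁)
      apart : ∀ {xs} → All (v #_) xs → All (k ≢_) xs
      apart = All.map (λ { r refl → ~#⊥ (~-sym kv) r })
      second : ∀ {Λ h₀ h₁ hs} → IndPath (v ∷ Λ) → odd? (length Λ) ≡ false → Attached (v ∷ Λ) h₀ h₁ hs →
        EvenHole h₀ h₁ hs → Saturated ((v ∷ Λ) ++ h₀ ∷ h₁ ∷ hs) → All (k #_) Λ → All (k #_) (h₀ ∷ h₁ ∷ hs) →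
        Improvement K
      second P o A E sat kΛ kC with Blocked.leg P o A E sat (S-false Kv) kv kΛ kC (S-false Kk) Ss sk uniqk
      ... | inj₂ (_ , _ , f , m ∷ [] , _) = flip-improves f m Kk
      first : Lollipop v t (λ _ → ⊤) ⊎ Done₁ (v ∷ []) → Improvement K
      first (inj₂ (_ , _ , f , m ∷ [] , _)) = flip-improves f m Kv
      first (inj₁ (long {Λ} P o A@((_ ∷ _) , _) E sat _ _)) = second P (cong not o) A E sat (proj₁ c) (proj₂ c)
        where
        c : All (k #_) (t ∷ Λ) × All (k #_) (_ ∷ _ ∷ _)
        c = lollipop-clean P o A E kv kt (apart (proj₁ (proj₂ P))) (apart (proj₁ A))
      first (inj₁ (short {h₁} {h₂} {h₃} {gs} E vt vh₁ vhs Sh₂ sat _)) with adn k h₁ kh₁≢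
        where
        kh₁≢ : k ≢ h₁
        kh₁≢ e = ~#⊥ (proj₁ (proj₁ E)) (subst (t #_) e (#-sym kt))
      -- If `k` sees `h₂`, a member of `S`, then `h₂` is its only neighbour `s` there, and `ρ` sees
      -- it by its choice.
      ... | ad a = ⊥-elim (short-contact E vt vh₁ vhs kv kt a
                    (λ kh₂ → subst (ρ ~_) (≡-sym (uniqk Sh₂ (~-sym kh₂))) ρs) ρk)
      ... | na b = second {[]} tt refl (vt , vh₁ , vhs) E sat []
                     (holeContact {v} {[]} tt refl (vt , vh₁ , vhs) E kv [] (proj₂ kt ∷ proj₂ b ∷ apart vhs) (inj₂ (kt , b)))

-- Suns and the legs at their tips

module Suns (G : Graph) (F : Forbidden G) (w4 : W4Free G)
  (S : F.Fin (n G) → Bool) (stable : Cliques.Stable G S) where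
  open Lists G
  open Forbidden F
  open Contact G F
  open Cliques G
  open Legs G F w4
  open Augment S stable using (stable-#; two-nbrs)

  -- A triangle x , y , z whose edges are completed by the members a , b , c of S.
  record Sun (a b c x y z : V) : Set where
    field
      Sa : S ∋ a
      Sb : S ∋ b
      Sc : S ∋ c
      Sx : S x ≡ false
      Sy : S y ≡ false
      Sz : S z ≡ false
      xa : x ~ a
      xb : x ~ b
      xc : x # c
      ya : y ~ a
      yc : y ~ c
      yb : y # b
      zb : z ~ b
      zc : z ~ c
      za : z # a
      xy : x ~ y
      xz : x ~ z
      yz : y ~ z
      ab : a # b
      ac : a # c
      bc : b # c

  -- Together with `swapᵇᶜ` this generates all six symmetries of a sun.
  swapᵃᵇ : ∀ {a b c x y z} → Sun a b c x y z → Sun b a c x z y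
  swapᵃᵇ s = record
    { Sa = Sb ; Sb = Sa ; Sc = Sc ; Sx = Sx ; Sy = Sz ; Sz = Sy ; xa = xb ; xb = xa ; xc = xc
    ; ya = zb ; yc = zc ; yb = za ; zb = ya ; zc = yc ; za = yb ; xy = xz ; xz = xy ; yz = ~-sym yz
    ; ab = #-sym ab ; ac = bc ; bc = ac }
    where open Sun s

  swapᵇᶜ : ∀ {a b c x y z} → Sun a b c x y z → Sun a c b y x z
  swapᵇᶜ s = record
    { Sa = Sa ; Sb = Sc ; Sc = Sb ; Sx = Sy ; Sy = Sx ; Sz = Sz ; xa = ya ; xb = yc ; xc = yb
    ; ya = xa ; yc = xb ; yb = xc ; zb = zc ; zc = zb ; za = za ; xy = ~-sym xy ; xz = yz ; yz = xz
    ; ab = ac ; ac = ab ; bc = #-sym bc }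
    where open Sun s

  lastAdj-split : ∀ {x} zs → LastAdj x zs → ∃ λ ini → ∃ λ e → zs ≡ ini ++ e ∷ [] × All (x #_) ini × x ~ e
  lastAdj-split (z ∷ [])      a       = [] , z , refl , [] , a
  lastAdj-split (z ∷ z′ ∷ zs) (b , a) with lastAdj-split (z′ ∷ zs) a
  ... | ini , e , q , c , d = z ∷ ini , e , cong (z ∷_) q , b ∷ c , d

  module Tip {a b c x y z} (sun : Sun a b c x y z) where
    open Sun sun

    -- What it means to lie on the side of `a`. The field `agree` allows a leg rooted at `x` to be
    -- moved to `y`, the other triangle vertex adjacent to `a`.
    record Plain (w : V) : Set where
      field
        wb    : w # b
        wc    : w # c
        wz    : w # z
        agree : adj G x w ≡ adj G y w

    plain-a : Plain a
    plain-a = record { wb = ab ; wc = ac ; wz = #-sym za ; agree = trans xa (≡-sym ya) }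

    y~ : ∀ {w} → Plain w → x ~ w → y ~ w
    y~ p e = trans (≡-sym (Plain.agree p)) e

    y# : ∀ {w} → Plain w → x # w → y # w
    y# {w} p (e , _) = trans (≡-sym (Plain.agree p)) e , λ { refl → ~#⊥ yz (Plain.wz p) }

    -- A connection from `w` back to the sun within the side of `a`, in which only the last vertex
    -- sees `x`. Two such arms from different sides that touched would close a cycle through `x`.
    record Arm (w : V) : Set where
      field
        rest  : List V
        path  : IndPath (w ∷ rest)
        end   : LastAdj x (w ∷ rest)
        plain : All Plain (w ∷ rest)

    shorten : ∀ u xs → Plain u → x # u → IndPath xs → LastAdj x xs → All Plain xs → All (u #_) xs ⊎ Arm u
    shorten u (p ∷ []) gu xu P e g with tri u p
    ... | eq refl = ⊥-elim (~#⊥ e xu)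
    ... | ad up   = inj₂ (record { rest = p ∷ [] ; path = up , [] , tt ; end = xu , e ; plain = gu ∷ g })
    ... | na up   = inj₁ (up ∷ [])
    shorten u (p ∷ q ∷ ps) gu xu P e g with shorten u (q ∷ ps) gu xu (indPath-tail p _ P) (proj₂ e) (All.tail g)
    ... | inj₂ arm = inj₂ arm
    ... | inj₁ f with tri u p
    ...   | eq refl = inj₂ (record { rest = q ∷ ps ; path = P ; end = e ; plain = g })
    ...   | ad up   = inj₂ (record { rest = p ∷ q ∷ ps ; path = up , f , P ; end = xu , e ; plain = gu ∷ g })
    ...   | na up   = inj₁ (up ∷ f)

    arm-step : ∀ {s w} → Arm s → w ~ s → Plain w → w ≢ x → Arm w
    arm-step {s} {w} arm ws g wx with adn x w (λ e → wx (≡-sym e))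
    ... | ad e = record { rest = [] ; path = tt ; end = e ; plain = g ∷ [] }
    ... | na e with shorten w (s ∷ Arm.rest arm) g e (Arm.path arm) (Arm.end arm) (Arm.plain arm)
    ...   | inj₂ r       = r
    ...   | inj₁ (f ∷ _) = ⊥-elim (~#⊥ ws f)

    Good : V → Set
    Good w = Plain w × Arm w × w ≢ x

    good-a : Good a
    good-a = plain-a , record { rest = [] ; path = tt ; end = xa ; plain = plain-a ∷ [] } , λ e → ~⇒≢ xa (≡-sym e)

    -- Hiding `b` leaves `a` as the only neighbour of `x` in the stable set, as a rooted leg
    -- requires.
    B : V → Bool
    B u = S u ∧ not ⌊ u F.≟ b ⌋

    B-S : ∀ {u} → B ∋ u → S ∋ u × u ≢ b
    B-S {u} e with S u | u F.≟ b
    B-S {u} e  | true  | no d  = refl , d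
    B-S {u} () | true  | yes _
    B-S {u} () | false | _

    S-B : ∀ {u} → S ∋ u → u ≢ b → B ∋ u
    S-B {u} e d with u F.≟ b
    ... | yes p = ⊥-elim (d p)
    ... | no _ rewrite e = refl

    B-false : ∀ {u} → S u ≡ false → B u ≡ false
    B-false e rewrite e = refl

    B-stable : Stable B
    B-stable p q = stable (proj₁ (B-S p)) (proj₁ (B-S q))

    -- All remaining requirements follow from claws at `z`, `x` and `y`.
    finish : ∀ {w} → w # b → w # c → w ≢ x → w ≢ y → Plain w
    finish {w} wb wc wx wy = record { wb = wb ; wc = wc ; wz = wz ; agree = same }
      where
      wz : w # z
      wz with tri w z
      ... | na e = e
      ... | eq refl = ⊥-elim (~#⊥ zb wb)
      ... | ad e = ⊥-elim (claw zb zc (~-sym e) bc (#-sym wb) (#-sym wc))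
      same : adj G x w ≡ adj G y w
      same with adn x w (λ e → wx (≡-sym e)) | adn y w (λ e → wy (≡-sym e))
      ... | ad e       | ad f       = trans e (≡-sym f)
      ... | na (e , _) | na (f , _) = trans e (≡-sym f)
      ... | ad e       | na f       = ⊥-elim (claw xb xy e (#-sym yb) (#-sym wb) f)
      ... | na e       | ad f       = ⊥-elim (claw yc (~-sym xy) f (#-sym xc) (#-sym wc) e)

    -- If `w` saw `c`, the leg from `w` back to `a` would close to an odd hole: through `y` when `w`
    -- sees `y`, and through `x , z , c` when `w` misses `y` and `z`. The remaining case is a claw,
    -- and next to `a` also a 4-wheel occurs. The argument for `b` is similar, with `x` and `y`
    -- exchanged.
    plain-next : ∀ {P₀ s l Π w} → s ∷ l ∷ Π ≡ P₀ ++ a ∷ x ∷ [] → IndPath (s ∷ l ∷ Π) → odd? (length Π) ≡ false →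
      All Good P₀ → S ∋ s → w ~ s → w # l → S w ≡ false → w ≢ x → w ≢ y → w ≢ z → Plain w
    plain-next {[]} {w = w} refl _ _ _ _ wa wx Sw w≢x w≢y w≢z = finish wb wc w≢x w≢y
      where
      w≢ : ∀ {u} → S ∋ u → w ≢ u
      w≢ Su refl = t≢f Su Sw
      wc : w # c
      wc with adn w c (w≢ Sc)
      ... | na e = e
      ... | ad e with adn w z w≢z | adn w y w≢y
      ...   | na f | _    = ⊥-elim (oddHole {x} {a} {w ∷ c ∷ z ∷ []}
        (xa , (#-sym wx , xc , xz) , ~-sym wa , (ac ∷ #-sym za ∷ []) , e , (f ∷ []) , ~-sym zc , [] , tt) (s≤s (s≤s z≤n)) refl)
      ...   | ad f | ad g = ⊥-elim (w4 ya (~-sym g) yz (~-sym xy) (~-sym wa) f (~-sym xz) xa (#-sym za) wx)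
      ...   | ad f | na g = ⊥-elim (claw zb (~-sym f) (~-sym yz)
                (nonadj′) (#-sym yb) g)
        where
        nonadj′ : b # w
        nonadj′ = #-sym (nonadj wa e ac (w≢ Sb) ab (#-sym bc))
      wb : w # b
      wb with adn w b (w≢ Sb)
      ... | na e = e
      ... | ad e with adn w y w≢y | adn w z w≢z
      ...   | ad g | _    = ⊥-elim (claw yc (~-sym g) (~-sym xy) (#-sym wc) (#-sym xc) wx)
      ...   | na _ | ad g = ⊥-elim (claw zc (~-sym g) (~-sym xz) (#-sym wc) (#-sym xc) wx)
      ...   | na f | na g = ⊥-elim (oddHole {y} {a} {w ∷ b ∷ z ∷ []}
        (ya , (#-sym f , yb , yz) , ~-sym wa , (ab ∷ #-sym za ∷ []) , e , (g ∷ []) , ~-sym zb , [] , tt) (s≤s (s≤s z≤n)) refl)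
    plain-next {s′ ∷ []} e _ o _ _ _ _ _ _ _ _ with ∷-injectiveʳ (∷-injectiveʳ e)
    ... | refl = ⊥-elim (t≢f refl o)
    plain-next {s ∷ l ∷ P₁} {w = w} refl P o ((gs , _) ∷ gl ∷ gP) Ss ws wl Sw w≢x w≢y w≢z = finish wb wc w≢x w≢y
      where
      Q : List V
      Q = s ∷ l ∷ P₁ ++ a ∷ []
      Qx : (s ∷ l ∷ P₁) ++ a ∷ x ∷ [] ≡ Q ++ x ∷ []
      Qx = ≡-sym (++-assoc (s ∷ l ∷ P₁) (a ∷ []) (x ∷ []))
      PQ : IndPath Q
      PQ = indPath-++ˡ Q (subst IndPath Qx P)
      xQ : LastAdj x Q
      xQ = indPath-lastAdj s (l ∷ P₁ ++ a ∷ []) (subst IndPath Qx P)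
      gQ : All Plain Q
      gQ = gs ∷ proj₁ gl ∷ ∷ʳ⁺ (All.map proj₁ gP) plain-a
      lastAdj-y : ∀ zs → All Plain zs → LastAdj x zs → LastAdj y zs
      lastAdj-y (q ∷ [])      (g ∷ [])    e       = y~ g e
      lastAdj-y (q ∷ q′ ∷ qs) (g ∷ g′ ∷ h) (e , f) = y# g e , lastAdj-y (q′ ∷ qs) (g′ ∷ h) f
      yQ : LastAdj y Q
      yQ = lastAdj-y Q gQ xQ
      zQ : All (z #_) Q
      zQ = All.map (λ g → #-sym (Plain.wz g)) gQ
      oQ : odd? (length Q) ≡ true
      oQ = cong (λ b → not (not b)) (lem (trans (≡-sym (cong (λ l → odd? (length l)) (∷-injectiveʳ (∷-injectiveʳ Qx)))) o))
        where
        lem : odd? (length ((P₁ ++ a ∷ []) ++ x ∷ [])) ≡ false → odd? (length (P₁ ++ a ∷ [])) ≡ true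
        lem e rewrite odd?-++ (P₁ ++ a ∷ []) (x ∷ []) with odd? (length (P₁ ++ a ∷ []))
        ... | true  = refl
        ... | false = ⊥-elim (t≢f refl e)
      w≢ : ∀ {u} → S ∋ u → w ≢ u
      w≢ Su refl = t≢f Su Sw
      s≢Q : All (w ≢_) (P₁ ++ a ∷ [])
      s≢Q = All.map (λ { r refl → ~#⊥ (~-sym ws) r }) (proj₁ (proj₂ PQ))
      sx : s # x
      sx = #-sym (proj₁ xQ)
      -- Otherwise `s`, `t` and a further neighbour on `Q` form a claw at `w`.
      free : ∀ {t} → w ~ t → All (_# t) Q → All (w #_) (l ∷ P₁ ++ a ∷ [])
      free {t} wt (st ∷ lt ∷ Qt) with search w (P₁ ++ a ∷ []) s≢Q
      ... | none f = wl ∷ f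
      ... | found pre q suf e _ wq = ⊥-elim (claw ws wq wt
              (All.lookup (proj₁ (proj₂ PQ)) q∈) st (All.lookup Qt q∈))
        where
        q∈ : q ∈ P₁ ++ a ∷ []
        q∈ = subst (q ∈_) (≡-sym e) (∈-++⁺ʳ pre (here refl))
      wc : w # c
      wc with adn w c (w≢ Sc)
      ... | na e = e
      ... | ad e = ⊥-elim (go (adn w y w≢y) (adn w z w≢z))
        where
        f : All (w #_) (l ∷ P₁ ++ a ∷ [])
        f = free e (All.map Plain.wc gQ)
        wx : w # x
        wx = nonadj ws e (Plain.wc gs) w≢x sx (#-sym xc)
        wb : w # b
        wb = nonadj ws e (Plain.wc gs) (w≢ Sb) (Plain.wb gs) (#-sym bc)
        go : AdN w y → AdN w z → ⊥
        go (ad g) _      = oddHole {y} {w} {Q} (~-sym g , yQ , ws , f , PQ) (s≤s (s≤s z≤n)) oQ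
        go (na g) (ad h) = claw zb (~-sym h) (~-sym yz) (#-sym wb) (#-sym yb) g
        go (na g) (na h) = oddHole {z} {c} {w ∷ Q ++ x ∷ []}
          (zc , lastAdj-∷ʳ (w ∷ Q) (#-sym h ∷ zQ) (~-sym xz) ,
           ~-sym e , ∷ʳ⁺ (All.map (λ g → #-sym (Plain.wc g)) gQ) (#-sym xc) ,
           ws , ∷ʳ⁺ f wx , indPath-∷ʳ Q x PQ xQ) (s≤s (s≤s z≤n)) (odd2 x)
          where
          odd2 : ∀ v → not (odd? (length (Q ++ v ∷ []))) ≡ true
          odd2 v rewrite odd?-++ Q (v ∷ []) | oQ = refl
      wb : w # b
      wb with adn w b (w≢ Sb)
      ... | na e = e
      ... | ad e = ⊥-elim (go (adn w y w≢y) (adn w x w≢x) (adn w z w≢z))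
        where
        f : All (w #_) (l ∷ P₁ ++ a ∷ [])
        f = free e (All.map Plain.wb gQ)
        wa : w # a
        wa = All.lookup f (there (∈-++⁺ʳ P₁ (here refl)))
        go : AdN w y → AdN w x → AdN w z → ⊥
        go (ad g) _      _      = claw (~-sym g) ya yc wa wc ac
        go (na _) (ad g) _      = oddHole {x} {w} {Q} (~-sym g , xQ , ws , f , PQ) (s≤s (s≤s z≤n)) oQ
        go (na g) (na h) (ad i) = claw zc (~-sym i) (~-sym xz) (#-sym wc) (#-sym xc) h
        go (na g) (na h) (na i) = oddHole {z} {b} {w ∷ Q ++ y ∷ []}
          (zb , lastAdj-∷ʳ (w ∷ Q) (#-sym i ∷ zQ) (~-sym yz) ,
           ~-sym e , ∷ʳ⁺ (All.map (λ g → #-sym (Plain.wb g)) gQ) (#-sym yb) ,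
           ws , ∷ʳ⁺ f g , indPath-∷ʳ Q y PQ yQ) (s≤s (s≤s z≤n)) (odd2 y)
          where
          odd2 : ∀ v → not (odd? (length (Q ++ v ∷ []))) ≡ true
          odd2 v rewrite odd?-++ Q (v ∷ []) | oQ = refl

    S-false : ∀ {w s} → B w ≡ false → w ~ s → s # b → S w ≡ false
    S-false {w} Bw ws sb with ∋? S w
    ... | inj₂ e = e
    ... | inj₁ e = ⊥-elim (t≢f (S-B e λ { refl → ~#⊥ (~-sym ws) sb }) Bw)

    hook : ∀ {P₀ s l Π w} → s ∷ l ∷ Π ≡ P₀ ++ a ∷ x ∷ [] → IndPath (s ∷ l ∷ Π) → odd? (length Π) ≡ false →
      All Good P₀ → Augment.Saturated B B-stable (s ∷ l ∷ Π) → B ∋ s → w ~ s → w # l → B w ≡ false → Good w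
    hook {[]} {w = w} refl P o gP _ Bs ws wl Bw =
      g , arm-step (proj₁ (proj₂ good-a)) ws g (proj₂ wl) , proj₂ wl
      where
      g : Plain w
      g = plain-next {[]} refl P o [] Sa ws wl (S-false Bw ws ab) (proj₂ wl)
            (λ { refl → ~#⊥ (~-sym xy) wl }) (λ { refl → ~#⊥ ws za })
    hook {p ∷ []} {s} {w = w} e P o _ _ _ _ _ _ with ∷-injectiveʳ (∷-injectiveʳ e)
    ... | refl = ⊥-elim (t≢f refl o)
    hook {p ∷ p′ ∷ P₁} {s} {w = w} refl P o gP@((gs , arm , _) ∷ _) _ Bs ws wl Bw = g , arm-step arm ws g w≢x , w≢x
      where
      sx : s # x
      sx = All.lookup (proj₁ (proj₂ P)) (∈-++⁺ʳ P₁ (there (here refl)))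
      w≢x : w ≢ x
      w≢x refl = ~#⊥ (~-sym ws) sx
      g : Plain w
      g = plain-next {p ∷ p′ ∷ P₁} refl P o gP (proj₁ (B-S Bs)) ws wl (S-false Bw ws (Plain.wb gs)) w≢x
            (λ { refl → ~#⊥ ws (y# gs (#-sym sx)) }) (λ { refl → ~#⊥ ws (#-sym (Plain.wz gs)) })

    hookS : ∀ {w u} → Good w → B w ≡ false → B ∋ u → u ~ w → Good u
    hookS {w} {u} (gw , arm , _) _ Bu uw with u F.≟ a
    ... | yes refl = good-a
    ... | no u≢a = gu , arm-step arm uw gu (∋-≢ {S} Su Sx) , ∋-≢ {S} Su Sx
      where
      Su : S ∋ u
      Su = proj₁ (B-S Bu)
      u≢c : u ≢ c
      u≢c refl = ~#⊥ (~-sym uw) (Plain.wc gw)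
      gu : Plain u
      gu = finish (stable-# Su Sb (proj₂ (B-S Bu))) (stable-# Su Sc u≢c) (∋-≢ {S} Su Sx) (∋-≢ {S} Su Sy)

    uniq : ∀ {u} → B ∋ u → u ~ x → u ≡ a
    uniq Bu ux with two-nbrs Sa Sb (λ e → proj₂ ab (≡-sym e)) (~-sym xa) (~-sym xb) (proj₁ (B-S Bu)) ux
    ... | inj₁ e = e
    ... | inj₂ e = ⊥-elim (proj₂ (B-S Bu) e)

    open RootedLeg G F w4 B B-stable public using (Lollipop; short; long)
    open RootedLeg.Rooted G F w4 B B-stable xa (S-B Sa (proj₂ ab)) (B-false Sx) uniq Good good-a
      (λ {P₀} → hook {P₀}) (λ {w} → hookS {w}) public using (leg; Done)

    record Rooted-at (r : V) : Set where
      field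
        {Λ}    : List V
        {h₀ h₁} : V
        {hs}   : List V
        path   : IndPath (r ∷ Λ)
        even   : odd? (length Λ) ≡ false
        att    : Attached (r ∷ Λ) h₀ h₁ hs
        hole   : EvenHole h₀ h₁ hs
        arms   : All Good (Λ ++ h₀ ∷ h₁ ∷ hs)

    -- Good vertices do not distinguish `x` from `y`, so the tail keeps its shape when its root is
    -- replaced. This provides two lollipops with distinct adjacent roots.
    reroot : Lollipop x a Good → Rooted-at y
    reroot (short E xa′ xh₁ xhs _ _ (_ ∷ g₁ ∷ gs)) = record
      { Λ = [] ; path = tt ; even = refl
      ; att = ya , y~ (proj₁ g₁) xh₁ , All.zipWith (λ { (g , e) → y# (proj₁ g) e }) (gs , xhs)
      ; hole = E ; arms = good-a ∷ g₁ ∷ gs }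
    reroot (long (_ , xΛ , P) o (xC , A) E _ (_ ∷ gΛ) gC) = record
      { path = ya , All.zipWith (λ { (g , e) → y# (proj₁ g) e }) (gΛ , xΛ) , P
      ; even = cong not o
      ; att = All.zipWith (λ { (g , e) → y# (proj₁ g) e }) (gC , xC) , A
      ; hole = E ; arms = good-a ∷ ++⁺ gΛ gC }

  module TwoTips {a b c x y z} (sun : Sun a b c x y z) where
    open Sun sun
    module A = Tip sun
    module B = Tip (swapᵃᵇ sun)

    -- A contact between arms of different sides closes one cycle through `x` and another, longer by
    -- one, through `y` and `z`: the `a`-side sees `y` as it sees `x`, the `b`-side sees `z` so. One
    -- of the two is odd. The induction starts at the ends near `x`, so the remainders are already
    -- known to be apart when `p` meets `q`.
    cross : ∀ ps qs → IndPath ps → IndPath qs → LastAdj x ps → LastAdj x qs → All A.Plain ps → All B.Plain qs →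
            Far ps qs
    cross-head : ∀ p ps qs → IndPath (p ∷ ps) → IndPath qs → LastAdj x (p ∷ ps) → LastAdj x qs →
      All A.Plain (p ∷ ps) → All B.Plain qs → Far ps qs → All (p #_) qs
    cross []       qs _ _ _ _ _ _ = []
    cross (p ∷ []) qs P Q e f g h = cross-head p [] qs P Q e f g h [] ∷ []
    cross (p ∷ p′ ∷ ps) qs P Q e f g h =
      let ih = cross (p′ ∷ ps) qs (indPath-tail p _ P) Q (proj₂ e) f (All.tail g) h
      in cross-head p (p′ ∷ ps) qs P Q e f g h ih ∷ ih
    cross-head p ps []       P Q e f g h far = []
    cross-head p ps (q ∷ qs) P Q e f g h far = touch (tri p q) ∷ rest
      where
      tail-of : ∀ qs → IndPath (q ∷ qs) → LastAdj x (q ∷ qs) → All B.Plain (q ∷ qs) → Far ps (q ∷ qs) → All (p #_) qs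
      tail-of []        _  _        _  _   = []
      tail-of (q′ ∷ qs) Q′ (_ , f′) h′ fr = cross-head p ps (q′ ∷ qs) P (indPath-tail q _ Q′) e f′ g (All.tail h′) (All.map All.tail fr)
      rest : All (p #_) qs
      rest = tail-of qs Q f h far
      touch : Tri p q → p # q
      touch (na d) = d
      touch (eq refl) = ⊥-elim (same ps qs P Q e far rest)
        where
        same : ∀ ps qs → IndPath (p ∷ ps) → IndPath (p ∷ qs) → LastAdj x (p ∷ ps) → Far ps (p ∷ qs) → All (p #_) qs → ⊥
        same (p′ ∷ _) _        (pp , _) _        _  ((d ∷ _) ∷ _) _       = ~#⊥ (~-sym pp) d
        same []       (q′ ∷ _) _        (pq , _) _  _             (d ∷ _) = ~#⊥ pq d
        same []       []       _        _        e₁ _             _       =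
          ~#⊥ (~-sym (A.y~ (All.head g) e₁)) (B.Plain.wz (All.head h))
      touch (ad pq) with lastAdj-split (p ∷ ps) e
      ... | ini , w , s , xini , xw = ⊥-elim (go _ refl)
        where
        R : reverse (p ∷ ps) ≡ w ∷ reverse ini
        R = trans (cong reverse s) (reverse-++ ini (w ∷ []))
        joined : IndPath (w ∷ reverse ini ++ q ∷ qs)
        joined = subst (λ l → IndPath (l ++ q ∷ qs)) R
          (indPath-join (reverse (p ∷ ps)) q qs (indPath-reverse (p ∷ ps) P) Q
            (lastAdj-reverse p ps (~-sym pq) (All.map (λ { (d ∷ _) → #-sym d }) far))
            (reverse⁺ (rest ∷ All.map All.tail far)))
        gR : All A.Plain (ini ++ w ∷ [])
        gR = subst (All A.Plain) s g
        g-ini : All A.Plain ini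
        g-ini = ++⁻ˡ ini gR
        gw : A.Plain w
        gw = All.head (++⁻ʳ ini gR)
        H₁ : Hole x w (reverse ini ++ q ∷ qs)
        H₁ = xw , lastAdj-++ (reverse ini) q qs (reverse⁺ xini) f , joined
        z-end : ∀ q qs → All B.Plain (q ∷ qs) → LastAdj x (q ∷ qs) → LastAdj z (q ∷ qs)
        z-end q []        (k ∷ _) l       = B.y~ k l
        z-end q (q′ ∷ qs) (k ∷ ks) (l , m) = B.y# k l , z-end q′ qs ks m
        H₂ : Hole z y (w ∷ reverse ini ++ q ∷ qs)
        H₂ = ~-sym yz ,
             lastAdj-++ (w ∷ reverse ini) q qs
               (#-sym (A.Plain.wz gw) ∷ reverse⁺ (All.map (λ k → #-sym (A.Plain.wz k)) g-ini)) (z-end q qs h f) ,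
             A.y~ gw xw ,
             ++⁺ (reverse⁺ (All.zipWith (λ { (k , d) → A.y# k d }) (g-ini , xini))) (All.map (λ k → #-sym (B.Plain.wz k)) h) ,
             joined
        go : ∀ m → length (reverse ini ++ q ∷ qs) ≡ m → ⊥
        go zero          l with reverse ini
        go zero          () | []
        go zero          () | _ ∷ _
        -- The arms touch right next to `x`: the cycles have lengths three and four and form a
        -- 4-wheel with hub `x`.
        go (suc zero)    l = one (reverse ini) qs l f h joined
          where
          one : ∀ (is qs : List V) → length (is ++ q ∷ qs) ≡ 1 → LastAdj x (q ∷ qs) → All B.Plain (q ∷ qs) →
                IndPath (w ∷ is ++ q ∷ qs) → ⊥
          one [] [] _ xq (k ∷ []) (wq , _) =
            w4 xy xw xq xz (A.y~ gw xw) wq (~-sym (B.y~ k xq)) (~-sym yz) (#-sym (B.Plain.wz k)) (A.Plain.wz gw)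
          one (_ ∷ [])    qs ()
          one (_ ∷ _ ∷ _) qs ()
        go (suc (suc m)) l with odd? (length (reverse ini ++ q ∷ qs)) in o
        ... | true  = oddHole H₁ (subst (2 ≤_) (≡-sym l) (s≤s (s≤s z≤n))) o
        ... | false = oddHole H₂ (s≤s (subst (1 ≤_) (≡-sym l) (s≤s z≤n))) (cong not o)

    apart : ∀ {u w} → A.Good u → B.Good w → u # w
    apart (_ , p , _) (_ , q , _) = All.head (All.head (cross _ _ (A.Arm.path p) (B.Arm.path q)
      (A.Arm.end p) (B.Arm.end q) (A.Arm.plain p) (B.Arm.plain q)))

    far-apart : ∀ {us ws} → All A.Good us → All B.Good ws → Far us ws
    far-apart gs hs = All.map (λ g → All.map (apart g) hs) gs

    open Augment S stable using (Flip)

    -- Each leg was grown with `a` or `b` hidden. The added vertices other than `x` miss the vertex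
    -- hidden from their leg, and for `x` each of `a` and `b` is removed by the leg that can see it,
    -- so the two exchanges are compatible in `S` itself.
    join-flips : A.Done (x ∷ []) → B.Done (x ∷ []) → ∃ λ Rm → ∃ λ Ad → Flip Rm Ad × x ∈ Ad
    join-flips (R₁ , A₁ , f₁ , m₁ ∷ [] , _ , g₁) (R₂ , A₂ , f₂ , m₂ ∷ [] , _ , g₂) =
      R₁ ++ R₂ , A₁ ++ A₂ , record { indep = ind ; nbr = nb ; cover = cov } , ∈-++⁺ˡ m₁
      where
      module F₁ = Augment.Flip f₁
      module F₂ = Augment.Flip f₂
      mixed : ∀ {u w} → u ∈ A₁ → w ∈ A₂ → u ~ w → ⊥
      mixed {u} {w} m m′ uw with All.lookup g₁ m | All.lookup g₂ m′
      ... | inj₁ refl | _         = F₂.indep m₂ m′ uw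
      ... | inj₂ _    | inj₁ refl = F₁.indep m m₁ uw
      ... | inj₂ g    | inj₂ h    = ~#⊥ uw (apart g h)
      ind : ∀ {u w} → u ∈ A₁ ++ A₂ → w ∈ A₁ ++ A₂ → u ~ w → ⊥
      ind m m′ uw with ∈-++⁻ A₁ m | ∈-++⁻ A₁ m′
      ... | inj₁ p | inj₁ q = F₁.indep p q uw
      ... | inj₁ p | inj₂ q = mixed p q uw
      ... | inj₂ p | inj₁ q = mixed q p (~-sym uw)
      ... | inj₂ p | inj₂ q = F₂.indep p q uw
      nbx : ∀ {u} → S ∋ u → x ~ u → u ∈ R₁ ++ R₂
      nbx {u} Su xu with u F.≟ b
      ... | yes refl = ∈-++⁺ʳ R₁ (F₂.nbr m₂ (B.S-B Sb (λ e → proj₂ ab (≡-sym e))) xu)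
      ... | no d     = ∈-++⁺ˡ (F₁.nbr m₁ (A.S-B Su d) xu)
      nb : ∀ {w u} → w ∈ A₁ ++ A₂ → S ∋ u → w ~ u → u ∈ R₁ ++ R₂
      nb {w} {u} m Su wu with ∈-++⁻ A₁ m
      nb {w} {u} m Su wu | inj₁ p with All.lookup g₁ p
      ... | inj₁ refl    = nbx Su wu
      ... | inj₂ (g , _) = ∈-++⁺ˡ (F₁.nbr p (A.S-B Su λ { refl → ~#⊥ wu (A.Plain.wb g) }) wu)
      nb {w} {u} m Su wu | inj₂ p with All.lookup g₂ p
      ... | inj₁ refl    = nbx Su wu
      ... | inj₂ (g , _) = ∈-++⁺ʳ R₁ (F₂.nbr p (B.S-B Su λ { refl → ~#⊥ wu (B.Plain.wb g) }) wu)
      cov : ∀ {s} → s ∈ R₁ ++ R₂ → ∀ L → Max L → L ∋ s → ∃ λ u → u ∈ A₁ ++ A₂ × L ∋ u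
      cov m L M Ls with ∈-++⁻ R₁ m
      ... | inj₁ p with F₁.cover p L M Ls
      ...   | u , u∈ , Lu = u , ∈-++⁺ˡ u∈ , Lu
      cov m L M Ls | inj₂ p with F₂.cover p L M Ls
      ...   | u , u∈ , Lu = u , ∈-++⁺ʳ A₁ u∈ , Lu

    attached-split : ∀ ps {h₀ h₁ hs} → Attached ps h₀ h₁ hs → ∃ λ ini → ∃ λ p →
      ps ≡ ini ++ p ∷ [] × Far ini (h₀ ∷ h₁ ∷ hs) × p ~ h₀ × p ~ h₁ × All (p #_) hs
    attached-split (p ∷ []) (u , v , w) = [] , p , refl , [] , u , v , w
    attached-split (p ∷ q ∷ ps) (f , at) with attached-split (q ∷ ps) at
    ... | ini , r , e , g , h = p ∷ ini , r , cong (p ∷_) e , f ∷ g , h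

    -- The path of the handcuff crosses the edge yz of the sun.
    two-lollipops : A.Rooted-at y → B.Rooted-at z → ⊥
    two-lollipops α β with attached-split (y ∷ A.Rooted-at.Λ α) (A.Rooted-at.att α)
    ... | ini , p , e , far , ph₀ , ph₁ , phs =
      handcuff (proj₁ α.hole) (proj₁ (proj₂ α.hole)) (proj₂ (proj₂ α.hole))
               (proj₁ β.hole) (proj₁ (proj₂ β.hole)) (proj₂ (proj₂ β.hole))
        (subst (λ l → IndPath (l ++ z ∷ β.Λ)) R joined) odd ph₀ ph₁ phs
        (++⁺ (reverse⁺ far) (All.map #-sym zH ∷ far-sym _ _ (All.map All.tail farH)))
        (subst (λ l → Attached (l ++ z ∷ β.Λ) β.h₀ β.h₁ β.hs) R
          (attached-++ (reverse (y ∷ α.Λ)) z β.Λ (reverse⁺ (yK ∷ farΛK)) β.att))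
        farHK
      where
      module α = A.Rooted-at α
      module β = B.Rooted-at β
      H K : List V
      H = α.h₀ ∷ α.h₁ ∷ α.hs
      K = β.h₀ ∷ β.h₁ ∷ β.hs
      gΛ : All A.Good α.Λ
      gΛ = ++⁻ˡ α.Λ α.arms
      gH : All A.Good H
      gH = ++⁻ʳ α.Λ α.arms
      kΛ : All B.Good β.Λ
      kΛ = ++⁻ˡ β.Λ β.arms
      kK : All B.Good K
      kK = ++⁻ʳ β.Λ β.arms
      zH : All (_# z) H
      zH = All.map (λ g → A.Plain.wz (proj₁ g)) gH
      yK : All (y #_) K
      yK = All.map (λ g → #-sym (B.Plain.wz (proj₁ g))) kK
      farHK : Far H K
      farHK = far-apart gH kK
      farH : Far H (z ∷ β.Λ)
      farH = All.zipWith (λ { (u , v) → u ∷ v }) (zH , far-apart gH kΛ)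
      farΛK : Far α.Λ K
      farΛK = far-apart gΛ kK
      joined : IndPath (reverse (y ∷ α.Λ) ++ z ∷ β.Λ)
      joined = indPath-join (reverse (y ∷ α.Λ)) z β.Λ (indPath-reverse (y ∷ α.Λ) α.path) β.path
        (lastAdj-reverse y α.Λ (~-sym yz) (All.map (λ g → #-sym (A.Plain.wz (proj₁ g))) gΛ))
        (reverse⁺ (All.map (λ g → #-sym (B.Plain.wz (proj₁ g))) kΛ ∷ far-apart gΛ kΛ))
      R : reverse (y ∷ α.Λ) ≡ p ∷ reverse ini
      R = trans (cong reverse e) (reverse-++ ini (p ∷ []))
      odd : odd? (length (reverse ini ++ z ∷ β.Λ)) ≡ true
      odd = lem (cong (λ l → odd? (length (l ++ z ∷ β.Λ))) R)
        where
        lem : odd? (length (reverse (y ∷ α.Λ) ++ z ∷ β.Λ)) ≡ not (odd? (length (reverse ini ++ z ∷ β.Λ))) →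
              odd? (length (reverse ini ++ z ∷ β.Λ)) ≡ true
        lem q rewrite odd?-++ (reverse (y ∷ α.Λ)) (z ∷ β.Λ) | length-reverse (y ∷ α.Λ) | α.even | β.even
          with odd? (length (reverse ini ++ z ∷ β.Λ))
        ... | true = refl

-- Strong stable sets without a 4-wheel

allVecs : ∀ m → List (Vec Bool m)
allVecs zero    = [] ∷ []
allVecs (suc m) = map (true ∷_) (allVecs m) ++ map (false ∷_) (allVecs m)

∈-allVecs : ∀ {m} (xs : Vec Bool m) → xs ∈ allVecs m
∈-allVecs []           = here refl
∈-allVecs (true ∷ xs)  = ∈-++⁺ˡ (∈-map⁺ (true ∷_) (∈-allVecs xs))
∈-allVecs (false ∷ xs) = ∈-++⁺ʳ (map (true ∷_) (allVecs _)) (∈-map⁺ (false ∷_) (∈-allVecs xs))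

module W4FreeCase (G : Graph) (F : Forbidden G) (w4 : W4Free G) where
  open Lists G
  open Contact G F
  open Cliques G
  open Legs G F w4

  module Step (S : V → Bool) (stable : Stable S) where
    open Improve G F w4 S stable
    open Suns G F w4 S stable
    open Augment S stable using (stable-#)

    -- The leg towards `a` can start at `x` or at `y`. What is good when seen from `y` is good when
    -- seen from `x`, so a lollipop grown from `y` can be used there without rerooting.
    module TipSwap {a b c x y z} (s : Sun a b c x y z) (s′ : Sun a c b y x z) where
      module A = Tip s
      module A′ = Tip s′

      plain : ∀ {w} → A′.Plain w → A.Plain w
      plain p = record { wb = A′.Plain.wc p ; wc = A′.Plain.wb p ; wz = A′.Plain.wz p ; agree = ≡-sym (A′.Plain.agree p) }

      end : ∀ ws → All A′.Plain ws → LastAdj y ws → LastAdj x ws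
      end (w ∷ [])      (g ∷ [])     e       = A′.y~ g e
      end (w ∷ w′ ∷ ws) (g ∷ g′ ∷ h) (e , f) = A′.y# g e , end (w′ ∷ ws) (g′ ∷ h) f

      good : ∀ {w} → A′.Good w → A.Good w
      good {w} (p , arm , _) =
        plain p ,
        record { rest = A′.Arm.rest arm ; path = A′.Arm.path arm
               ; end = end (w ∷ A′.Arm.rest arm) (A′.Arm.plain arm) (A′.Arm.end arm)
               ; plain = All.map plain (A′.Arm.plain arm) } ,
        λ { refl → ~#⊥ (Sun.xb s) (A′.Plain.wc p) }

      direct : A′.Lollipop y a A′.Good → A.Rooted-at y
      direct (A′.short E ya yh₁ yhs _ _ g) = record
        { Λ = [] ; path = tt ; even = refl ; att = ya , yh₁ , yhs ; hole = E ; arms = All.map good g }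
      direct (A′.long P o A E _ gΛ gC) = record
        { path = P ; even = cong not o ; att = A ; hole = E ; arms = All.map good (++⁺ gΛ gC) }

    module _ {K : V → Bool} (M : Max K) (missed : ∀ {x} → K ∋ x → S ∋ x → ⊥) where

      pair : ∀ {a b c x y z} (s : Sun a b c x y z) → K ∋ x →
        Improvement K ⊎ Tip.Lollipop s x a (Tip.Good s) ⊎ Tip.Lollipop (swapᵃᵇ s) x b (Tip.Good (swapᵃᵇ s))
      pair s Kx with Tip.leg s | Tip.leg (swapᵃᵇ s)
      ... | inj₁ l | _      = inj₂ (inj₁ l)
      ... | inj₂ _ | inj₁ l = inj₂ (inj₂ l)
      ... | inj₂ d | inj₂ e with TwoTips.join-flips s d e
      ...   | _ , _ , f , m = inj₁ (flip-improves f m Kx)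

      -- With the leg to `a` blocked, `z` can use the legs to `b` and `c`. A lollipop at `b` or at
      -- `c` would combine with the one at `a`, so at most one of the three tips is blocked.
      one-lollipop : ∀ {a b c x y z} (s : Sun a b c x y z) → K ∋ z →
        Tip.Lollipop s x a (Tip.Good s) → Improvement K
      one-lollipop s Kz l with pair (swapᵇᶜ (swapᵃᵇ s)) Kz
      ... | inj₁ i = i
      ... | inj₂ (inj₁ l′) =
        ⊥-elim (TwoTips.two-lollipops s (Tip.reroot s l) (TipSwap.direct (swapᵃᵇ s) (swapᵇᶜ (swapᵃᵇ s)) l′))
      ... | inj₂ (inj₂ l′) =
        ⊥-elim (TwoTips.two-lollipops (swapᵇᶜ s) (TipSwap.direct (swapᵇᶜ s) s l)
          (TipSwap.direct (swapᵃᵇ (swapᵇᶜ s)) (swapᵃᵇ (swapᵇᶜ (swapᵃᵇ s))) l′))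

      sun-improves : ∀ {a b c x y z} → Sun a b c x y z → K ∋ x → K ∋ y → K ∋ z → Improvement K
      sun-improves s Kx Ky Kz with pair s Kx
      ... | inj₁ i        = i
      ... | inj₂ (inj₁ l) = one-lollipop s Kz l
      ... | inj₂ (inj₂ l) = one-lollipop (swapᵃᵇ s) Ky l

      other-nbr : ∀ {v} → K ∋ v → ∀ t → S ∋ t → t ~ v → Improvement K ⊎ ∃ λ u → S ∋ u × u ~ v × u ≢ t
      other-nbr {v} Kv t St tv with any? (λ u → (S u ≟ true) ×-dec ~? u v ×-dec ¬? (u F.≟ t))
      ... | yes (u , p) = inj₂ (u , p)
      ... | no lone     = inj₁ (unique-improves M missed Kv St tv uniq)
        where
        uniq : ∀ {u} → S ∋ u → u ~ v → u ≡ t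
        uniq {u} Su uv with u F.≟ t
        ... | yes e = e
        ... | no d  = ⊥-elim (lone (u , Su , uv , d))

      -- Unless `x` or `z` has fewer than two neighbours in `S`, a sun arises: maximality of `K`
      -- gives `z` missing `a` and `y` missing `b`, and claw-freeness supplies the other
      -- adjacencies.
      improve-at : ∀ {x} → K ∋ x → Improvement K
      improve-at {x} Kx with any? (λ u → (S u ≟ true) ×-dec ~? u x)
      ... | no lone = lone-improves M missed Kx λ Su ux → lone (_ , Su , ux)
      ... | yes (a , Sa , ax) with other-nbr Kx a Sa ax | outside M a (K-false M missed Sa)
      ...   | inj₁ i | _ = i
      ...   | inj₂ (b , Sb , bx , ba) | z , Kz , za with other-nbr Kz b Sb bz
        where
        xz : x ~ z
        xz = MaxIn.clq M Kx Kz λ { refl → ~#⊥ (~-sym ax) za }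
        bz : b ~ z
        bz = noFork (~-sym ax) (~-sym bx) xz (stable-# Sa Sb λ e → ba (≡-sym e)) (#-sym za) (λ e → missed Kz (subst (S ∋_) e Sb))
      ...     | inj₁ i = i
      ...     | inj₂ (c , Sc , cz , cb) with outside M b (K-false M missed Sb)
      ...       | y , Ky , yb = sun-improves (record
                  { Sa = Sa ; Sb = Sb ; Sc = Sc ; Sx = S-false M missed Kx ; Sy = S-false M missed Ky ; Sz = S-false M missed Kz
                  ; xa = ~-sym ax ; xb = ~-sym bx ; xc = xc ; ya = ~-sym ay ; yc = ~-sym cy ; yb = yb
                  ; zb = ~-sym bz ; zc = ~-sym cz ; za = za ; xy = xy ; xz = xz ; yz = yz
                  ; ab = ab ; ac = ac ; bc = bc }) Kx Ky Kz
        where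
        xz : x ~ z
        xz = MaxIn.clq M Kx Kz λ { refl → ~#⊥ (~-sym ax) za }
        ab : a # b
        ab = stable-# Sa Sb λ e → ba (≡-sym e)
        bc : b # c
        bc = stable-# Sb Sc λ e → cb (≡-sym e)
        ac : a # c
        ac = stable-# Sa Sc λ { refl → ~#⊥ (~-sym cz) za }
        bz : b ~ z
        bz = noFork (~-sym ax) (~-sym bx) xz ab (#-sym za) (λ e → missed Kz (subst (S ∋_) e Sb))
        xy : x ~ y
        xy = MaxIn.clq M Kx Ky λ { refl → ~#⊥ (~-sym bx) yb }
        yz : y ~ z
        yz = MaxIn.clq M Ky Kz λ { refl → ~#⊥ (~-sym bz) yb }
        ay : a ~ y
        ay = noFork (~-sym bx) (~-sym ax) xy (#-sym ab) (#-sym yb) (λ e → missed Ky (subst (S ∋_) e Sa))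
        cy : c ~ y
        cy = noFork (~-sym bz) (~-sym cz) (~-sym yz) bc (#-sym yb) (λ e → missed Ky (subst (S ∋_) e Sc))
        xc : x # c
        xc = nonadj (~-sym ax) (~-sym bx) ab (λ e → missed Kx (subst (S ∋_) (≡-sym e) Sc)) ac bc

  Strong : (V → Bool) → Set
  Strong S = Stable S × ∀ L → Max L → ∃ λ x → S ∋ x × L ∋ x

  max? : ∀ L → Dec (Max L)
  max? L = map′ (λ { (c , m) → record { sub = λ _ → refl ; clq = λ {x} {y} → c x y ; max = λ v _ → m v } })
                (λ M → (λ x y → MaxIn.clq M) , outside M)
                (all? (λ x → all? λ y → (L x ≟ true) →-dec (L y ≟ true) →-dec ¬? (x F.≟ y) →-dec ~? x y) ×-dec
                 all? (λ v → (L v ≟ false) →-dec any? λ u → (L u ≟ true) ×-dec (adj G u v ≟ false) ×-dec ¬? (u F.≟ v)))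

  -- An improvement loses no maximal clique that is already hit, so one pass over the list suffices.
  -- The list will contain all vertex sets, and `max?` picks out those that matter.
  hitting : V → (Ls : List (V → Bool)) → ∃ λ S → Stable S × All (λ L → Max L → ∃ λ x → S ∋ x × L ∋ x) Ls
  hitting v₀ [] = (λ _ → false) , (λ ()) , []
  hitting v₀ (L ∷ Ls) with hitting v₀ Ls
  ... | S , st , hs with any? (λ x → (S x ≟ true) ×-dec (L x ≟ true)) | max? L
  ...   | yes h | _      = S , st , (λ _ → h) ∷ hs
  ...   | no _  | no m   = S , st , (λ M → ⊥-elim (m M)) ∷ hs
  ...   | no h  | yes M  = result (Step.improve-at S st M (λ a b → h (_ , b , a)) (proj₂ member))
    where
    member : ∃ λ x → L ∋ x
    member with ∋? L v₀
    ... | inj₁ a = v₀ , a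
    ... | inj₂ b with outside M v₀ b
    ...   | u , Lu , _ = u , Lu
    result : Improve.Improvement G F w4 S st L →
             ∃ λ T → Stable T × All (λ L → Max L → ∃ λ x → T ∋ x × L ∋ x) (L ∷ Ls)
    result (T , stT , hT , keep) = T , stT , (λ _ → hT) ∷ All.map (λ f M′ → keep _ M′ (f M′)) hs

  w4Free-strong : V → ∃ Strong
  w4Free-strong v₀ with hitting v₀ (map lookupᵛ (allVecs (n G)))
  ... | S , st , hs = S , st , hit
    where
    hit : ∀ L → Max L → ∃ λ x → S ∋ x × L ∋ x
    hit L M with All.lookup hs (∈-map⁺ lookupᵛ (∈-allVecs (tabulate L))) M′
      where
      at : ∀ v → lookupᵛ (tabulate L) v ≡ L v
      at v = lookup∘tabulate L v
      M′ : Max (lookupᵛ (tabulate L))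
      M′ = record
        { sub = λ _ → refl
        ; clq = λ {x} {y} p q → MaxIn.clq M (trans (≡-sym (at x)) p) (trans (≡-sym (at y)) q)
        ; max = λ v _ e → back v (outside M v (trans (≡-sym (at v)) e)) }
        where
        back : ∀ v → (∃ λ u → L ∋ u × u # v) → ∃ λ u → lookupᵛ (tabulate L) u ≡ true × u # v
        back v (u , Lu , uv) = u , trans (at u) Lu , uv
    ... | x , Sx , Lx = x , Sx , trans (≡-sym (lookup∘tabulate L x)) Lx

-- Graphs with a 4-wheel

module Sets {m : ℕ} where

  VSet : Set
  VSet = F.Fin m → Bool

  infix 4 _⊆_
  _⊆_ : VSet → VSet → Set
  X ⊆ Y = ∀ {v} → X v ≡ true → Y v ≡ true

  abstract
    ⌈_⌉ : {P : F.Fin m → Set} → (∀ v → Dec (P v)) → VSet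
    ⌈ P? ⌉ v = ⌊ P? v ⌋

    ⌈⌉⁺ : {P : F.Fin m → Set} (P? : ∀ v → Dec (P v)) → ∀ {v} → P v → ⌈ P? ⌉ v ≡ true
    ⌈⌉⁺ P? {v} p with P? v
    ... | yes _ = refl
    ... | no ¬p = ⊥-elim (¬p p)

    ⌈⌉⁻ : {P : F.Fin m → Set} (P? : ∀ v → Dec (P v)) → ∀ {v} → ⌈ P? ⌉ v ≡ true → P v
    ⌈⌉⁻ P? {v} e with P? v
    ⌈⌉⁻ P? {v} e  | yes p = p
    ⌈⌉⁻ P? {v} () | no _

    ⌈⌉-no : {P : F.Fin m → Set} (P? : ∀ v → Dec (P v)) → ∀ {v} → ¬ P v → ⌈ P? ⌉ v ≡ false
    ⌈⌉-no P? {v} ¬p with P? v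
    ... | yes p = ⊥-elim (¬p p)
    ... | no _  = refl

  add : VSet → F.Fin m → VSet
  add X w v = X v ∨ ⌊ v F.≟ w ⌋

  add-old : ∀ X w → X ⊆ add X w
  add-old X w e rewrite e = refl

  add-new : ∀ X w → add X w w ≡ true
  add-new X w with X w | w F.≟ w
  ... | true  | _     = refl
  ... | false | yes _ = refl
  ... | false | no d  = ⊥-elim (d refl)

  add⁻ : ∀ X w {v} → add X w v ≡ true → X v ≡ true ⊎ v ≡ w
  add⁻ X w {v} e with X v | v F.≟ w
  add⁻ X w {v} e  | true  | _     = inj₁ refl
  add⁻ X w {v} e  | false | yes p = inj₂ p
  add⁻ X w {v} () | false | no _

  -- Every step brings in a new vertex, so the list of vertices outside the set shrinks. Maximal
  -- cliques, maximal fat sets and components are all produced by this loop.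
  saturate : {P Q : VSet → Set} →
    (∀ X → P X → Q X ⊎ ∃ λ Y → ∃ λ w → P Y × X ⊆ Y × X w ≡ false × Y w ≡ true) →
    ∀ X → P X → ∃ λ Y → P Y × Q Y
  saturate {P} {Q} step X₀ p₀ = go _ (allFin m) ≤-refl X₀ p₀ (λ {v} _ → ∈-allFin v)
    where
    go : ∀ k pool → length pool ≤ k → ∀ X → P X → (∀ {v} → X v ≡ false → v ∈ pool) → ∃ λ Y → P Y × Q Y
    go k pool le X p out with step X p
    ... | inj₁ q = X , p , q
    ... | inj₂ (Y , w , p′ , sub , Xw , Yw) = again k le
      where
      keep? : ∀ v → Dec (v ≢ w)
      keep? v = ¬? (v F.≟ w)
      shorter : length (filter keep? pool) < length pool
      shorter = filter-notAll keep? pool (lose (out Xw) (λ f → f refl))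
      out′ : ∀ {v} → Y v ≡ false → v ∈ filter keep? pool
      out′ {v} Yv = ∈-filter⁺ keep? (out Xv) λ { refl → clash Yw Yv }
        where
        clash : ∀ {b : Bool} → b ≡ true → b ≡ false → ⊥
        clash refl ()
        Xv : X v ≡ false
        Xv with X v in e
        ... | false = refl
        ... | true  = ⊥-elim (clash (sub e) Yv)
      again : ∀ k → length pool ≤ k → ∃ λ Y → P Y × Q Y
      again zero le′ with ≤-trans shorter le′
      ... | ()
      again (suc k′) le′ = go k′ (filter keep? pool) (≤-pred (≤-trans shorter le′)) Y p′ out′

-- Walks and the induced paths within them

module Walks (G : Graph) where
  open Lists G

  -- A walk whose interior vertices satisfy U.
  data Walk (U : V → Set) : V → V → Set where
    one : ∀ {x y} → x ~ y → Walk U x y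
    via : ∀ {x w y} → x ~ w → U w → Walk U w y → Walk U x y

  walk-map : ∀ {U U′ : V → Set} → (∀ {v} → U v → U′ v) → ∀ {x y} → Walk U x y → Walk U′ x y
  walk-map f (one a)     = one a
  walk-map f (via a u w) = via a (f u) (walk-map f w)

  walk-snoc : ∀ {U : V → Set} {x y z} → Walk U x y → U y → y ~ z → Walk U x z
  walk-snoc (one a)     u b = via a u (one b)
  walk-snoc (via a v w) u b = via a v (walk-snoc w u b)

  walk-trans : ∀ {U : V → Set} {x y z} → Walk U x y → U y → Walk U y z → Walk U x z
  walk-trans (one a)     u w = via a u w
  walk-trans (via a v p) u w = via a v (walk-trans p u w)

  walk-sym : ∀ {U : V → Set} {x y} → Walk U x y → Walk U y x
  walk-sym (one a)     = one (~-sym a)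
  walk-sym (via a u w) = walk-snoc (walk-sym w) u (~-sym a)

  private
    shorten : ∀ {U : V → Set} {y} x ms → IndPath (ms ++ y ∷ []) → All U ms →
      All (x #_) (ms ++ y ∷ []) ⊎ (x ≡ y ⊎ ∃ λ mid → IndPath (x ∷ mid ++ y ∷ []) × All U mid)
    shorten {y = y} x [] P _ with tri x y
    ... | eq e = inj₂ (inj₁ e)
    ... | ad a = inj₂ (inj₂ ([] , (a , [] , P) , []))
    ... | na d = inj₁ (d ∷ [])
    shorten x (p ∷ ms) P (u ∷ us) with shorten x ms (indPath-tail p _ P) us
    ... | inj₂ r = inj₂ r
    ... | inj₁ f with tri x p
    ...   | eq refl = inj₂ (inj₂ (ms , P , us))
    ...   | ad a    = inj₂ (inj₂ (p ∷ ms , (a , f , P) , u ∷ us))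
    ...   | na d    = inj₁ (d ∷ f)

  induced : ∀ {U : V → Set} {x y} → Walk U x y → x ≢ y → ∃ λ mid → IndPath (x ∷ mid ++ y ∷ []) × All U mid
  induced (one a) _ = [] , (a , [] , _) , []
  induced {y = y} (via {x} {w} a u p) d with w F.≟ y
  ... | yes refl = [] , (a , [] , _) , []
  ... | no e with induced p e
  ...   | mid , P , us with shorten x (w ∷ mid) P (u ∷ us)
  ...     | inj₁ (f ∷ _)   = ⊥-elim (~#⊥ a f)
  ...     | inj₂ (inj₁ q)  = ⊥-elim (d q)
  ...     | inj₂ (inj₂ r)  = r

  -- The walk is scanned from its far end: a vertex in `Q` becomes the new end, and the next vertex
  -- in `P` completes the segment, so its interior avoids both.
  segment : ∀ {N P Q : V → Set} → (∀ v → Dec (P v)) → (∀ v → Dec (Q v)) → ∀ {x y} → Walk N x y →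
    N x → N y → P x → Q y →
    ∃ λ x′ → ∃ λ y′ → N x′ × N y′ × P x′ × Q y′ × Walk (λ v → N v × ¬ P v × ¬ Q v) x′ y′
  segment {N} {P} {Q} P? Q? {x} w₀ Nx₀ Ny₀ Px₀ Qy₀ with go w₀ Ny₀ Qy₀
    where
    N₀ : V → Set
    N₀ v = N v × ¬ P v × ¬ Q v
    go : ∀ {x y} → Walk N x y → N y → Q y →
      (∃ λ x′ → ∃ λ y′ → N x′ × N y′ × P x′ × Q y′ × Walk N₀ x′ y′) ⊎ (∃ λ y′ → N y′ × Q y′ × Walk N₀ x y′)
    go (one a) Ny Qy = inj₂ (_ , Ny , Qy , one a)
    go (via {w = w} a u p) Ny Qy with go p Ny Qy
    ... | inj₁ r = inj₁ r
    ... | inj₂ (y′ , Ny′ , Qy′ , p′) with Q? w | P? w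
    ...   | yes q | _     = inj₂ (w , u , q , one a)
    ...   | no _  | yes c = inj₁ (w , y′ , u , Ny′ , c , Qy′ , p′)
    ...   | no q  | no c  = inj₂ (y′ , Ny′ , Qy′ , via a (u , c , q) p′)
  ... | inj₁ r = r
  ... | inj₂ (y′ , Ny′ , Qy′ , p) = x , y′ , Nx₀ , Ny′ , Px₀ , Qy′ , p

-- Strong stable sets of induced subgraphs

module StrongSets (G : Graph) where
  open Lists G
  open Cliques G
  open Sets {n G}

  record StrongIn (U : VSet) : Set where
    field
      S      : VSet
      sub    : S ⊆ U
      stable : Stable S
      hits   : ∀ L → MaxIn U L → ∃ λ x → S ∋ x × L ∋ x

  extend-clique : ∀ U K → K ⊆ U → (∀ {x y} → K ∋ x → K ∋ y → x ≢ y → x ~ y) → ∃ λ L → MaxIn U L × K ⊆ L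
  extend-clique U K KU Kc with saturate {P = λ X → X ⊆ U × K ⊆ X × (∀ x y → X ∋ x → X ∋ y → x ≢ y → x ~ y)}
                                        {Q = λ X → ∀ v → U ∋ v → X v ≡ false → ∃ λ u → X ∋ u × u # v}
                                        step K (KU , (λ e → e) , λ x y → Kc)
    where
    P Q : VSet → Set
    P X = X ⊆ U × K ⊆ X × (∀ x y → X ∋ x → X ∋ y → x ≢ y → x ~ y)
    Q X = ∀ v → U ∋ v → X v ≡ false → ∃ λ u → X ∋ u × u # v
    step : ∀ X → P X → Q X ⊎ ∃ λ Y → ∃ λ w → P Y × X ⊆ Y × X w ≡ false × Y w ≡ true
    step X (XU , KX , Xc)
      with any? (λ v → (U v ≟ true) ×-dec (X v ≟ false) ×-dec all? λ u → (X u ≟ true) →-dec ~? u v)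
    ... | yes (v , Uv , Xv , all) =
      inj₂ (add X v , v , ((λ e → U′ (add⁻ X v e)) , (λ e → add-old X v (KX e)) ,
        λ x y a b → clq (add⁻ X v a) (add⁻ X v b)) , add-old X v , Xv , add-new X v)
      where
      U′ : ∀ {u} → X ∋ u ⊎ u ≡ v → U ∋ u
      U′ (inj₁ a)    = XU a
      U′ (inj₂ refl) = Uv
      clq : ∀ {x y} → X ∋ x ⊎ x ≡ v → X ∋ y ⊎ y ≡ v → x ≢ y → x ~ y
      clq (inj₁ a)    (inj₁ b)    d = Xc _ _ a b d
      clq (inj₁ a)    (inj₂ refl) d = all _ a
      clq (inj₂ refl) (inj₁ b)    d = ~-sym (all _ b)
      clq (inj₂ refl) (inj₂ refl) d = ⊥-elim (d refl)
    ... | no stuck = inj₁ λ v Uv Xv → blocker v Uv Xv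
      where
      blocker : ∀ v → U ∋ v → X v ≡ false → ∃ λ u → X ∋ u × u # v
      blocker v Uv Xv with any? (λ u → (X u ≟ true) ×-dec (adj G u v ≟ false))
      ... | yes (u , Xu , uv) = u , Xu , uv , ∋-≢ {X} Xu Xv
      ... | no none′ = ⊥-elim (stuck (v , Uv , Xv , all))
        where
        all : ∀ u → X ∋ u → u ~ v
        all u Xu with adj G u v in e
        ... | true  = refl
        ... | false = ⊥-elim (none′ (u , Xu , e))
  ... | L , (LU , KL , Lc) , Lm = L , record { sub = LU ; clq = λ {x} {y} → Lc x y ; max = Lm } , KL

  -- The set of `x` and `y` extends to a maximal clique of the induced graph, and `h` is where the
  -- strong set meets it. The case `x ≡ y` serves single vertices.
  hit-edge : ∀ {U} (T : StrongIn U) {x y} → U ∋ x → U ∋ y → x ≡ y ⊎ x ~ y →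
    ∃ λ h → StrongIn.S T ∋ h × (h ≡ x ⊎ h ~ x) × (h ≡ y ⊎ h ~ y)
  hit-edge {U} T {x} {y} Ux Uy xy with extend-clique U (add (⌈ F._≟ x ⌉) y) sub′ clq′
    where
    view : ∀ {v} → add (⌈ F._≟ x ⌉) y v ≡ true → v ≡ x ⊎ v ≡ y
    view e with add⁻ (⌈ F._≟ x ⌉) y e
    ... | inj₁ a = inj₁ (⌈⌉⁻ (F._≟ x) a)
    ... | inj₂ b = inj₂ b
    sub′ : add (⌈ F._≟ x ⌉) y ⊆ U
    sub′ {v} e with view {v} e
    ... | inj₁ refl = Ux
    ... | inj₂ refl = Uy
    join : ∀ {u v} → u ≡ x ⊎ u ≡ y → v ≡ x ⊎ v ≡ y → x ≡ y ⊎ x ~ y → u ≢ v → u ~ v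
    join (inj₁ refl) (inj₁ refl) _        d = ⊥-elim (d refl)
    join (inj₂ refl) (inj₂ refl) _        d = ⊥-elim (d refl)
    join (inj₁ refl) (inj₂ refl) (inj₁ e) d = ⊥-elim (d e)
    join (inj₂ refl) (inj₁ refl) (inj₁ e) d = ⊥-elim (d (≡-sym e))
    join (inj₁ refl) (inj₂ refl) (inj₂ a) d = a
    join (inj₂ refl) (inj₁ refl) (inj₂ a) d = ~-sym a
    clq′ : ∀ {u v} → add (⌈ F._≟ x ⌉) y ∋ u → add (⌈ F._≟ x ⌉) y ∋ v → u ≢ v → u ~ v
    clq′ {u} {v} a b = join (view {u} a) (view {v} b) xy
  ... | L , M , KL with StrongIn.hits T L M
  ...   | h , Sh , Lh = h , Sh , near (KL (add-old (⌈ F._≟ x ⌉) y (⌈⌉⁺ (F._≟ x) refl))) , near (KL (add-new (⌈ F._≟ x ⌉) y))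
    where
    near : ∀ {v} → L ∋ v → h ≡ v ⊎ h ~ v
    near {v} Lv with h F.≟ v
    ... | yes e = inj₁ e
    ... | no d  = inj₂ (MaxIn.clq M Lh Lv d)

-- Enlarging a 4-wheel

module FatSquares (G : Graph) (F : Forbidden G) where
  open Lists G
  open Forbidden F
  open Cliques G
  open Sets {n G}
  module C = Base (co G)
  module CL = Lists (co G)
  module CW = Walks (co G)

  co~ : ∀ {x y} → x # y → x C.~ y
  co~ r = proj₁ (co-Rel G r)

  co# : ∀ {x y} → x ~ y → x C.# y
  co# a = co-Rel G (~⇒Rel a)

  A : VSet → V → Set
  A Z v = ∀ z → Z ∋ z → v ~ z

  A? : ∀ Z v → Dec (A Z v)
  A? Z v = all? λ z → (Z z ≟ true) →-dec ~? v z

  -- A 4-wheel with two opposite rim vertices enlarged to the set Z, which is connected in the complement;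
  -- the hub may end up in Z or among the vertices A Z complete to Z.
  data Centre (Z : VSet) : Set where
    inZ : ∀ {y u v} → Z ∋ y → Z ∋ u → Z ∋ v → y ~ u → y ~ v → u # v → Centre Z
    inA : ∀ {y u v} → A Z y → A Z u → A Z v → y ~ u → y ~ v → u # v → Centre Z

  record Fat (Z : VSet) : Set where
    field
      {z₀ z₁ p₀ q₀} : V
      Zz₀    : Z ∋ z₀
      Zz₁    : Z ∋ z₁
      z₀z₁   : z₀ # z₁
      Ap₀    : A Z p₀
      Aq₀    : A Z q₀
      p₀q₀   : p₀ # q₀
      anti   : ∀ {u v} → Z ∋ u → Z ∋ v → u ≡ v ⊎ CW.Walk (Z ∋_) u v
      centre : Centre Z

  -- The gain from maximality: by `grow`, a vertex `m` violating this could be absorbed into `Z`.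
  Closed : VSet → Set
  Closed Z = ∀ {m p q} → Z m ≡ false → ¬ A Z m → A Z p → A Z q → p # q → m ~ p → m ~ q → ⊥

  missing : ∀ {Z m} → ¬ A Z m → Z m ≡ false → ∃ λ z → Z ∋ z × m # z
  missing {Z} {m} nA Zm with any? (λ z → (Z z ≟ true) ×-dec (adj G m z ≟ false))
  ... | yes (z , Zz , e) = z , Zz , e , λ q → ∋-≢ {Z} Zz Zm (≡-sym q)
  ... | no all = ⊥-elim (nA λ z Zz → full z Zz)
    where
    full : ∀ z → Z ∋ z → m ~ z
    full z Zz with adj G m z in e
    ... | true  = refl
    ... | false = ⊥-elim (all (z , Zz , e))

  module Grow {Z : VSet} (fat : Fat Z) where
    open Fat fat

    triple : ∀ {u v w} → A Z u → A Z v → A Z w → u # v → u # w → v # w → ⊥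
    triple Au Av Aw = claw (~-sym (Au z₀ Zz₀)) (~-sym (Av z₀ Zz₀)) (~-sym (Aw z₀ Zz₀))

    record Target (m : V) : Set where
      field
        {p q y} : V
        Ap : A Z p
        Aq : A Z q
        Ay : A Z y
        pq : p # q
        mp : m ~ p
        mq : m ~ q
        yp : y ~ p
        yq : y ~ q

    module _ {m : V} (m∉ : ¬ A Z m) where

      -- The edge `y d` leads from the side of `p` to the side of `q`. If `m` sees `d` or `y`, that
      -- vertex can replace `q` or `p`; otherwise `m , p , y , d , q` is a five-hole.
      core : ∀ {p q y d} → A Z p → A Z q → p # q → m ~ p → m ~ q → (∀ {w} → A Z w → w ~ p → w ~ q → ⊥) →
        A Z y → A Z d → y ~ d → y ≡ p ⊎ y ~ p → d ≡ q ⊎ d ~ q → Target m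
      core Ap Aq pq mp mq sep Ay Ad yd (inj₁ refl) (inj₁ refl) = ⊥-elim (~#⊥ yd pq)
      core Ap Aq pq mp mq sep Ay Ad yd (inj₂ yp)   (inj₁ refl) = ⊥-elim (sep Ay yp yd)
      core Ap Aq pq mp mq sep Ay Ad yd (inj₁ refl) (inj₂ dq)   = ⊥-elim (sep Ad (~-sym yd) dq)
      core {p} {q} {y} {d} Ap Aq pq mp mq sep Ay Ad yd (inj₂ yp) (inj₂ dq)
        with adn m d (λ { refl → m∉ Ad }) | adn m y (λ { refl → m∉ Ay })
      ... | ad md | _ = record { Ap = Ap ; Aq = Ad ; Ay = Ay ; pq = pd ; mp = mp ; mq = md ; yp = yp ; yq = yd }
        where
        pd : p # d
        pd with adn p d (λ { refl → ~#⊥ dq pq })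
        ... | na e = e
        ... | ad e = ⊥-elim (sep Ad (~-sym e) dq)
      ... | na _ | ad my = record { Ap = Ay ; Aq = Aq ; Ay = Ad ; pq = yq ; mp = my ; mq = mq ; yp = ~-sym yd ; yq = dq }
        where
        yq : y # q
        yq with adn y q (λ { refl → ~#⊥ yp (#-sym pq) })
        ... | na e = e
        ... | ad e = ⊥-elim (sep Ay yp e)
      ... | na md | na my = ⊥-elim (oddHole {m} {p} {y ∷ d ∷ q ∷ []}
        (mp , (my , md , mq) , ~-sym yp , (pd ∷ pq ∷ []) , yd , (yq ∷ []) , dq , [] , tt) (s≤s (s≤s z≤n)) refl)
        where
        pd : p # d
        pd with adn p d (λ { refl → ~#⊥ dq pq })
        ... | na e = e
        ... | ad e = ⊥-elim (sep Ad (~-sym e) dq)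
        yq : y # q
        yq with adn y q (λ { refl → ~#⊥ yp (#-sym pq) })
        ... | na e = e
        ... | ad e = ⊥-elim (sep Ay yp e)

      -- If `p` and `q` have no common neighbour in `A Z`, that set splits into a side of `p` and a
      -- side of `q`, since it has no stable triple. For the same reason `u` and `v` do not lie on
      -- one side together with `y`: the opposite end would complete a stable triple. So `y u` or
      -- `y v` crosses.
      target : ∀ {p q y u v} → A Z p → A Z q → p # q → m ~ p → m ~ q →
        A Z y → A Z u → A Z v → y ~ u → y ~ v → u # v → Target m
      target {p} {q} {y} {u} {v} Ap Aq pq mp mq Ay Au Av yu yv uv
        with any? (λ w → A? Z w ×-dec ~? w p ×-dec ~? w q)
      ... | yes (w , Aw , wp , wq) = record
        { Ap = Ap ; Aq = Aq ; Ay = Aw ; pq = pq ; mp = mp ; mq = mq ; yp = wp ; yq = wq }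
      ... | no sep′ = choose (side Ay) (side Au) (side Av)
        where
        sep : ∀ {w} → A Z w → w ~ p → w ~ q → ⊥
        sep Aw a b = sep′ (_ , Aw , a , b)
        Side : V → Set
        Side w = (w ≡ p ⊎ w ~ p) ⊎ (w ≡ q ⊎ w ~ q)
        side : ∀ {w} → A Z w → Side w
        side {w} Aw with tri w p | tri w q
        ... | eq e | _    = inj₁ (inj₁ e)
        ... | ad e | _    = inj₁ (inj₂ e)
        ... | na _ | eq e = inj₂ (inj₁ e)
        ... | na _ | ad e = inj₂ (inj₂ e)
        ... | na a | na b = ⊥-elim (triple Ap Aq Aw pq (#-sym a) (#-sym b))
        off-q : ∀ {w} → A Z w → w ≡ p ⊎ w ~ p → w # q
        off-q Aw (inj₁ refl) = pq
        off-q {w} Aw (inj₂ a) with tri w q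
        ... | eq refl = ⊥-elim (~#⊥ a (#-sym pq))
        ... | ad b    = ⊥-elim (sep Aw a b)
        ... | na b    = b
        off-p : ∀ {w} → A Z w → w ≡ q ⊎ w ~ q → w # p
        off-p Aw (inj₁ refl) = #-sym pq
        off-p {w} Aw (inj₂ a) with tri w p
        ... | eq refl = ⊥-elim (~#⊥ a pq)
        ... | ad b    = ⊥-elim (sep Aw b a)
        ... | na b    = b
        choose : Side y → Side u → Side v → Target m
        choose (inj₁ l) (inj₂ r) _        = core Ap Aq pq mp mq sep Ay Au yu l r
        choose (inj₁ l) (inj₁ _) (inj₂ r) = core Ap Aq pq mp mq sep Ay Av yv l r
        choose (inj₂ r) (inj₁ l) _        = core Aq Ap (#-sym pq) mq mp (λ Aw a b → sep Aw b a) Ay Au yu r l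
        choose (inj₂ r) (inj₂ _) (inj₁ l) = core Aq Ap (#-sym pq) mq mp (λ Aw a b → sep Aw b a) Ay Av yv r l
        choose (inj₁ _) (inj₁ a) (inj₁ b) = ⊥-elim (triple Au Av Aq uv (off-q Au a) (off-q Av b))
        choose (inj₂ _) (inj₂ a) (inj₂ b) = ⊥-elim (triple Au Av Ap uv (off-p Au a) (off-p Av b))

  anti-add : ∀ Z m {z} → Z ∋ z → m # z → (∀ {u v} → Z ∋ u → Z ∋ v → u ≡ v ⊎ CW.Walk (Z ∋_) u v) →
    ∀ {u v} → add Z m ∋ u → add Z m ∋ v → u ≡ v ⊎ CW.Walk (add Z m ∋_) u v
  anti-add Z m {z} Zz mz anti a b = go (add⁻ Z m a) (add⁻ Z m b)
    where
    up : ∀ {x y} → CW.Walk (Z ∋_) x y → CW.Walk (add Z m ∋_) x y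
    up = CW.walk-map (add-old Z m)
    from-m : ∀ {v} → Z ∋ v → CW.Walk (add Z m ∋_) m v
    from-m Zv with anti Zz Zv
    ... | inj₁ refl = CW.one (co~ mz)
    ... | inj₂ w    = CW.via (co~ mz) (add-old Z m Zz) (up w)
    go : ∀ {u v} → Z ∋ u ⊎ u ≡ m → Z ∋ v ⊎ v ≡ m → u ≡ v ⊎ CW.Walk (add Z m ∋_) u v
    go (inj₁ a) (inj₁ b) with anti a b
    ... | inj₁ e = inj₁ e
    ... | inj₂ w = inj₂ (up w)
    go (inj₁ a)    (inj₂ refl) = inj₂ (CW.walk-sym (from-m a))
    go (inj₂ refl) (inj₁ b)    = inj₂ (from-m b)
    go (inj₂ refl) (inj₂ refl) = inj₁ refl

  A-add : ∀ Z m {v} → A Z v → v ~ m → A (add Z m) v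
  A-add Z m Av vm z e with add⁻ Z m e
  ... | inj₁ a    = Av z a
  ... | inj₂ refl = vm

  grow-by : ∀ {Z m p q} (fat : Fat Z) → Z m ≡ false → ¬ A Z m → A Z p → A Z q → p # q → m ~ p → m ~ q →
    Centre (add Z m) → Fat (add Z m)
  grow-by {Z} {m} fat Zm nA Ap Aq pq mp mq ce with missing nA Zm
  ... | z , Zz , mz = record
    { Zz₀ = add-old Z m Zz₀ ; Zz₁ = add-old Z m Zz₁ ; z₀z₁ = z₀z₁
    ; Ap₀ = A-add Z m Ap (~-sym mp) ; Aq₀ = A-add Z m Aq (~-sym mq) ; p₀q₀ = pq
    ; anti = anti-add Z m Zz mz anti ; centre = ce }
    where open Fat fat

  grow : ∀ Z → Fat Z → Closed Z ⊎ ∃ λ Y → ∃ λ w → Fat Y × Z ⊆ Y × Z w ≡ false × Y w ≡ true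
  grow Z fat with any? (λ m → any? λ p → any? λ q →
    (Z m ≟ false) ×-dec ¬? (A? Z m) ×-dec A? Z p ×-dec A? Z q ×-dec (adj G p q ≟ false) ×-dec ¬? (p F.≟ q) ×-dec
    ~? m p ×-dec ~? m q)
  ... | no closed = inj₁ λ {m} {p} {q} a b c d e f g → closed (m , p , q , a , b , c , d , proj₁ e , proj₂ e , f , g)
  ... | yes (m , p , q , Zm , nA , Ap , Aq , e , d , mp , mq) with Fat.centre fat
  ...   | inZ Zy Zu Zv yu yv uv = inj₂ (add Z m , m ,
          grow-by fat Zm nA Ap Aq (e , d) mp mq
            (inZ (add-old Z m Zy) (add-old Z m Zu) (add-old Z m Zv) yu yv uv) ,
          add-old Z m , Zm , add-new Z m)
  ...   | inA Ay Au Av yu yv uv = inj₂ (place (Grow.target fat nA Ap Aq (e , d) mp mq Ay Au Av yu yv uv))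
    where
    open Fat fat
    place : Grow.Target fat m → ∃ λ Y → ∃ λ w → Fat Y × Z ⊆ Y × Z w ≡ false × Y w ≡ true
    place t with adn (Grow.Target.y t) m (λ { refl → nA (Grow.Target.Ay t) })
    -- `y`, `p` and `q` stay complete to the enlarged set, so they remain a centre.
    ... | ad ym = add Z m , m ,
        grow-by fat Zm nA T.Ap T.Aq T.pq T.mp T.mq
          (inA (A-add Z m T.Ay ym) (A-add Z m T.Ap (~-sym T.mp)) (A-add Z m T.Aq (~-sym T.mq)) T.yp T.yq T.pq) ,
        add-old Z m , Zm , add-new Z m
      where module T = Grow.Target t
    -- `y` is not complete to the enlarged set and is absorbed as well. In the complement it is
    -- joined to `m`, and it serves as the hub for `z₀ , z₁`.
    ... | na ym = Y , m ,
        record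
          { Zz₀ = up Zz₀ ; Zz₁ = up Zz₁ ; z₀z₁ = z₀z₁
          ; Ap₀ = Ap′ ; Aq₀ = Aq′ ; p₀q₀ = T.pq
          ; anti = anti-add (add Z m) T.y (add-new Z m) ym
              (let (_ , Zz , mz) = missing nA Zm in anti-add Z m Zz mz anti)
          ; centre = inZ (add-new (add Z m) T.y) (up Zz₀) (up Zz₁) (T.Ay z₀ Zz₀) (T.Ay z₁ Zz₁) z₀z₁ } ,
        up , Zm , add-old (add Z m) T.y (add-new Z m)
      where
      module T = Grow.Target t
      Y : VSet
      Y = add (add Z m) T.y
      up : Z ⊆ Y
      up a = add-old (add Z m) T.y (add-old Z m a)
      Ap′ : A Y T.p
      Ap′ = A-add (add Z m) T.y (A-add Z m T.Ap (~-sym T.mp)) (~-sym T.yp)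
      Aq′ : A Y T.q
      Aq′ = A-add (add Z m) T.y (A-add Z m T.Aq (~-sym T.mq)) (~-sym T.yq)

  closure : ∀ Z → Fat Z → ∃ λ Y → Fat Y × Closed Y
  closure = saturate {P = Fat} {Q = Closed} grow

  from-W4 : ∀ {c w x y z} → c ~ w → c ~ x → c ~ y → c ~ z → w ~ x → x ~ y → y ~ z → z ~ w → w # y → x # z →
    ∃ λ Z → Fat Z × Closed Z
  from-W4 {c} {w} {x} {y} {z} cw cx cy cz wx xy yz zw wy xz = closure Z (record
    { Zz₀ = add-old ⌈ F._≟ x ⌉ z (⌈⌉⁺ (F._≟ x) refl) ; Zz₁ = add-new ⌈ F._≟ x ⌉ z ; z₀z₁ = xz
    ; Ap₀ = complete wx (~-sym zw) ; Aq₀ = complete (~-sym xy) yz ; p₀q₀ = wy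
    ; anti = λ a b → anti (view a) (view b)
    ; centre = inA (complete cx cz) (complete wx (~-sym zw)) (complete (~-sym xy) yz) cw cy wy })
    where
    Z : VSet
    Z = add ⌈ F._≟ x ⌉ z
    view : ∀ {v} → Z ∋ v → v ≡ x ⊎ v ≡ z
    view {v} e with add⁻ ⌈ F._≟ x ⌉ z {v} e
    ... | inj₁ a = inj₁ (⌈⌉⁻ (F._≟ x) a)
    ... | inj₂ a = inj₂ a
    complete : ∀ {v} → v ~ x → v ~ z → A Z v
    complete vx vz u Zu with view {u} Zu
    ... | inj₁ refl = vx
    ... | inj₂ refl = vz
    anti : ∀ {u v} → u ≡ x ⊎ u ≡ z → v ≡ x ⊎ v ≡ z → u ≡ v ⊎ CW.Walk (Z ∋_) u v
    anti (inj₁ refl) (inj₁ refl) = inj₁ refl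
    anti (inj₂ refl) (inj₂ refl) = inj₁ refl
    anti (inj₁ refl) (inj₂ refl) = inj₂ (CW.one (co~ xz))
    anti (inj₂ refl) (inj₁ refl) = inj₂ (CW.one (co~ (#-sym xz)))

-- Vertices outside a maximal enlarged wheel

module Reduce (G : Graph) (F : Forbidden G) {Z : Sets.VSet {n G}}
  (fat : FatSquares.Fat G F Z) (closed : FatSquares.Closed G F Z) where
  open Lists G
  open Forbidden F
  open Cliques G
  open Sets {n G}
  open Walks G using (Walk; walk-trans; walk-sym; induced; segment)
  open FatSquares G F hiding (A; A?)
  open Fat fat

  A : V → Set
  A = FatSquares.A G F Z

  A? : ∀ v → Dec (A v)
  A? = FatSquares.A? G F Z

  record M (v : V) : Set where
    constructor mk
    field
      Zf : Z v ≡ false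
      nA : ¬ A v

  triple : ∀ {u v w} → A u → A v → A w → u # v → u # w → v # w → ⊥
  triple = Grow.triple fat

  A∉Z : ∀ {v} → A v → Z v ≡ false
  A∉Z {v} Av with ∋? Z v
  ... | inj₁ a = ⊥-elim (~⇒≢ (Av v a) refl)
  ... | inj₂ b = b

  M≢A : ∀ {m p} → M m → A p → m ≢ p
  M≢A Mm Ap refl = M.nA Mm Ap

  M≢Z : ∀ {m z} → M m → Z ∋ z → m ≢ z
  M≢Z Mm Zz refl = t≢f Zz (M.Zf Mm)

  adnA : ∀ {m p} → M m → A p → AdN m p
  adnA Mm Ap = adn _ _ (M≢A Mm Ap)

  adnZ : ∀ {m z} → M m → Z ∋ z → AdN m z
  adnZ Mm Zz = adn _ _ (M≢Z Mm Zz)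

  missed : ∀ {m} → M m → ∃ λ z → Z ∋ z × m # z
  missed Mm = missing (M.nA Mm) (M.Zf Mm)

  notBoth : ∀ {m p q} → M m → A p → A q → p # q → m ~ p → m # q
  notBoth Mm Ap Aq pq mp with adnA Mm Aq
  ... | na e = e
  ... | ad e = ⊥-elim (closed (M.Zf Mm) (M.nA Mm) Ap Aq pq mp e)

  oneOf : ∀ {m z p q} → M m → Z ∋ z → m ~ z → A p → A q → p # q → m ~ p ⊎ m ~ q
  oneOf Mm Zz mz Ap Aq pq with adnA Mm Ap | adnA Mm Aq
  ... | ad a | _    = inj₁ a
  ... | na _ | ad b = inj₂ b
  ... | na a | na b = ⊥-elim (claw (~-sym mz) (~-sym (Ap _ Zz)) (~-sym (Aq _ Zz)) a b pq)

  oneOfZ : ∀ {m p u v} → M m → A p → m ~ p → Z ∋ u → Z ∋ v → u # v → m ~ u ⊎ m ~ v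
  oneOfZ Mm Ap mp Zu Zv uv with adnZ Mm Zu | adnZ Mm Zv
  ... | ad a | _    = inj₁ a
  ... | na _ | ad b = inj₂ b
  ... | na a | na b = ⊥-elim (claw (~-sym mp) (Ap _ Zu) (Ap _ Zv) a b uv)

  -- Both vertices miss something in `Z`, which is connected in the complement, so the complement
  -- has an induced path from `m₁` to `m₂` through `Z`. With `p` and `q` it forms an antihole of
  -- length at least five.
  sameSide : ∀ {m₁ m₂ p q} → M m₁ → M m₂ → A p → A q → p # q → m₁ ~ m₂ → m₁ ~ p → m₂ ~ q → ⊥
  sameSide {m₁} {m₂} {p} {q} M₁ M₂ Ap Aq pq m₁m₂ m₁p m₂q with missed M₁ | missed M₂
  ... | z₁ , Zz₁ , m₁z₁ | z₂ , Zz₂ , m₂z₂ = go (CW.induced walk (~⇒≢ m₁m₂))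
    where
    walk : CW.Walk (Z ∋_) m₁ m₂
    walk with anti Zz₁ Zz₂
    ... | inj₁ refl = CW.via (co~ m₁z₁) Zz₁ (CW.one (co~ (#-sym m₂z₂)))
    ... | inj₂ w    = CW.via (co~ m₁z₁) Zz₁ (CW.walk-snoc w Zz₂ (co~ (#-sym m₂z₂)))
    m₁q : m₁ # q
    m₁q = notBoth M₁ Ap Aq pq m₁p
    m₂p : m₂ # p
    m₂p = notBoth M₂ Aq Ap (#-sym pq) m₂q
    go : (∃ λ mid → CL.IndPath (m₁ ∷ mid ++ m₂ ∷ []) × All (Z ∋_) mid) → ⊥
    go ([] , (e , _) , _) = C.~#⊥ e (co# m₁m₂)
    go (z ∷ mid , P , Zs) = antihole {p} {q} {m₁ ∷ (z ∷ mid) ++ m₂ ∷ []}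
      (co~ pq ,
       CL.lastAdj-∷ʳ (m₁ ∷ z ∷ mid) (co# (~-sym m₁p) ∷ All.map (λ e → co# (Ap _ e)) Zs) (co~ (#-sym m₂p)) ,
       co~ (#-sym m₁q) , ∷ʳ⁺ (All.map (λ e → co# (Aq _ e)) Zs) (co# (~-sym m₂q)) , P)
      (s≤s (s≤s (len mid)))
      where
      len : ∀ (xs : List V) {y} → 1 ≤ length (xs ++ y ∷ [])
      len []       = s≤s z≤n
      len (_ ∷ xs) = s≤s z≤n

  -- The path closes to a cycle through c and to one through p and q; their lengths differ in parity.
  parity-clash : ∀ {x y mid c p q} → IndPath (x ∷ mid ++ y ∷ []) → 1 ≤ length mid →
    c ~ x → c ~ y → All (c #_) mid → p ~ x → p # y → All (p #_) mid → q ~ y → q # x → All (q #_) mid → p ~ q → ⊥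
  parity-clash {x} {y} {mid} {c} {p} {q} P l cx cy cm px py pm qy qx qm pq with odd? (length mid) in o
  ... | false = oddHole {c} {x} {mid ++ y ∷ []} (cx , lastAdj-∷ʳ mid cm cy , P) (long mid l) odd1
    where
    long : ∀ (xs : List V) → 1 ≤ length xs → 2 ≤ length (xs ++ y ∷ [])
    long (_ ∷ [])     _ = s≤s (s≤s z≤n)
    long (_ ∷ _ ∷ xs) _ = s≤s (s≤s z≤n)
    odd1 : odd? (length (mid ++ y ∷ [])) ≡ true
    odd1 rewrite odd?-++ mid (y ∷ []) | o = refl
  ... | true = oddHole {q} {p} {x ∷ mid ++ y ∷ []}
      (~-sym pq , lastAdj-∷ʳ (x ∷ mid) (qx ∷ qm) qy , px , ∷ʳ⁺ pm py , P) (s≤s (long mid)) odd2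
    where
    long : ∀ (xs : List V) → 1 ≤ length (xs ++ y ∷ [])
    long []       = s≤s z≤n
    long (_ ∷ xs) = s≤s z≤n
    odd2 : not (odd? (length (mid ++ y ∷ []))) ≡ true
    odd2 rewrite odd?-++ mid (y ∷ []) | o = refl

  -- {c , d} is a strong stable set of the graph induced on A, up to vertices adjacent to all of A.
  record Pair (c d : V) : Set where
    field
      Ac  : A c
      Ad  : A d
      cd  : c # d
      sep : ∀ {u v} → A u → A v → u # c → v # d → u ~ v → ⊥

  swap : ∀ {c d} → Pair c d → Pair d c
  swap P = record { Ac = Ad ; Ad = Ac ; cd = #-sym cd ; sep = λ a b e f g → sep b a f e (~-sym g) }
    where open Pair P

  record Connected (N : VSet) : Set where
    field
      inM   : ∀ {v} → N ∋ v → M v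
      {root} : V
      Nroot : N ∋ root
      reach : ∀ {v} → N ∋ v → root ≡ v ⊎ Walk (N ∋_) root v

    link : ∀ {u v} → N ∋ u → N ∋ v → u ≡ v ⊎ Walk (N ∋_) u v
    link Nu Nv with reach Nu | reach Nv
    ... | inj₁ refl | b         = b
    ... | inj₂ w    | inj₁ refl = inj₂ (walk-sym w)
    ... | inj₂ w    | inj₂ w′   = inj₂ (walk-trans (walk-sym w) Nroot w′)

  module Component {N : VSet} (conn : Connected N) where
    open Connected conn

    module Typed {c d} (pair : Pair c d) where
      open Pair pair

      -- By a claw at the vertex of `Z`, a neighbour there forces adjacency to `c` or `d`. In the
      -- same way a neighbour in `A` forces one in `Z`, so `c` and `d` detect every contact.
      untyped-Z : ∀ {u} → N ∋ u → ¬ u ~ c → ¬ u ~ d → ∀ {z} → Z ∋ z → z # u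
      untyped-Z Nu nc nd Zz with adnZ (inM Nu) Zz
      ... | na e = #-sym e
      ... | ad e = ⊥-elim ([ nc , nd ]′ (oneOf (inM Nu) Zz e Ac Ad cd))

      untyped-A : ∀ {u} → N ∋ u → ¬ u ~ c → ¬ u ~ d → ∀ {p} → A p → p # u
      untyped-A Nu nc nd Ap with adnA (inM Nu) Ap
      ... | na e = #-sym e
      ... | ad e with oneOfZ (inM Nu) Ap e Zz₀ Zz₁ z₀z₁
      ...   | inj₁ a = ⊥-elim (~#⊥ (~-sym a) (untyped-Z Nu nc nd Zz₀))
      ...   | inj₂ a = ⊥-elim (~#⊥ (~-sym a) (untyped-Z Nu nc nd Zz₁))

      -- Take an induced path in `N` from a neighbour `μ` of `c` to a neighbour `ν` of `d` whose
      -- interior misses both, hence misses `A` and `Z`. If the ends have no common neighbour in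
      -- `Z`, its parity decides between an odd hole and an odd prism. If they have one,
      -- `parity-clash` makes them agree on all of `Z`, and the centre refutes this.
      sameType : ∀ {μ₀ ν₀} → N ∋ μ₀ → N ∋ ν₀ → μ₀ ~ c → ν₀ ~ d → ⊥
      sameType Nμ₀ Nν₀ μ₀c ν₀d with link Nμ₀ Nν₀
      ... | inj₁ refl = ~#⊥ ν₀d (notBoth (inM Nμ₀) Ac Ad cd μ₀c)
      ... | inj₂ walk with segment (λ v → ~? v c) (λ v → ~? v d) walk Nμ₀ Nν₀ μ₀c ν₀d
      ...   | μ , ν , Nμ , Nν , μc , νd , w = go (induced w (λ { refl → ~#⊥ νd (notBoth (inM Nμ) Ac Ad cd μc) }))
        where
        μd : μ # d
        μd = notBoth (inM Nμ) Ac Ad cd μc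
        νc : ν # c
        νc = notBoth (inM Nν) Ad Ac (#-sym cd) νd
        Inner : V → Set
        Inner v = N ∋ v × ¬ v ~ c × ¬ v ~ d
        go : (∃ λ mid → IndPath (μ ∷ mid ++ ν ∷ []) × All Inner mid) → ⊥
        go ([] , (μν , _) , _) = sameSide (inM Nμ) (inM Nν) Ac Ad cd μν μc νd
        go (mid@(_ ∷ _) , P , us) with any? (λ y → (Z y ≟ true) ×-dec ~? y μ ×-dec ~? y ν)
        ... | no apart = [ far Zz₀ Zz₁ z₀z₁ , far Zz₁ Zz₀ (#-sym z₀z₁) ]′ (oneOfZ (inM Nμ) Ac μc Zz₀ Zz₁ z₀z₁)
          where
          farZ : ∀ {z} → Z ∋ z → All (z #_) mid
          farZ Zz = All.map (λ { (a , b , e) → untyped-Z a b e Zz }) us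
          farA : ∀ {p} → A p → All (p #_) mid
          farA Ap = All.map (λ { (a , b , e) → untyped-A a b e Ap }) us
          far : ∀ {u v} → Z ∋ u → Z ∋ v → u # v → μ ~ u → ⊥
          far {u} {v} Zu Zv uv μu = finish (odd? (length mid)) refl
            where
            νu : ν # u
            νu with adnZ (inM Nν) Zu
            ... | na e = e
            ... | ad e = ⊥-elim (apart (u , Zu , ~-sym μu , ~-sym e))
            νv : ν ~ v
            νv with oneOfZ (inM Nν) Ad νd Zu Zv uv
            ... | inj₁ e = ⊥-elim (~#⊥ e νu)
            ... | inj₂ e = e
            μv : μ # v
            μv with adnZ (inM Nμ) Zv
            ... | na e = e
            ... | ad e = ⊥-elim (apart (v , Zv , ~-sym e , ~-sym νv))
            finish : ∀ b → odd? (length mid) ≡ b → ⊥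
            finish true o = oddHole {v} {c} {μ ∷ mid ++ ν ∷ []}
              (~-sym (Ac v Zv) , lastAdj-∷ʳ (μ ∷ mid) (#-sym μv ∷ farZ Zv) (~-sym νv) ,
               ~-sym μc , ∷ʳ⁺ (farA Ac) (#-sym νc) , P) (s≤s (s≤s z≤n)) odd2
              where
              odd2 : not (odd? (length (mid ++ ν ∷ []))) ≡ true
              odd2 rewrite odd?-++ mid (ν ∷ []) | o = refl
            -- The triangles are `μ , c , u` and `ν , v , d`, joined by the path and the edges `c v`
            -- and `u d`.
            finish false o = oddPrism {μ} {mid ++ ν ∷ []} {c} {v ∷ []} {u} {d ∷ []}
              P (Ac v Zv , [] , tt) (~-sym (Ad u Zu) , [] , tt)
              (μc , (μv ∷ []) , ∷ʳ⁺ (All.map #-sym (farA Ac)) νc ,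
                lastLast-∷ʳ mid ν (v ∷ []) (All.map (λ e → #-sym e ∷ []) (farZ Zv)) νv)
              (μu , (μd ∷ []) , ∷ʳ⁺ (All.map #-sym (farZ Zu)) νu ,
                lastLast-∷ʳ mid ν (d ∷ []) (All.map (λ e → #-sym e ∷ []) (farA Ad)) νd)
              (Ac u Zu , (cd ∷ []) , (#-sym uv ∷ []) , ~-sym (Ad v Zv))
              odd1 refl refl
              where
              odd1 : odd? (length (mid ++ ν ∷ [])) ≡ true
              odd1 rewrite odd?-++ mid (ν ∷ []) | o = refl
        ... | yes (y , Zy , yμ , yν) with missed (inM Nμ)
        ...   | e , Ze , μe = split centre
          where
          farZ : ∀ {z} → Z ∋ z → All (z #_) mid
          farZ Zz = All.map (λ { (a , b , e) → untyped-Z a b e Zz }) us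
          farA : ∀ {p} → A p → All (p #_) mid
          farA Ap = All.map (λ { (a , b , e) → untyped-A a b e Ap }) us
          clash : ∀ {p q} → p ~ μ → p # ν → All (p #_) mid → q ~ ν → q # μ → All (q #_) mid → p ~ q → ⊥
          clash = parity-clash P (s≤s z≤n) yμ yν (farZ Zy)
          same→ : ∀ {z} → Z ∋ z → z # μ → z # ν
          same→ Zz zμ with adnZ (inM Nν) Zz
          ... | na a = #-sym a
          ... | ad a = ⊥-elim (clash (~-sym μc) (#-sym νc) (farA Ac) (~-sym a) zμ (farZ Zz) (Ac _ Zz))
          same← : ∀ {z} → Z ∋ z → z ~ μ → z ~ ν
          same← Zz zμ with adnZ (inM Nν) Zz
          ... | ad a = ~-sym a
          ... | na a = ⊥-elim (clash zμ (#-sym a) (farZ Zz) (~-sym νd) (#-sym μd) (farA Ad) (~-sym (Ad _ Zz)))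
          μν : μ # ν
          μν with adn μ ν (λ { refl → ~#⊥ νd μd })
          ... | na a = a
          ... | ad a = ⊥-elim (sameSide (inM Nμ) (inM Nν) Ac Ad cd a μc νd)
          -- Since `μ` and `ν` agree on `Z`, an edge `u v` would make `μ , ν , v` a claw at `u`.
          sides : ∀ {u v} → Z ∋ u → Z ∋ v → u ~ μ → v # μ → u # v
          sides {u} {v} Zu Zv uμ vμ with adn u v (λ { refl → ~#⊥ uμ vμ })
          ... | na a = a
          ... | ad a = ⊥-elim (claw uμ (same← Zu uμ) a μν (#-sym vμ) (#-sym (same→ Zv vμ)))
          μy : μ ~ y
          μy = ~-sym yμ
          νy : ν ~ y
          νy = ~-sym yν
          split : Centre Z → ⊥
          split (inZ {w} {u} {v} Zw Zu Zv wu wv uv) = go₁ (adnZ (inM Nμ) Zu) (adnZ (inM Nμ) Zv) (adnZ (inM Nμ) Zw)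
            where
            go₁ : AdN μ u → AdN μ v → AdN μ w → ⊥
            go₁ (ad a) (ad b) _      = claw (Ac e Ze) (Ac u Zu) (Ac v Zv)
              (#-sym (sides Zu Ze (~-sym a) (#-sym μe))) (#-sym (sides Zv Ze (~-sym b) (#-sym μe))) uv
            go₁ (na a) (na b) _      = claw (~-sym μc) (Ac u Zu) (Ac v Zv) a b uv
            go₁ (ad a) (na b) (ad f) = ~#⊥ wv (sides Zw Zv (~-sym f) (#-sym b))
            go₁ (ad a) (na b) (na f) = ~#⊥ (~-sym wu) (sides Zu Zw (~-sym a) (#-sym f))
            go₁ (na a) (ad b) (ad f) = ~#⊥ wu (sides Zw Zu (~-sym f) (#-sym a))
            go₁ (na a) (ad b) (na f) = ~#⊥ (~-sym wv) (sides Zv Zw (~-sym b) (#-sym f))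
          split (inA {x} {p} {q} Ax Ap Aq xp xq pq) =
            go₂ (oneOf (inM Nμ) Zy μy Ap Aq pq) (oneOf (inM Nν) Zy νy Ap Aq pq)
            where
            eν : e # ν
            eν = same→ Ze (#-sym μe)
            both : ∀ {r} → A r → r ~ μ → r ~ ν → ⊥
            both Ar rμ rν = claw rμ rν (Ar e Ze) μν μe (#-sym eν)
            mixed : ∀ {p q} → A p → A q → p # q → x ~ p → x ~ q → μ ~ p → ν ~ q → ⊥
            mixed {p} {q} Ap Aq pq xp xq μp νq with adnA (inM Nμ) Ax | adnA (inM Nν) Ax
            ... | ad a | ad b = both Ax (~-sym a) (~-sym b)
            ... | na a | na b = claw yμ yν (~-sym (Ax y Zy)) μν a b
            ... | ad a | na b = clash (~-sym a) (#-sym b) (farA Ax) (~-sym νq) (#-sym (notBoth (inM Nμ) Ap Aq pq μp)) (farA Aq) xq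
            ... | na a | ad b = clash (~-sym μp) (#-sym (notBoth (inM Nν) Aq Ap (#-sym pq) νq)) (farA Ap) (~-sym b) (#-sym a) (farA Ax) (~-sym xp)
            go₂ : μ ~ p ⊎ μ ~ q → ν ~ p ⊎ ν ~ q → ⊥
            go₂ (inj₁ a) (inj₁ b) = both Ap (~-sym a) (~-sym b)
            go₂ (inj₂ a) (inj₂ b) = both Aq (~-sym a) (~-sym b)
            go₂ (inj₁ a) (inj₂ b) = mixed Ap Aq pq xp xq a b
            go₂ (inj₂ a) (inj₁ b) = mixed Aq Ap (#-sym pq) xq xp a b

      -- By claws, each vertex of `Z` sees exactly one of `m₀` and `m₁`, and every vertex of `N`
      -- adjacent to `w₀` or `w₁` follows one of them on all of `Z`. An induced path in `N` between
      -- the two kinds gives a five-hole through `d` if it is one edge. Otherwise `c` and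
      -- `parity-clash` forbid the edges that connect the two parts, and no room is left for the
      -- centre.
      twoPlaces : (∀ {u} → N ∋ u → u ~ d → ⊥) → ∀ {m₀ m₁ w₀ w₁} → N ∋ m₀ → N ∋ m₁ → m₀ ~ c → m₁ ~ c →
        Z ∋ w₀ → Z ∋ w₁ → w₀ # w₁ → m₀ ~ w₀ → m₀ # w₁ → m₁ ~ w₁ → m₁ # w₀ → m₀ # m₁ → ⊥
      twoPlaces no-d {m₀} {m₁} {w₀} {w₁} N₀ N₁ m₀c m₁c Zw₀ Zw₁ w₀w₁ m₀w₀ m₀w₁ m₁w₁ m₁w₀ m₀m₁
        with link N₀ N₁
      ... | inj₁ refl = ~#⊥ m₀w₀ m₁w₀
      ... | inj₂ walk with segment (λ v → ~? v w₀) (λ v → ~? v w₁) walk N₀ N₁ m₀w₀ m₁w₁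
      ...   | μ , ν , Nμ , Nν , μw₀ , νw₁ , w = go (induced w (λ { refl → ~#⊥ νw₁ (proj₂ (class₀ Nμ μw₀) Zw₁ (~-sym m₁w₁)) }))
        where
        typed : ∀ {u z} → N ∋ u → Z ∋ z → u ~ z → u ~ c
        typed Nu Zz uz with oneOf (inM Nu) Zz uz Ac Ad cd
        ... | inj₁ a = a
        ... | inj₂ a = ⊥-elim (no-d Nu a)
        off-d : ∀ {u} → N ∋ u → u # d
        off-d Nu with adnA (inM Nu) Ad
        ... | na e = e
        ... | ad e = ⊥-elim (no-d Nu e)
        exclusive : ∀ {u v z} → N ∋ u → N ∋ v → u # v → Z ∋ z → z ~ u → z # v
        exclusive Nu Nv uv Zz zu with adnZ (inM Nv) Zz
        ... | na e = #-sym e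
        ... | ad e = ⊥-elim (claw zu (~-sym e) (~-sym (Ad _ Zz)) uv (off-d Nu) (off-d Nv))
        classify : ∀ {z} → Z ∋ z → (z ~ m₀ × z # m₁) ⊎ (z ~ m₁ × z # m₀)
        classify Zz with adnZ (inM N₀) Zz | adnZ (inM N₁) Zz
        ... | ad a | _    = inj₁ (~-sym a , exclusive N₀ N₁ m₀m₁ Zz (~-sym a))
        ... | na _ | ad b = inj₂ (~-sym b , exclusive N₁ N₀ (#-sym m₀m₁) Zz (~-sym b))
        ... | na a | na b = ⊥-elim (claw (~-sym m₀c) (~-sym m₁c) (Ac _ Zz) m₀m₁ a b)
        co-nbr : ∀ {z u} → Z ∋ z → Z ∋ u → z ≢ u → ∃ λ z* → Z ∋ z* × z* # z
        co-nbr Zz Zu d with anti Zz Zu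
        ... | inj₁ e = ⊥-elim (d e)
        ... | inj₂ (CW.one a) = _ , Zu , #-sym (co⁻ a)
          where
          co⁻ : ∀ {x y} → x C.~ y → x # y
          co⁻ a = co-Rel⁻ G (C.~⇒Rel a)
        ... | inj₂ (CW.via a Zw _) = _ , Zw , #-sym (co⁻ a)
          where
          co⁻ : ∀ {x y} → x C.~ y → x # y
          co⁻ a = co-Rel⁻ G (C.~⇒Rel a)
        another : ∀ {z} → Z ∋ z → ∃ λ z* → Z ∋ z* × z* # z
        another {z} Zz with z F.≟ w₀
        ... | yes refl = w₁ , Zw₁ , #-sym w₀w₁
        ... | no d     = co-nbr Zz Zw₀ d
        -- The five-hole is `m , z , d , z* , μ`, where `z*` is a non-neighbour of `z` in `Z` and
        -- hence sees `m′` and not `m`.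
        pentagon : ∀ {m m′ μ z} → N ∋ m → N ∋ m′ → m ~ c → m′ ~ c → N ∋ μ → μ ~ c → μ ~ m → μ # z → Z ∋ z →
          z ~ m → z # m′ → m # m′ → ⊥
        pentagon {m} {m′} {μ} {z} Nm Nm′ mc m′c Nμ μc μm μz Zz zm zm′ mm′ with another Zz
        ... | z* , Zz* , z*z = oddHole {m} {z} {d ∷ z* ∷ μ ∷ []}
            (~-sym zm , (off-d Nm , #-sym (exclusive Nm′ Nm (#-sym mm′) Zz* z*m′) , ~-sym μm) ,
             ~-sym (Ad z Zz) , (#-sym z*z ∷ #-sym μz ∷ []) , Ad z* Zz* , (#-sym (off-d Nμ) ∷ []) , ~-sym μz* , [] , tt)
            (s≤s (s≤s z≤n)) refl
          where
          z*m′ : z* ~ m′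
          z*m′ with oneOfZ (inM Nm′) Ac m′c Zz Zz* (#-sym z*z)
          ... | inj₁ e = ⊥-elim (~#⊥ (~-sym e) zm′)
          ... | inj₂ e = ~-sym e
          μz* : μ ~ z*
          μz* with oneOfZ (inM Nμ) Ac μc Zz Zz* (#-sym z*z)
          ... | inj₁ e = ⊥-elim (~#⊥ e μz)
          ... | inj₂ e = e
        not-both : ∀ {μ} → N ∋ μ → μ ~ c → μ ~ m₀ → μ ~ m₁ → ⊥
        not-both {μ} Nμ μc a b with missed (inM Nμ)
        ... | z , Zz , μz with classify Zz
        ...   | inj₁ (zm₀ , zm₁) = pentagon N₀ N₁ m₀c m₁c Nμ μc a μz Zz zm₀ zm₁ m₀m₁
        ...   | inj₂ (zm₁ , zm₀) = pentagon N₁ N₀ m₁c m₀c Nμ μc b μz Zz zm₁ zm₀ (#-sym m₀m₁)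
        class : ∀ {m m′ μ} → N ∋ m → N ∋ m′ → m ~ c → m′ ~ c → m # m′ → N ∋ μ → μ ~ c → μ # m′ →
          (∀ {z} → Z ∋ z → z ~ m → z ~ μ) × (∀ {z} → Z ∋ z → z ~ m′ → μ # z)
        class {m} {m′} {μ} Nm Nm′ mc m′c mm′ Nμ μc μm′ = near , λ Zz zm′ → #-sym (exclusive Nm′ Nμ (#-sym μm′) Zz zm′)
          where
          near : ∀ {z} → Z ∋ z → z ~ m → z ~ μ
          near Zz zm with adnZ (inM Nμ) Zz
          ... | ad e = ~-sym e
          ... | na e = ⊥-elim (claw (~-sym μc) (~-sym m′c) (Ac _ Zz) μm′ e (#-sym (exclusive Nm Nm′ mm′ Zz zm)))
        class₀ : ∀ {μ} → N ∋ μ → μ ~ w₀ → (∀ {z} → Z ∋ z → z ~ m₀ → z ~ μ) × (∀ {z} → Z ∋ z → z ~ m₁ → μ # z)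
        class₀ {μ} Nμ μw with tri μ m₁ | tri μ m₀
        ... | na e    | _       = class N₀ N₁ m₀c m₁c m₀m₁ Nμ (typed Nμ Zw₀ μw) e
        ... | eq refl | _       = ⊥-elim (~#⊥ μw m₁w₀)
        ... | ad e    | ad f    = ⊥-elim (not-both Nμ (typed Nμ Zw₀ μw) f e)
        ... | ad e    | eq refl = ⊥-elim (~#⊥ e m₀m₁)
        ... | ad e    | na f    = ⊥-elim (~#⊥ μw (proj₂ (class N₁ N₀ m₁c m₀c (#-sym m₀m₁) Nμ (typed Nμ Zw₀ μw) f) Zw₀ (~-sym m₀w₀)))
        class₁ : ∀ {μ} → N ∋ μ → μ ~ w₁ → (∀ {z} → Z ∋ z → z ~ m₁ → z ~ μ) × (∀ {z} → Z ∋ z → z ~ m₀ → μ # z)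
        class₁ {μ} Nμ μw with tri μ m₀ | tri μ m₁
        ... | na e    | _       = class N₁ N₀ m₁c m₀c (#-sym m₀m₁) Nμ (typed Nμ Zw₁ μw) e
        ... | eq refl | _       = ⊥-elim (~#⊥ μw m₀w₁)
        ... | ad e    | ad f    = ⊥-elim (not-both Nμ (typed Nμ Zw₁ μw) e f)
        ... | ad e    | eq refl = ⊥-elim (~#⊥ e (#-sym m₀m₁))
        ... | ad e    | na f    = ⊥-elim (~#⊥ μw (proj₂ (class N₀ N₁ m₀c m₁c m₀m₁ Nμ (typed Nμ Zw₁ μw) f) Zw₁ (~-sym m₁w₁)))
        Inner : V → Set
        Inner v = N ∋ v × ¬ v ~ w₀ × ¬ v ~ w₁
        go : (∃ λ mid → IndPath (μ ∷ mid ++ ν ∷ []) × All Inner mid) → ⊥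
        go ([] , (μν , _) , _) = oddHole {μ} {ν} {w₁ ∷ d ∷ w₀ ∷ []}
          (μν , (proj₂ (class₀ Nμ μw₀) Zw₁ (~-sym m₁w₁) , off-d Nμ , μw₀) ,
           νw₁ , (off-d Nν ∷ proj₂ (class₁ Nν νw₁) Zw₀ (~-sym m₀w₀) ∷ []) , ~-sym (Ad w₁ Zw₁) , (#-sym w₀w₁ ∷ []) , Ad w₀ Zw₀ , [] , tt)
          (s≤s (s≤s z≤n)) refl
        go (mid@(_ ∷ _) , P , us) = split centre
          where
          free : ∀ {v} → Inner v → ¬ v ~ c
          free (Nv , a , b) vc = [ a , b ]′ (oneOfZ (inM Nv) Ac vc Zw₀ Zw₁ w₀w₁)
          farZ : ∀ {z} → Z ∋ z → All (z #_) mid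
          farZ Zz = All.map (λ i → untyped-Z (proj₁ i) (free i) (no-d (proj₁ i)) Zz) us
          farA : ∀ {p} → A p → All (p #_) mid
          farA Ap = All.map (λ i → untyped-A (proj₁ i) (free i) (no-d (proj₁ i)) Ap) us
          μc : μ ~ c
          μc = typed Nμ Zw₀ μw₀
          νc : ν ~ c
          νc = typed Nν Zw₁ νw₁
          clash : ∀ {p q} → p ~ μ → p # ν → All (p #_) mid → q ~ ν → q # μ → All (q #_) mid → p ~ q → ⊥
          clash = parity-clash P (s≤s z≤n) (~-sym μc) (~-sym νc) (farA Ac)
          Side₀ Side₁ : V → Set
          Side₀ z = z ~ μ × z # ν
          Side₁ z = z ~ ν × z # μ
          side : ∀ {z} → Z ∋ z → Side₀ z ⊎ Side₁ z
          side Zz with classify Zz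
          ... | inj₁ (a , _) = inj₁ (proj₁ (class₀ Nμ μw₀) Zz a , #-sym (proj₂ (class₁ Nν νw₁) Zz a))
          ... | inj₂ (a , _) = inj₂ (proj₁ (class₁ Nν νw₁) Zz a , #-sym (proj₂ (class₀ Nμ μw₀) Zz a))
          rung : ∀ {u v} → Z ∋ u → Z ∋ v → u ~ v → Side₀ u → Side₁ v → ⊥
          rung Zu Zv uv (a , b) (e , f) = clash a b (farZ Zu) e f (farZ Zv) uv
          μν : μ # ν
          μν = far P
            where
            far : ∀ {x xs} → IndPath (μ ∷ (x ∷ xs) ++ ν ∷ []) → μ # ν
            far {xs = xs} (_ , f , _) = All.head (++⁻ʳ xs f)
          split : Centre Z → ⊥
          split (inZ {w} {u} {v} Zw Zu Zv wu wv uv) = go₁ (side Zu) (side Zv) (side Zw)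
            where
            go₁ : Side₀ u ⊎ Side₁ u → Side₀ v ⊎ Side₁ v → Side₀ w ⊎ Side₁ w → ⊥
            go₁ (inj₁ a) (inj₂ b) (inj₁ f) = rung Zw Zv wv f b
            go₁ (inj₁ a) (inj₂ b) (inj₂ f) = rung Zu Zw (~-sym wu) a f
            go₁ (inj₂ a) (inj₁ b) (inj₁ f) = rung Zw Zu wu f a
            go₁ (inj₂ a) (inj₁ b) (inj₂ f) = rung Zv Zw (~-sym wv) b f
            go₁ (inj₁ a) (inj₁ b) _        = claw (~-sym νc) (Ac u Zu) (Ac v Zv) (#-sym (proj₂ a)) (#-sym (proj₂ b)) uv
            go₁ (inj₂ a) (inj₂ b) _        = claw (~-sym μc) (Ac u Zu) (Ac v Zv) (#-sym (proj₂ a)) (#-sym (proj₂ b)) uv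
          split (inA {x} {p} {q} Ax Ap Aq xp xq pq) =
            go₂ (oneOf (inM Nμ) Zw₀ μw₀ Ap Aq pq) (oneOf (inM Nν) Zw₁ νw₁ Ap Aq pq)
            where
            left : ∀ {r} → A r → r ~ μ → r # ν → ⊥
            left Ar rμ rν = clash rμ rν (farA Ar) (~-sym νw₁) (#-sym (proj₂ (class₀ Nμ μw₀) Zw₁ (~-sym m₁w₁))) (farZ Zw₁) (Ar w₁ Zw₁)
            right : ∀ {r} → A r → r ~ ν → r # μ → ⊥
            right Ar rν rμ = clash (~-sym μw₀) (#-sym (proj₂ (class₁ Nν νw₁) Zw₀ (~-sym m₀w₀))) (farZ Zw₀) rν rμ (farA Ar) (~-sym (Ar w₀ Zw₀))
            both : ∀ {p q} → A p → A q → p # q → x ~ p → x ~ q → μ ~ p → ν ~ p → ⊥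
            both Ap Aq pq xp xq μp νp with adnA (inM Nμ) Ax | adnA (inM Nν) Ax
            ... | ad a | ad b = claw (~-sym a) (~-sym b) xq μν (notBoth (inM Nμ) Ap Aq pq μp) (notBoth (inM Nν) Ap Aq pq νp)
            ... | ad a | na b = left Ax (~-sym a) (#-sym b)
            ... | na a | ad b = right Ax (~-sym b) (#-sym a)
            ... | na a | na b = claw (~-sym μp) (~-sym νp) (~-sym xp) μν a b
            go₂ : μ ~ p ⊎ μ ~ q → ν ~ p ⊎ ν ~ q → ⊥
            go₂ (inj₁ a) (inj₁ b) = both Ap Aq pq xp xq a b
            go₂ (inj₂ a) (inj₂ b) = both Aq Ap (#-sym pq) xq xp a b
            go₂ (inj₁ a) (inj₂ b) = left Ap (~-sym a) (#-sym (notBoth (inM Nν) Aq Ap (#-sym pq) b))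
            go₂ (inj₂ a) (inj₁ b) = left Aq (~-sym a) (#-sym (notBoth (inM Nν) Ap Aq pq b))

-- Assembling a strong stable set around the wheel

module Assemble (G : Graph) (F : Forbidden G) {Z : Sets.VSet {n G}}
  (fat : FatSquares.Fat G F Z) (closed : FatSquares.Closed G F Z)
  (ih : ∀ U → (∃ λ v → U v ≡ true) → (∃ λ w → U w ≡ false) → StrongSets.StrongIn G U) where
  open Lists G
  open Forbidden F
  open Cliques G
  open Sets {n G}
  open Walks G using (Walk; one; walk-map; walk-snoc)
  open StrongSets G
  open FatSquares G F using (Fat; inZ; inA)
  open Fat fat
  open Reduce G F fat closed

  -- `U` keeps the members of `A` with a non-neighbour in `A`. The non-neighbour `e` of `c` must be
  -- hit by a second member `d` of the strong set, and a third member would complete a stable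
  -- triple.
  strongPair : ∃ λ c → ∃ λ d → Pair c d
  strongPair = go (hit-edge T p₀∈ p₀∈ (inj₁ refl))
    where
    P? : ∀ v → Dec (A v × ∃ λ w → A w × w # v)
    P? v = A? v ×-dec any? λ w → A? w ×-dec (adj G w v ≟ false) ×-dec ¬? (w F.≟ v)
    U : VSet
    U = ⌈ P? ⌉
    p₀∈ : U ∋ p₀
    p₀∈ = ⌈⌉⁺ P? (Ap₀ , q₀ , Aq₀ , #-sym p₀q₀)
    T : StrongIn U
    T = ih U (p₀ , p₀∈) (z₀ , ⌈⌉-no P? λ x → t≢f Zz₀ (A∉Z (proj₁ x)))
    open StrongIn T
    go : (∃ λ h → S ∋ h × (h ≡ p₀ ⊎ h ~ p₀) × (h ≡ p₀ ⊎ h ~ p₀)) → ∃ λ c → ∃ λ d → Pair c d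
    go (c , Sc , _) with ⌈⌉⁻ P? (sub Sc)
    ... | Ac , e , Ae , ec = go′ (hit-edge T e∈ e∈ (inj₁ refl))
      where
      e∈ : U ∋ e
      e∈ = ⌈⌉⁺ P? (Ae , c , Ac , #-sym ec)
      go′ : (∃ λ h → S ∋ h × (h ≡ e ⊎ h ~ e) × (h ≡ e ⊎ h ~ e)) → ∃ λ c → ∃ λ d → Pair c d
      go′ (d , Sd , de , _) = c , d , record { Ac = Ac ; Ad = Ad ; cd = cd ; sep = sep }
        where
        miss : ∀ {x y} → x ≡ y ⊎ x ~ y → y # x → ⊥
        miss (inj₁ refl) b = proj₂ b refl
        miss (inj₂ a)    b = ~#⊥ (~-sym a) b
        Ad : A d
        Ad = proj₁ (⌈⌉⁻ P? (sub Sd))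
        c≢d : c ≢ d
        c≢d refl = miss de ec
        cd : c # d
        cd with adn c d c≢d
        ... | na a = a
        ... | ad a = ⊥-elim (stable Sc Sd a)
        only : ∀ {h} → S ∋ h → h ≡ c ⊎ h ≡ d
        only {h} Sh with tri h c | tri h d
        ... | eq a | _    = inj₁ a
        ... | ad a | _    = ⊥-elim (stable Sh Sc a)
        ... | na _ | eq b = inj₂ b
        ... | na _ | ad b = ⊥-elim (stable Sh Sd b)
        ... | na a | na b = ⊥-elim (triple (proj₁ (⌈⌉⁻ P? (sub Sh))) Ac Ad a b cd)
        sep : ∀ {u v} → A u → A v → u # c → v # d → u ~ v → ⊥
        sep {u} {v} Au Av uc vd uv =
          clash (hit-edge T (⌈⌉⁺ P? (Au , c , Ac , #-sym uc)) (⌈⌉⁺ P? (Av , d , Ad , #-sym vd)) (inj₂ uv))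
          where
          clash : (∃ λ h → S ∋ h × (h ≡ u ⊎ h ~ u) × (h ≡ v ⊎ h ~ v)) → ⊥
          clash (h , Sh , hu , hv) with only Sh
          ... | inj₁ refl = miss hu uc
          ... | inj₂ refl = miss hv vd

  module _ {c d : V} (pair : Pair c d) where

    -- `off` allows `c` and `d` to be added later. Maximal cliques reaching into `A` or `Z` are left
    -- to that pair.
    record Good (N : VSet) : Set where
      field
        T      : VSet
        sub    : T ⊆ N
        stable : Stable T
        off    : ∀ {x} → T ∋ x → ¬ x ~ c × ¬ x ~ d
        hits   : ∀ L → Max L → L ⊆ N → ∃ λ x → T ∋ x × L ∋ x

  -- A strong stable set of the graph induced on N together with c , d and a nonadjacent pair u , v of Z.
  data Place (c d u v : V) (N : VSet) (x : V) : Set where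
    isc : x ≡ c → Place c d u v N x
    isd : x ≡ d → Place c d u v N x
    isu : x ≡ u → Place c d u v N x
    isv : x ≡ v → Place c d u v N x
    inN : N ∋ x → Place c d u v N x

  record Trace (c d u v : V) (N : VSet) : Set where
    field
      S      : VSet
      place  : ∀ {x} → S ∋ x → Place c d u v N x
      stable : Stable S
      edge   : ∀ {x y} → Place c d u v N x → Place c d u v N y → x ~ y →
               ∃ λ h → S ∋ h × (h ≡ x ⊎ h ~ x) × (h ≡ y ⊎ h ~ y)
      hits   : ∀ L → Max L → L ⊆ N → ∃ λ x → S ∋ x × L ∋ x

  swap-cd : ∀ {c d u v N x} → Place c d u v N x → Place d c u v N x
  swap-cd (isc e) = isd e
  swap-cd (isd e) = isc e
  swap-cd (isu e) = isu e
  swap-cd (isv e) = isv e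
  swap-cd (inN e) = inN e

  swap-uv : ∀ {c d u v N x} → Place c d u v N x → Place c d v u N x
  swap-uv (isc e) = isc e
  swap-uv (isd e) = isd e
  swap-uv (isu e) = isv e
  swap-uv (isv e) = isu e
  swap-uv (inN e) = inN e

  trace-cd : ∀ {c d u v N} → Trace c d u v N → Trace d c u v N
  trace-cd t = record { S = S ; place = λ e → swap-cd (place e) ; stable = stable
                      ; edge = λ a b → edge (swap-cd a) (swap-cd b) ; hits = hits }
    where open Trace t

  trace-uv : ∀ {c d u v N} → Trace c d u v N → Trace c d v u N
  trace-uv t = record { S = S ; place = λ e → swap-uv (place e) ; stable = stable
                      ; edge = λ a b → edge (swap-uv a) (swap-uv b) ; hits = hits }
    where open Trace t

  -- The vertex `w` left over makes the set proper, so that `ih` applies to it.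
  trace : ∀ {c d u v N} → (∃ λ w → ¬ Place c d u v N w) → Trace c d u v N
  trace {c} {d} {u} {v} {N} (w , out) = record
    { S = S ; place = λ e → ⌈⌉⁻ P? (sub e) ; stable = stable
    ; edge = λ a b e → hit-edge T (⌈⌉⁺ P? a) (⌈⌉⁺ P? b) (inj₂ e)
    ; hits = λ L m L⊆ → hits L (record
        { sub = λ e → ⌈⌉⁺ P? (inN (L⊆ e)) ; clq = MaxIn.clq m ; max = λ x _ → outside m x }) }
    where
    P? : ∀ x → Dec (Place c d u v N x)
    P? x with x F.≟ c | x F.≟ d | x F.≟ u | x F.≟ v | ∋? N x
    ... | yes e | _     | _     | _     | _      = yes (isc e)
    ... | no _  | yes e | _     | _     | _      = yes (isd e)
    ... | no _  | no _  | yes e | _     | _      = yes (isu e)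
    ... | no _  | no _  | no _  | yes e | _      = yes (isv e)
    ... | no _  | no _  | no _  | no _  | inj₁ e = yes (inN e)
    ... | no a  | no b  | no x  | no y  | inj₂ e = no λ where
      (isc p) → a p
      (isd p) → b p
      (isu p) → x p
      (isv p) → y p
      (inN p) → t≢f p e
    T : StrongIn ⌈ P? ⌉
    T = ih ⌈ P? ⌉ (c , ⌈⌉⁺ P? (isc refl)) (w , ⌈⌉-no P? out)
    open StrongIn T

  restrict : ∀ {P : V → Set} → (∀ v → Dec (P v)) → VSet → VSet
  restrict P? S = ⌈ (λ v → (S v ≟ true) ×-dec P? v) ⌉

  module _ {N : VSet} (conn : Connected N) where
    open Connected conn
    open Component conn

    module Adjacent {c d u v m₀} (pair : Pair c d) (Zu : Z ∋ u) (Zv : Z ∋ v) (uv : u # v)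
      (t : Trace c d u v N) (Sm₀ : Trace.S t ∋ m₀) (Nm₀ : N ∋ m₀) (m₀c : m₀ ~ c) where
      open Pair pair
      open Typed pair
      open Trace t

      no-d : ∀ {x} → N ∋ x → x ~ d → ⊥
      no-d Nx xd = sameType Nm₀ Nx m₀c xd

      #d : ∀ {x} → N ∋ x → x # d
      #d Nx with adnA (inM Nx) Ad
      ... | na e = e
      ... | ad e = ⊥-elim (no-d Nx e)

      apart : ∀ {x} → S ∋ x → x ≢ m₀ → m₀ # x
      apart {x} Sx d with adn m₀ x (λ e → d (≡-sym e))
      ... | na e = e
      ... | ad e = ⊥-elim (stable Sm₀ Sx e)

      share : ∀ {x z} → S ∋ x → N ∋ x → x ≢ m₀ → Z ∋ z → m₀ ~ z → x # z
      share {x} Sx Nx d Zz m₀z with adnZ (inM Nx) Zz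
      ... | na e = e
      ... | ad e = ⊥-elim (claw (~-sym m₀z) (~-sym e) (~-sym (Ad _ Zz)) (apart Sx d) (#d Nm₀) (#d Nx))

      -- It suffices to drop `m₀`. Another member of `S` in `N` adjacent to `c` would see `u` or `v`
      -- and form a claw there with `m₀` and `d`, and no maximal clique inside `N` contains `m₀`.
      both : m₀ ~ u → m₀ ~ v → Good pair N
      both m₀u m₀v = record
        { T = restrict P? S ; sub = λ e → proj₁ (proj₂ (⌈⌉⁻ Q? e))
        ; stable = λ a b → stable (proj₁ (⌈⌉⁻ Q? a)) (proj₁ (⌈⌉⁻ Q? b))
        ; off = λ e → off (⌈⌉⁻ Q? e) ; hits = hits′ }
        where
        P? : ∀ x → Dec (N ∋ x × x ≢ m₀)
        P? x = (N x ≟ true) ×-dec ¬? (x F.≟ m₀)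
        Q? : ∀ x → Dec (S ∋ x × N ∋ x × x ≢ m₀)
        Q? x = (S x ≟ true) ×-dec P? x
        off : ∀ {x} → S ∋ x × N ∋ x × x ≢ m₀ → ¬ x ~ c × ¬ x ~ d
        off (Sx , Nx , d) = (λ xc → [ (λ a → ~#⊥ a (share Sx Nx d Zu m₀u)) , (λ a → ~#⊥ a (share Sx Nx d Zv m₀v)) ]′
                                      (oneOfZ (inM Nx) Ac xc Zu Zv uv)) , no-d Nx
        hits′ : ∀ L → Max L → L ⊆ N → ∃ λ x → restrict P? S ∋ x × L ∋ x
        hits′ L m L⊆ with hits L m L⊆
        ... | x , Sx , Lx with x F.≟ m₀
        ...   | no d = x , ⌈⌉⁺ Q? (Sx , L⊆ Lx , d) , Lx
        ...   | yes refl with ∋? L c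
        ...     | inj₁ Lc = ⊥-elim (M.nA (inM (L⊆ Lc)) Ac)
        ...     | inj₂ e with outside m c e
        -- `w` misses `c`, and `d` has no neighbour in `N`, so `w` misses `Z`; thus `w , u , v` form
        -- a claw at `m₀`.
        ...       | w , Lw , wc = ⊥-elim (claw m₀w m₀u m₀v (off-Z Zu) (off-Z Zv) uv)
          where
          m₀w : m₀ ~ w
          m₀w = MaxIn.clq m Lx Lw λ { refl → ~#⊥ m₀c wc }
          off-Z : ∀ {z} → Z ∋ z → w # z
          off-Z Zz with adnZ (inM (L⊆ Lw)) Zz
          ... | na a = a
          ... | ad a = ⊥-elim ([ (λ b → ~#⊥ b wc) , no-d (L⊆ Lw) ]′ (oneOf (inM (L⊆ Lw)) Zz a Ac Ad cd))

      -- The strong set has to reach the edge `c v`. A vertex of `N` doing so is excluded by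
      -- `twoPlaces`, which leaves `v` itself; but with `v` and `m₀` chosen, nothing can reach the
      -- edge `d u`.
      one-sided : m₀ ~ u → m₀ # v → ⊥
      one-sided m₀u m₀v with edge (isc refl) (isv refl) (Ac v Zv)
      ... | h , Sh , hc , hv with place Sh
      ...   | isc refl = stable Sm₀ Sh m₀c
      ...   | isd refl = [ (λ e → proj₂ cd (≡-sym e)) , (λ a → ~#⊥ a (#-sym cd)) ]′ hc
      ...   | isu refl = [ proj₂ uv , (λ a → ~#⊥ a uv) ]′ hv
      ...   | inN Nh = twoPlaces no-d Nm₀ Nh m₀c h~c Zu Zv uv m₀u m₀v h~v (share Sh Nh h≢m₀ Zu m₀u) (apart Sh h≢m₀)
        where
        h~c : h ~ c
        h~c = [ (λ { refl → ⊥-elim (M.nA (inM Nh) Ac) }) , (λ a → a) ]′ hc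
        h~v : h ~ v
        h~v = [ (λ { refl → ⊥-elim (M≢Z (inM Nh) Zv refl) }) , (λ a → a) ]′ hv
        h≢m₀ : h ≢ m₀
        h≢m₀ refl = ~#⊥ h~v m₀v
      ...   | isv refl with edge (isd refl) (isu refl) (Ad u Zu)
      ...     | k , Sk , kd , ku with place Sk
      ...       | isc refl = [ proj₂ cd , (λ a → ~#⊥ a cd) ]′ kd
      ...       | isd refl = stable Sk Sh (Ad v Zv)
      ...       | isu refl = stable Sm₀ Sk m₀u
      ...       | isv refl = [ (λ e → proj₂ uv (≡-sym e)) , (λ a → ~#⊥ (~-sym a) uv) ]′ ku
      ...       | inN Nk   = [ (λ { refl → M.nA (inM Nk) Ad }) , no-d Nk ]′ kd

    adjacent : ∀ {c d u v m₀} (pair : Pair c d) → Z ∋ u → Z ∋ v → u # v →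
      (t : Trace c d u v N) → Trace.S t ∋ m₀ → N ∋ m₀ → m₀ ~ c → Good pair N
    adjacent pair Zu Zv uv t Sm Nm mc with adnZ (inM Nm) Zu | adnZ (inM Nm) Zv
    ... | ad a | ad b = Adjacent.both pair Zu Zv uv t Sm Nm mc a b
    ... | ad a | na b = ⊥-elim (Adjacent.one-sided pair Zu Zv uv t Sm Nm mc a b)
    ... | na a | ad b = ⊥-elim (Adjacent.one-sided pair Zv Zu (#-sym uv) (trace-uv t) Sm Nm mc b a)
    ... | na a | na b = ⊥-elim ([ (λ e → ~#⊥ e a) , (λ e → ~#⊥ e b) ]′ (oneOfZ (inM Nm) (Pair.Ac pair) mc Zu Zv uv))

    from-trace : ∀ {c d u v} (pair : Pair c d) → Z ∋ u → Z ∋ v → u # v → Trace c d u v N → Good pair N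
    from-trace {c} {d} pair Zu Zv uv t
      with any? (λ m → (Trace.S t m ≟ true) ×-dec (N m ≟ true) ×-dec ~? m c)
         | any? (λ m → (Trace.S t m ≟ true) ×-dec (N m ≟ true) ×-dec ~? m d)
    ... | yes (m , Sm , Nm , mc) | _ = adjacent pair Zu Zv uv t Sm Nm mc
    ... | no _ | yes (m , Sm , Nm , md) = flip (adjacent (swap pair) Zu Zv uv (trace-cd t) Sm Nm md)
      where
      flip : Good (swap pair) N → Good pair N
      flip g = record { T = T ; sub = sub ; stable = stable ; off = λ e → proj₂ (off e) , proj₁ (off e) ; hits = hits }
        where open Good g
    ... | no nc | no nd = record
      { T = restrict N? S ; sub = λ e → proj₂ (⌈⌉⁻ Q? e)
      ; stable = λ a b → stable (proj₁ (⌈⌉⁻ Q? a)) (proj₁ (⌈⌉⁻ Q? b))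
      ; off = λ e → let (Sx , Nx) = ⌈⌉⁻ Q? e in (λ a → nc (_ , Sx , Nx , a)) , (λ a → nd (_ , Sx , Nx , a))
      ; hits = hits′ }
      where
      open Trace t
      N? : ∀ x → Dec (N ∋ x)
      N? x = N x ≟ true
      Q? : ∀ x → Dec (S ∋ x × N ∋ x)
      Q? x = (S x ≟ true) ×-dec N? x
      hits′ : ∀ L → Max L → L ⊆ N → ∃ λ x → restrict N? S ∋ x × L ∋ x
      hits′ L m L⊆ with hits L m L⊆
      ... | x , Sx , Lx = x , ⌈⌉⁺ Q? (Sx , L⊆ Lx) , Lx

    -- The centre provides the vertex outside `N` and the four added ones: the hub if it is in `Z`;
    -- otherwise the hub or its neighbour `p`, whichever differs from both `c` and `d`.
    good-connected : ∀ {c d} (pair : Pair c d) → Good pair N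
    good-connected {c} {d} pair with centre
    ... | inZ {y} {u} {v} Zy Zu Zv yu yv uv = from-trace pair Zu Zv uv (trace (y , λ where
            (isc refl) → t≢f Zy (A∉Z Ac)
            (isd refl) → t≢f Zy (A∉Z Ad)
            (isu refl) → ~⇒≢ yu refl
            (isv refl) → ~⇒≢ yv refl
            (inN Ny)   → M≢Z (inM Ny) Zy refl))
      where open Pair pair
    ... | inA {y} {p} {q} Ay Ap Aq yp yq pq = from-trace pair Zz₀ Zz₁ z₀z₁ (trace third)
      where
      open Pair pair
      fresh : ∀ {w} → A w → w ≢ c → w ≢ d → ¬ Place c d z₀ z₁ N w
      fresh Aw wc wd (isc e)    = wc e
      fresh Aw wc wd (isd e)    = wd e
      fresh Aw wc wd (isu refl) = t≢f Zz₀ (A∉Z Aw)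
      fresh Aw wc wd (isv refl) = t≢f Zz₁ (A∉Z Aw)
      fresh Aw wc wd (inN Nw)   = M.nA (inM Nw) Aw
      third : ∃ λ w → ¬ Place c d z₀ z₁ N w
      third with y F.≟ c | y F.≟ d
      ... | yes refl | _        = p , fresh Ap (λ { refl → ~⇒≢ yp refl }) (λ { refl → ~#⊥ yp cd })
      ... | no _     | yes refl = p , fresh Ap (λ { refl → ~#⊥ yp (#-sym cd) }) (λ { refl → ~⇒≢ yp refl })
      ... | no a     | no b     = y , fresh Ay a b

  M? : ∀ v → Dec (M v)
  M? v with Z v ≟ false | A? v
  ... | yes a | no b  = yes (mk a b)
  ... | no a  | _     = no λ m → a (M.Zf m)
  ... | yes _ | yes b = no λ m → M.nA m b

  -- For `Y` inside `M`, this says that `Y` is a union of components of the graph induced on `M`.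
  Separated : VSet → Set
  Separated Y = ∀ {u w} → Y ∋ u → M w → u ~ w → Y ∋ w

  component : ∀ Y → Separated Y → ∀ {v} → M v → Y v ≡ false →
    ∃ λ C → Connected C × C ∋ v × (∀ {x} → C ∋ x → Y x ≡ false) × Separated C
  component Y sepY {v} Mv Yv = result (saturate {P = P} {Q = Q} step ⌈ F._≟ v ⌉ start)
    where
    P Q : VSet → Set
    P C = C ∋ v × (∀ x → C ∋ x → M x × Y x ≡ false × (v ≡ x ⊎ Walk (C ∋_) v x))
    Q C = ∀ u w → C ∋ u → M w → u ~ w → C ∋ w
    start : P ⌈ F._≟ v ⌉
    start = ⌈⌉⁺ (F._≟ v) refl , λ x e → at x (⌈⌉⁻ (F._≟ v) e)
      where
      at : ∀ x → x ≡ v → M x × Y x ≡ false × (v ≡ x ⊎ Walk (⌈ F._≟ v ⌉ ∋_) v x)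
      at x refl = Mv , Yv , inj₁ refl
    step : ∀ C → P C → Q C ⊎ ∃ λ D → ∃ λ w → P D × C ⊆ D × C w ≡ false × D w ≡ true
    step C (Cv , inC) with any? (λ u → any? λ w → (C u ≟ true) ×-dec M? w ×-dec ~? u w ×-dec (C w ≟ false))
    ... | no without = inj₁ λ u w Cu Mw uw → [ (λ e → e) , (λ e → ⊥-elim (without (u , w , Cu , Mw , uw , e))) ]′ (∋? C w)
    ... | yes (u , w , Cu , Mw , uw , Cw) =
      inj₂ (add C w , w , (add-old C w Cv , λ x e → at x (add⁻ C w e)) , add-old C w , Cw , add-new C w)
      where
      Yw : Y w ≡ false
      Yw with ∋? Y w
      ... | inj₂ e = e
      ... | inj₁ e = ⊥-elim (t≢f (sepY e (proj₁ (inC u Cu)) (~-sym uw)) (proj₁ (proj₂ (inC u Cu))))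
      up : ∀ {x} → v ≡ x ⊎ Walk (C ∋_) v x → v ≡ x ⊎ Walk (add C w ∋_) v x
      up (inj₁ e) = inj₁ e
      up (inj₂ p) = inj₂ (walk-map (add-old C w) p)
      at : ∀ x → C ∋ x ⊎ x ≡ w → M x × Y x ≡ false × (v ≡ x ⊎ Walk (add C w ∋_) v x)
      at x (inj₁ Cx) = proj₁ (inC x Cx) , proj₁ (proj₂ (inC x Cx)) , up (proj₂ (proj₂ (inC x Cx)))
      at x (inj₂ refl) = Mw , Yw , inj₂ (snoc (up (proj₂ (proj₂ (inC u Cu)))))
        where
        snoc : v ≡ u ⊎ Walk (add C w ∋_) v u → Walk (add C w ∋_) v w
        snoc (inj₁ refl) = one uw
        snoc (inj₂ p)    = walk-snoc p (add-old C w Cu) uw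
    result : (∃ λ C → P C × Q C) → ∃ λ C → Connected C × C ∋ v × (∀ {x} → C ∋ x → Y x ≡ false) × Separated C
    result (C , (Cv , inC) , q) = C ,
      record { inM = λ Cx → proj₁ (inC _ Cx) ; Nroot = Cv ; reach = λ Cx → proj₂ (proj₂ (inC _ Cx)) } ,
      Cv , (λ Cx → proj₁ (proj₂ (inC _ Cx))) , λ Cu Mw uw → q _ _ Cu Mw uw

  member : ∀ {L} → Max L → ∃ λ x → L ∋ x
  member {L} m with ∋? L z₀
  ... | inj₁ e = z₀ , e
  ... | inj₂ e with outside m z₀ e
  ...   | x , Lx , _ = x , Lx

  module _ {c d : V} (pair : Pair c d) where

    private
      union : VSet → VSet → VSet
      union X Y v = X v ∨ Y v

      ∪ˡ : ∀ X Y → X ⊆ union X Y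
      ∪ˡ X Y e rewrite e = refl

      ∪ʳ : ∀ X Y → Y ⊆ union X Y
      ∪ʳ X Y {v} e with X v
      ... | true  = refl
      ... | false = e

      ∪⁻ : ∀ X Y {v} → union X Y ∋ v → X ∋ v ⊎ Y ∋ v
      ∪⁻ X Y {v} e with X v
      ... | true  = inj₁ refl
      ... | false = inj₂ e

    good-union : ∀ X Y → Separated X → Separated Y → (∀ {x} → X ∋ x → M x) → (∀ {x} → Y ∋ x → M x) →
      (∀ {x} → Y ∋ x → X x ≡ false) → Good pair X → Good pair Y → Good pair (union X Y)
    good-union X Y sX sY XM YM disj g h = record
      { T = union G₁.T G₂.T
      ; sub = λ e → [ (λ a → ∪ˡ X Y (G₁.sub a)) , (λ b → ∪ʳ X Y (G₂.sub b)) ]′ (∪⁻ G₁.T G₂.T e)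
      ; stable = λ a b → st (∪⁻ G₁.T G₂.T a) (∪⁻ G₁.T G₂.T b)
      ; off = λ e → [ G₁.off , G₂.off ]′ (∪⁻ G₁.T G₂.T e)
      ; hits = hits }
      where
      module G₁ = Good g
      module G₂ = Good h
      cross : ∀ {x y} → X ∋ x → Y ∋ y → x ~ y → ⊥
      cross Xx Yy a = t≢f (sX Xx (YM Yy) a) (disj Yy)
      st : ∀ {x y} → G₁.T ∋ x ⊎ G₂.T ∋ x → G₁.T ∋ y ⊎ G₂.T ∋ y → x ~ y → ⊥
      st (inj₁ a) (inj₁ b) e = G₁.stable a b e
      st (inj₁ a) (inj₂ b) e = cross (G₁.sub a) (G₂.sub b) e
      st (inj₂ a) (inj₁ b) e = cross (G₁.sub b) (G₂.sub a) (~-sym e)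
      st (inj₂ a) (inj₂ b) e = G₂.stable a b e
      within : ∀ {L W x} → Max L → L ⊆ union X Y → Separated W → L ∋ x → W ∋ x → L ⊆ W
      within {x = x} m L⊆ sW Lx Wx {v} Lv with x F.≟ v
      ... | yes refl = Wx
      ... | no d     = sW Wx ([ XM , YM ]′ (∪⁻ X Y (L⊆ Lv))) (MaxIn.clq m Lx Lv d)
      hits : ∀ L → Max L → L ⊆ union X Y → ∃ λ x → union G₁.T G₂.T ∋ x × L ∋ x
      hits L m L⊆ with member m
      ... | x , Lx with ∪⁻ X Y (L⊆ Lx)
      ...   | inj₁ Xx = let (w , Tw , Lw) = G₁.hits L m (within m L⊆ sX Lx Xx) in w , ∪ˡ G₁.T G₂.T Tw , Lw
      ...   | inj₂ Yx = let (w , Tw , Lw) = G₂.hits L m (within m L⊆ sY Lx Yx) in w , ∪ʳ G₁.T G₂.T Tw , Lw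

    good-M : ∃ λ X → Good pair X × (∀ {v} → M v → X ∋ v)
    good-M = pack (saturate {P = P} {Q = Q} step (λ _ → false) start)
      where
      P Q : VSet → Set
      P X = (∀ x → X ∋ x → M x) × (∀ u w → X ∋ u → M w → u ~ w → X ∋ w) × Good pair X
      Q X = ∀ v → M v → X ∋ v
      start : P (λ _ → false)
      start = (λ _ ()) , (λ _ _ ()) , record
        { T = λ _ → false ; sub = λ () ; stable = λ () ; off = λ ()
        ; hits = λ L m L⊆ → ⊥-elim (absurd (L⊆ (proj₂ (member m)))) }
        where
        absurd : false ≡ true → ⊥
        absurd ()
      step : ∀ X → P X → Q X ⊎ ∃ λ Y → ∃ λ w → P Y × X ⊆ Y × X w ≡ false × Y w ≡ true
      step X (XM , sX , g) with any? (λ v → M? v ×-dec (X v ≟ false))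
      ... | no without = inj₁ λ v Mv → [ (λ e → e) , (λ e → ⊥-elim (without (v , Mv , e))) ]′ (∋? X v)
      ... | yes (v , Mv , Xv) with component X (λ a b e → sX _ _ a b e) Mv Xv
      ...   | C , conn , Cv , disj , sC = inj₂ (union X C , v ,
              ((λ x e → [ XM x , Connected.inM conn ]′ (∪⁻ X C e)) ,
               (λ u w e Mw uw → [ (λ a → ∪ˡ X C (sX u w a Mw uw)) , (λ b → ∪ʳ X C (sC b Mw uw)) ]′ (∪⁻ X C e)) ,
               good-union X C (λ a b e → sX _ _ a b e) sC (λ {x} → XM x) (Connected.inM conn) disj g (good-connected conn pair)) ,
              ∪ˡ X C , Xv , ∪ʳ X C Cv)
      pack : (∃ λ X → P X × Q X) → ∃ λ X → Good pair X × (∀ {v} → M v → X ∋ v)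
      pack (X , (_ , _ , g) , q) = X , g , λ {v} → q v

    open Pair pair

    typed : ∀ {m x} → M m → A x ⊎ Z ∋ x → m ~ x → m ~ c ⊎ m ~ d
    typed Mm (inj₂ Zx) mx = oneOf Mm Zx mx Ac Ad cd
    typed Mm (inj₁ Ax) mx with oneOfZ Mm Ax mx Zz₀ Zz₁ z₀z₁
    ... | inj₁ a = oneOf Mm Zz₀ a Ac Ad cd
    ... | inj₂ a = oneOf Mm Zz₁ a Ac Ad cd

    place-of : ∀ v → M v ⊎ A v ⊎ Z ∋ v
    place-of v with ∋? Z v | A? v
    ... | inj₁ a | _     = inj₂ (inj₂ a)
    ... | inj₂ _ | yes b = inj₂ (inj₁ b)
    ... | inj₂ a | no b  = inj₁ (mk a b)

    -- A maximal clique avoiding both has a member `l₁` missing `c` and a member `l₂` missing `d`,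
    -- neither of them in `Z`. Two members of `A` contradict `sep` or `triple`, two of `M`
    -- contradict `sameSide`, and one of each contradicts `closed`.
    meets-pair : ∀ L → Max L → ∀ {x} → L ∋ x → A x ⊎ Z ∋ x → L ∋ c ⊎ L ∋ d
    meets-pair L m {x} Lx Px with ∋? L c | ∋? L d
    ... | inj₁ a | _      = inj₁ a
    ... | inj₂ _ | inj₁ b = inj₂ b
    ... | inj₂ a | inj₂ b with outside m c a | outside m d b
    ...   | l₁ , L₁ , l₁c | l₂ , L₂ , l₂d = ⊥-elim (go (place-of l₁) (place-of l₂))
      where
      near : ∀ {l} → L ∋ l → M l → l ~ x
      near Ll Ml = MaxIn.clq m Ll Lx λ { refl → [ M.nA Ml , (λ e → t≢f e (M.Zf Ml)) ]′ Px }
      l₁d : M l₁ → l₁ ~ d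
      l₁d Ml = [ (λ e → ⊥-elim (~#⊥ e l₁c)) , (λ e → e) ]′ (typed Ml Px (near L₁ Ml))
      l₂c : M l₂ → l₂ ~ c
      l₂c Ml = [ (λ e → e) , (λ e → ⊥-elim (~#⊥ e l₂d)) ]′ (typed Ml Px (near L₂ Ml))
      go : M l₁ ⊎ A l₁ ⊎ Z ∋ l₁ → M l₂ ⊎ A l₂ ⊎ Z ∋ l₂ → ⊥
      go (inj₂ (inj₂ Z₁)) _ = ~#⊥ (~-sym (Ac _ Z₁)) l₁c
      go _ (inj₂ (inj₂ Z₂)) = ~#⊥ (~-sym (Ad _ Z₂)) l₂d
      go (inj₂ (inj₁ A₁)) (inj₂ (inj₁ A₂)) with l₁ F.≟ l₂
      ... | yes refl = triple A₁ Ac Ad l₁c l₂d cd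
      ... | no d     = sep A₁ A₂ l₁c l₂d (MaxIn.clq m L₁ L₂ d)
      go (inj₂ (inj₁ A₁)) (inj₁ M₂) = closed (M.Zf M₂) (M.nA M₂) A₁ Ac l₁c
        (MaxIn.clq m L₂ L₁ (M≢A M₂ A₁)) (l₂c M₂)
      go (inj₁ M₁) (inj₂ (inj₁ A₂)) = closed (M.Zf M₁) (M.nA M₁) A₂ Ad l₂d
        (MaxIn.clq m L₁ L₂ (M≢A M₁ A₂)) (l₁d M₁)
      go (inj₁ M₁) (inj₁ M₂) = sameSide M₁ M₂ Ad Ac (#-sym cd)
        (MaxIn.clq m L₁ L₂ λ { refl → ~#⊥ (l₁d M₁) l₂d }) (l₁d M₁) (l₂c M₂)

    strong : ∀ X → Good pair X → (∀ {v} → M v → X ∋ v) → StrongIn (λ _ → true)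
    strong X g M⊆X = record
      { S = S ; sub = λ _ → refl ; stable = λ a b → st (view a) (view b) ; hits = hits′ }
      where
      open Good g
      S : VSet
      S = add (add T c) d
      view : ∀ {v} → S ∋ v → T ∋ v ⊎ v ≡ c ⊎ v ≡ d
      view {v} e with add⁻ (add T c) d e
      ... | inj₂ q = inj₂ (inj₂ q)
      ... | inj₁ e′ with add⁻ T c e′
      ...   | inj₁ a = inj₁ a
      ...   | inj₂ q = inj₂ (inj₁ q)
      st : ∀ {x y} → T ∋ x ⊎ x ≡ c ⊎ x ≡ d → T ∋ y ⊎ y ≡ c ⊎ y ≡ d → x ~ y → ⊥
      st (inj₁ a)           (inj₁ b)           e = stable a b e
      st (inj₁ a)           (inj₂ (inj₁ refl)) e = proj₁ (off a) e
      st (inj₁ a)           (inj₂ (inj₂ refl)) e = proj₂ (off a) e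
      st (inj₂ (inj₁ refl)) (inj₁ b)           e = proj₁ (off b) (~-sym e)
      st (inj₂ (inj₂ refl)) (inj₁ b)           e = proj₂ (off b) (~-sym e)
      st (inj₂ (inj₁ refl)) (inj₂ (inj₁ refl)) e = ~⇒≢ e refl
      st (inj₂ (inj₂ refl)) (inj₂ (inj₂ refl)) e = ~⇒≢ e refl
      st (inj₂ (inj₁ refl)) (inj₂ (inj₂ refl)) e = ~#⊥ e cd
      st (inj₂ (inj₂ refl)) (inj₂ (inj₁ refl)) e = ~#⊥ (~-sym e) cd
      hits′ : ∀ L → Max L → ∃ λ x → S ∋ x × L ∋ x
      hits′ L m with any? (λ x → (L x ≟ true) ×-dec (A? x ⊎-dec (Z x ≟ true)))
      ... | yes (x , Lx , Px) with meets-pair L m Lx Px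
      ...   | inj₁ Lc = c , add-old (add T c) d (add-new T c) , Lc
      ...   | inj₂ Ld = d , add-new (add T c) d , Ld
      hits′ L m | no without with hits L m (λ {v} Lv → M⊆X (mk (Zf v Lv) λ Av → without (v , Lv , inj₁ Av)))
        where
        Zf : ∀ v → L ∋ v → Z v ≡ false
        Zf v Lv with ∋? Z v
        ... | inj₁ e = ⊥-elim (without (v , Lv , inj₂ e))
        ... | inj₂ e = e
      ...   | x , Tx , Lx = x , add-old (add T c) d (add-old T c Tx) , Lx

  strong-from-fat : StrongIn (λ _ → true)
  strong-from-fat = let (c , d , pair) = strongPair
                        (X , g , M⊆X)  = good-M pair
                    in strong pair X g M⊆X

-- Induced subgraphs and the induction on the number of vertices

module _ (G : Graph) {m : ℕ} (f : Fin m → Fin (n G)) (inj : Injective _≡_ _≡_ f) where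

  induce : Graph
  induce = record
    { n = m ; adj = λ x y → adj G (f x) (f y)
    ; sym = λ x y → Graph.sym G (f x) (f y) ; irrefl = λ x → irrefl G (f x) }

  contains-induce : ∀ {V : Set} {E : V → V → Bool} → Contains induce E → Contains G E
  contains-induce (g , g-inj , same) = (λ x → f (g x)) , (λ e → g-inj (inj e)) , same

  clawFree-induce : ClawFree G → ClawFree induce
  clawFree-induce cf h = cf (contains-induce h)

  innocent-induce : Innocent G → Innocent induce
  innocent-induce (a , b , c , d , e) =
    (λ { (k , o , l , h) → a (k , o , l , contains-induce h) }) ,
    (λ { (k , l , h) → b (k , l , contains-induce h) }) ,
    (λ { (k , l , o , h) → c (k , l , o , contains-induce h) }) ,
    (λ { (k , r , l , p , q , s , t , u , v , h) → d (k , r , l , p , q , s , t , u , v , contains-induce h) }) ,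
    (λ { (k , l , p , q , s , t , h) → e (k , l , p , q , s , t , contains-induce h) })

  strong-induce : ∀ U → (∀ v → U v ≡ true → ∃ λ i → f i ≡ v) →
    StrongSets.StrongIn induce (λ i → U (f i)) → StrongSets.StrongIn G U
  strong-induce U onto T = record
    { S = S ; sub = λ {v} e → sub′ (⌈⌉⁻ S? {v} e)
    ; stable = λ a b → st (⌈⌉⁻ S? a) (⌈⌉⁻ S? b) ; hits = hits′ }
    where
    open Lists G
    open Cliques G
    open Sets {n G}
    module T = StrongSets.StrongIn T
    S? : ∀ v → Dec (∃ λ i → T.S i ≡ true × f i ≡ v)
    S? v = any? λ i → (T.S i ≟ true) ×-dec (f i F.≟ v)
    S : VSet
    S = ⌈ S? ⌉
    sub′ : ∀ {v} → (∃ λ i → T.S i ≡ true × f i ≡ v) → U v ≡ true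
    sub′ (i , Ti , refl) = T.sub Ti
    st : ∀ {x y} → (∃ λ i → T.S i ≡ true × f i ≡ x) → (∃ λ i → T.S i ≡ true × f i ≡ y) → x ~ y → ⊥
    st (i , Ti , refl) (j , Tj , refl) = T.stable Ti Tj
    hits′ : ∀ L → MaxIn U L → ∃ λ x → S ∋ x × L ∋ x
    hits′ L M with T.hits (λ i → L (f i)) M′
      where
      open MaxIn M
      max′ : ∀ i → U (f i) ≡ true → L (f i) ≡ false → ∃ λ j → L (f j) ≡ true × Base._#_ induce j i
      max′ i Ui Li with max (f i) Ui Li
      ... | u , Lu , e , d with onto u (sub Lu)
      ...   | j , refl = j , Lu , e , λ { refl → d refl }
      M′ : Cliques.MaxIn induce (λ i → U (f i)) (λ i → L (f i))
      M′ = record { sub = sub ; clq = λ a b d → clq a b λ e → d (inj e) ; max = max′ }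
    ... | i , Ti , Li = f i , ⌈⌉⁺ S? (i , Ti , refl) , Li

skip : ∀ {k m} → k ≡ suc m → (w : Fin k) →
  ∃ λ (f : Fin m → Fin k) → Injective _≡_ _≡_ f × (∀ v → v ≢ w → ∃ λ i → f i ≡ v)
skip refl w = punchIn w , punchIn-injective w _ _ , λ v d →
  punchOut {i = w} {j = v} (λ e → d (≡-sym e)) , punchIn-punchOut {i = w} {j = v} (λ e → d (≡-sym e))

strong-whole : ∀ G → ClawFree G → Innocent G → Fin (n G) →
  (∀ U → (∃ λ v → U v ≡ true) → (∃ λ w → U w ≡ false) → StrongSets.StrongIn G U) →
  StrongSets.StrongIn G (λ _ → true)
strong-whole G cf inn v₀ ih
  with any? (λ c → any? λ w → any? λ x → any? λ y → any? λ z →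
    ~? c w ×-dec ~? c x ×-dec ~? c y ×-dec ~? c z ×-dec ~? w x ×-dec ~? x y ×-dec ~? y z ×-dec ~? z w ×-dec
    ((adj G w y ≟ false) ×-dec ¬? (w F.≟ y)) ×-dec ((adj G x z ≟ false) ×-dec ¬? (x F.≟ z)))
  where open Cliques G
... | yes (_ , _ , _ , _ , _ , cw , cx , cy , cz , wx , xy , yz , zw , wy , xz)
      with FatSquares.from-W4 G (forbidden G cf inn) cw cx cy cz wx xy yz zw wy xz
...   | _ , fat , closed = Assemble.strong-from-fat G (forbidden G cf inn) fat closed ih
strong-whole G cf inn v₀ ih | no none with W4FreeCase.w4Free-strong G (forbidden G cf inn)
  (λ a b c d e f g h i j → none (_ , _ , _ , _ , _ , a , b , c , d , e , f , g , h , i , j)) v₀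
... | S , stable , hits = record { S = S ; sub = λ _ → refl ; stable = stable ; hits = hits }

-- A proper subset misses some `w` and is treated in `G` without `w`, which has one vertex less. So
-- the whole graph can rely on all of its nonempty proper subsets.
strong-in     : ∀ m G → n G ≡ m → ClawFree G → Innocent G →
  ∀ U → (∃ λ v → U v ≡ true) → StrongSets.StrongIn G U
strong-proper : ∀ m G → n G ≡ suc m → ClawFree G → Innocent G →
  ∀ U → (∃ λ v → U v ≡ true) → (∃ λ w → U w ≡ false) → StrongSets.StrongIn G U

strong-in zero    G e cf inn U (v , _) with subst Fin e v
... | ()
strong-in (suc m) G e cf inn U (v , Uv) with any? (λ w → U w ≟ false)
... | yes out = strong-proper m G e cf inn U (v , Uv) out
... | no full = record
  { S = S ; sub = λ {x} _ → whole x ; stable = stable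
  ; hits = λ L M → hits L (record { sub = λ _ → refl ; clq = MaxIn.clq M ; max = λ x _ → MaxIn.max M x (whole x) }) }
  where
  open Cliques G
  open StrongSets.StrongIn (strong-whole G cf inn v (strong-proper m G e cf inn))
  whole : ∀ x → U x ≡ true
  whole x with U x in Ux
  ... | true  = refl
  ... | false = ⊥-elim (full (x , Ux))

strong-proper m G e cf inn U (v , Uv) (w , Uw) with skip e w
... | f , inj , onto = strong-induce G f inj U (λ x Ux → onto x (avoid Ux))
      (strong-in m (induce G f inj) refl (clawFree-induce G f inj cf) (innocent-induce G f inj inn)
        (λ i → U (f i)) (nonempty (onto v (avoid Uv))))
  where
  avoid : ∀ {x} → U x ≡ true → x ≢ w
  avoid Ux refl = Base.t≢f G Ux Uw
  nonempty : (∃ λ i → f i ≡ v) → ∃ λ i → U (f i) ≡ true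
  nonempty (i , refl) = i , Uv

theorem2p2 : (G : Graph) → 0 < n G → ClawFree G → Innocent G →
    ∃[ S ] IsStrongStable G S
theorem2p2 G pos cf inn = tabulate S , stable′ , hits′
  where
  open Lists G
  open Cliques G
  -- `pos` provides the vertex that makes the full set nonempty.
  open StrongSets.StrongIn (strong-in (n G) G refl cf inn (λ _ → true) (fromℕ< pos , refl))
  ∈⁻ : ∀ {x} → x ∈ˢ tabulate S → S ∋ x
  ∈⁻ {x} m = trans (≡-sym (lookup∘tabulate S x)) ([]=⇒lookup m)
  stable′ : ∀ x y → x ∈ˢ tabulate S → y ∈ˢ tabulate S → adj G x y ≡ false
  stable′ x y a b with adj G x y in e
  ... | true  = ⊥-elim (stable (∈⁻ a) (∈⁻ b) e)
  ... | false = refl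
  hits′ : ∀ K → IsMaximalClique G K → ∃[ v ] (v ∈ˢ tabulate S × v ∈ˢ K)
  hits′ K (clique , maximal) with hits (lookupᵛ K) M
    where
    max′ : ∀ v → lookupᵛ K v ≡ false → ∃ λ u → lookupᵛ K u ≡ true × u # v
    max′ v e with maximal v (λ m → t≢f ([]=⇒lookup m) e)
    ... | u , Ku , d , uv = u , []=⇒lookup Ku , uv , d
    M : Max (lookupᵛ K)
    M = record { sub = λ _ → refl ; clq = λ a b → clique _ _ (lookup⇒[]= _ K a) (lookup⇒[]= _ K b) ; max = λ v _ → max′ v }
  ... | v , Sv , Kv = v , lookup⇒[]= v _ (trans (lookup∘tabulate S v) Sv) , lookup⇒[]= v K Kv
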